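{- Let $t_2(2,q)$ denote the smallest size of a complete arc in $PG(2,q)$, let $q$ range over prime powers, and let $Q=\{961,1024,1369,1681,2401\}$. Then: $t_2(2,q)<4\sqrt{q}$ for $2\le q\le 841$ and for $q\in Q$; $t_2(2,q)\le 3\sqrt{q}$ for $2\le q\le 89$ and $q=101$; $t_2(2,q)<3.5\sqrt{q}$ for $2\le q\le 277$; $t_2(2,q)<3.8\sqrt{q}$ for $2\le q\le 509$ and $q\in\{521,523,529,601,661\}$; $t_2(2,q)\le 4\sqrt{q}-9$ for $37\le q\le 211$ and $q\in\{23,227,229,233,241,243,256,257,661\}$; $t_2(2,q)\le 4\sqrt{q}-8$ for $23\le q\le 307$ and $q\in\{317,343,601,661\}$; $t_2(2,q)\le 4\sqrt{q}-7$ for $19\le q\le 353$ and $q\in\{16,361,373,383,601,661\}$; $t_2(2,q)\le 4\sqrt{q}-6$ for $9\le q\le 409$ and $q\in\{421,431,433,443,463,601,661\}$; $t_2(2,q)\le 4\sqrt{q}-5$ for $8\le q\le 499$ and $q\in\{509,521,523,529,601,661\}$; $t_2(2,q)\le 4\sqrt{q}-4$ for $7\le q\le 557$, $q\in\{569,577,601,625,661,729,841\}$ and $q\in Q$; $t_2(2,q)<4\sqrt{q}-3$ for $7\le q\le 641$, $q\in\{661,729,841\}$ and $q\in Q$; $t_2(2,q)\le 4\sqrt{q}-2$ for $3\le q\le 691$, $q\in\{709,729,841\}$ and $q\in Q$; $t_2(2,q)<4\sqrt{q}-1$ for $2\le q\le 761$, $q=841$ and $q\in Q$.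
   Context: A $k$-arc in $PG(2,q)$ is a set of $k$ points no three collinear; it is complete if not contained in a $(k+1)$-arc. -}

module Defs where

open import Data.Nat using (ℕ; zero; suc; _≤_; _<_) renaming (_+_ to _+ℕ_; _*_ to _*ℕ_; _^_ to _^ℕ_)
open import Data.Nat.Primality using (Prime)
open import Data.Fin using (Fin)
open import Data.List using (List; _∷_; length; lookup)
open import Data.Product using (Σ; ∃; ∃-syntax; _×_; _,_)
open import Relation.Binary.PropositionalEquality using (_≡_; _≢_)
open import Relation.Nullary using (¬_)
open import Algebra.Structures using (IsCommutativeRing)

IsPrimePower : ℕ → Set
IsPrimePower q = ∃[ p ] ∃[ e ] (Prime p × q ≡ p ^ℕ suc e)

-- A finite field with q elements, carried by Fin q (propositional equality).
-- Every finite field of order q is isomorphic to one of these.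

record FiniteField (q : ℕ) : Set where
  field
    _+_ _*_ : Fin q → Fin q → Fin q
    -_      : Fin q → Fin q
    0F 1F   : Fin q
    isCommutativeRing : IsCommutativeRing _≡_ _+_ _*_ -_ 0F 1F
    0≢1     : 0F ≢ 1F
    inverse : ∀ x → x ≢ 0F → ∃[ y ] (x * y ≡ 1F)

module Plane {q : ℕ} (F : FiniteField q) where
  open FiniteField F

  record Vec3 : Set where
    constructor ⟨_,_,_⟩
    field x y z : Fin q

  NonZero3 : Vec3 → Set
  NonZero3 ⟨ a , b , c ⟩ = ¬ (a ≡ 0F × b ≡ 0F × c ≡ 0F)

  -- a point of PG(2,F) is a nonzero triple; two triples give the same point
  -- iff they are proportional by a nonzero scalar
  SamePoint : Vec3 → Vec3 → Set
  SamePoint ⟨ a , b , c ⟩ ⟨ a' , b' , c' ⟩ =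
    ∃[ λ' ] (λ' ≢ 0F × a' ≡ λ' * a × b' ≡ λ' * b × c' ≡ λ' * c)

  Incident : Vec3 → Vec3 → Set
  Incident ⟨ l , m , n ⟩ ⟨ a , b , c ⟩ = (l * a) + ((m * b) + (n * c)) ≡ 0F

  Collinear : Vec3 → Vec3 → Vec3 → Set
  Collinear P Q R = ∃[ L ] (NonZero3 L × Incident L P × Incident L Q × Incident L R)

  -- a set of points, represented as a list of homogeneous coordinate triples
  -- (one representative per point); its size is the length of the list.
  -- A k-arc: k points of PG(2,F), pairwise distinct, no three collinear.
  record IsArc (A : List Vec3) : Set where
    field
      points   : ∀ i → NonZero3 (lookup A i)
      distinct : ∀ i j → i ≢ j → ¬ SamePoint (lookup A i) (lookup A j)
      noThree  : ∀ i j k → i ≢ j → i ≢ k → j ≢ k →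
                 ¬ Collinear (lookup A i) (lookup A j) (lookup A k)

  IsCompleteArc : List Vec3 → Set
  IsCompleteArc A = IsArc A × (∀ P → ¬ IsArc (P ∷ A))

  IsT2 : ℕ → Set
  IsT2 k = (∃[ A ] (IsCompleteArc A × length A ≡ k))
         × (∀ A → IsCompleteArc A → k ≤ length A)

-- Comparisons with (a/b)·√q for naturals, squared out (both sides ≥ 0):
--   t <[ a / b ]√ q   means   t < (a/b)·√q   i.e.  b²t² < a²q
--   t ≤[ a / b ]√ q   means   t ≤ (a/b)·√q   i.e.  b²t² ≤ a²q
-- so "t ≤ 4√q − c" is written  (t + c) ≤[ 4 / 1 ]√ q.

_<[_/_]√_ : ℕ → ℕ → ℕ → ℕ → Set
t <[ a / b ]√ q = (b *ℕ b) *ℕ (t *ℕ t) < (a *ℕ a) *ℕ q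

_≤[_/_]√_ : ℕ → ℕ → ℕ → ℕ → Set
t ≤[ a / b ]√ q = (b *ℕ b) *ℕ (t *ℕ t) ≤ (a *ℕ a) *ℕ q

_∈[_,_] : ℕ → ℕ → ℕ → Set
q ∈[ a , b ] = a ≤ q × q ≤ b

{-# OPTIONS --safe #-}
module Submission where

open import Defs

-- It suffices to exhibit, for every prime power q in question, one complete arc that meets the bounds.  Write the
-- nonzero elements of the field as powers of a primitive element α.  The points (α^i : α^j : 1) form a torus on which a
-- line y = α^s x + α^t is a translate of the fixed curve y = x + 1, so the points covered by the bisecants form the
-- sumset of the set of bisecants and this curve.  That sumset is read off the base-Z digits of a product of two
-- integers.  Only the Zech logarithms of α enter, and these hold in every field of order q: α is found as a root of a
-- polynomial f with X^(q-1) - 1 = f h, because h has too few roots.  Most arcs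
-- are invariant under a group of translations of the torus, so that only orbit representatives need be treated.

-- Completeness has to be established by evaluation during type checking, over a field known only
-- through its axioms. An arc of about 4 √q points has about 8 q bisecants, hence about 8 q^2
-- incidences with points; going through them one by one is what the design avoids. In the product
-- of numerals a digit counts how often a point is covered, so one multiplication of large numbers
-- does the counting in bulk. The radix exceeds every count that can arise: digits never interact,
-- and a nonzero digit certifies a bisecant through the point. Only this direction is proved. Tables
-- and lists may lose entries, which at worst makes a check fail. For q > 2 the arcs avoid the
-- coordinate triangle, whose points still have to be covered: each side is a circle of exponents,
-- checked in one dimension, and each vertex lies on all lines of one of the special kinds x = α^i,
-- y = α^j, y = α^d x. For q = 2 the torus is a single point, and the arc is a frame, treated by
-- hand. Orders that are not prime powers are recognised by two coprime divisors, so primality is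
-- never tested.

module Numerals where

  open import Agda.Builtin.Nat using (div-helper; mod-helper)
  open import Data.Bool.Base using (Bool; true; false; if_then_else_; _∧_; T)
  open import Data.Empty using (⊥; ⊥-elim)
  open import Data.List.Base using (List; []; _∷_; _++_; length; take; drop)
  open import Data.List.Properties using (length-++)
  open import Data.List.Relation.Unary.All using (All; []; _∷_)
  import Data.List.Relation.Unary.All as All
  open import Data.List.Relation.Unary.AllPairs using (AllPairs; []; _∷_)
  open import Data.Maybe.Base using (Maybe; just; nothing)
  open import Data.Nat.Base
  open import Data.Nat.DivMod using (m≡m%n+[m/n]*n; m%n<n; [m+kn]%n≡m%n; m<n⇒m%n≡m)
  open import Data.Nat.Properties
  open import Data.Nat.Tactic.RingSolver using (solve-∀)
  open import Data.Product.Base using (∃; ∃-syntax; _×_; _,_; proj₁; proj₂)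
  open import Data.Unit.Base using (⊤; tt)
  open import Function.Base using (_∘_; id)
  open import Relation.Binary.PropositionalEquality
  open import Relation.Nullary using (¬_; yes; no)

  -- Division on numerals, search trees, detection of duplicates.

  infixl 7 _/1+_ _%1+_

  -- The divisor is `suc k`, so no proof of nonzeroness travels along. These are the built-in
  -- helpers to which `_/_` and `_%_` unfold; they evaluate directly on large numerals.
  _/1+_ _%1+_ : ℕ → ℕ → ℕ
  m /1+ k = div-helper 0 k m k
  m %1+ k = mod-helper 0 k m k

  %/-spec : ∀ m k → m ≡ m %1+ k + m /1+ k * suc k
  %/-spec m k = m≡m%n+[m/n]*n m (suc k)

  %-bound : ∀ m k → m %1+ k < suc k
  %-bound m k = m%n<n m (suc k)

  %-unique : ∀ {k r} a → r < suc k → (r + a * suc k) %1+ k ≡ r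
  %-unique {k} {r} a r<k = trans ([m+kn]%n≡m%n r a (suc k)) (m<n⇒m%n≡m r<k)

  /-unique : ∀ {k r} a → r < suc k → (r + a * suc k) /1+ k ≡ a
  /-unique {k} {r} a r<k = *-cancelʳ-≡ _ _ (suc k) (+-cancelˡ-≡ r _ _ (begin
    r + (r + a * suc k) /1+ k * suc k                        ≡⟨ cong (_+ (r + a * suc k) /1+ k * suc k) (sym (%-unique a r<k)) ⟩
    (r + a * suc k) %1+ k + (r + a * suc k) /1+ k * suc k     ≡⟨ sym (%/-spec (r + a * suc k) k) ⟩
    r + a * suc k                                            ∎))
    where open ≡-Reasoning

  if-true : ∀ {b} → b ≡ true → T b
  if-true refl = _

  ∧-true : ∀ {a b} → a ∧ b ≡ true → a ≡ true × b ≡ true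
  ∧-true {true} {true} refl = refl , refl

  ∸-sound : ∀ {Φ : ℕ → Set} m e → (e <ᵇ m) ≡ false → Φ e → Φ (m + (e ∸ m))
  ∸-sound {Φ} m e e≮m = subst Φ (sym (m+[n∸m]≡n (≮⇒≥ (λ e<m → subst T e≮m (<⇒<ᵇ {e} {m} e<m)))))

  -- Binary search trees over keys below the sum of the thresholds ms, which are meant to be … ∷ 4 ∷ 2 ∷ 1 ∷ [].
  data Tree (A : Set) : Set where
    empty : Tree A
    leaf  : A → Tree A
    node  : Tree A → Tree A → Tree A

  module _ {A : Set} where

    insert  : List ℕ → ℕ → A → Tree A → Tree A
    insert′ : Bool → ℕ → List ℕ → ℕ → A → Tree A → Tree A
    insert []       zero    a t = leaf a
    -- A key beyond the thresholds is dropped: `Entries` speaks only of what is stored, so a lost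
    -- entry cannot make a lookup wrong.
    insert []       (suc _) a t = t
    insert (m ∷ ms) k       a t = insert′ (k <ᵇ m) m ms k a t
    insert′ true  m ms k a (node l r) = node (insert ms k a l) r
    insert′ true  m ms k a _          = node (insert ms k a empty) empty
    insert′ false m ms k a (node l r) = node l (insert ms (k ∸ m) a r)
    insert′ false m ms k a _          = node empty (insert ms (k ∸ m) a empty)

    find  : List ℕ → ℕ → Tree A → Maybe A
    find′ : Bool → ℕ → List ℕ → ℕ → Tree A → Tree A → Maybe A
    find []       zero (leaf a)   = just a
    find (m ∷ ms) k    (node l r) = find′ (k <ᵇ m) m ms k l r
    find _        _    _          = nothing
    find′ true  m ms k l r = find ms k l
    find′ false m ms k l r = find ms (k ∸ m) r

    data Entries : List ℕ → (ℕ → A → Set) → Tree A → Set₁ where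
      empty : ∀ {ms Φ} → Entries ms Φ empty
      leaf  : ∀ {Φ a} → Φ 0 a → Entries [] Φ (leaf a)
      node  : ∀ {m ms Φ l r} → Entries ms Φ l → Entries ms (Φ ∘ (m +_)) r → Entries (m ∷ ms) Φ (node l r)

    insert-Entries : ∀ ms {Φ} k {a t} → Entries ms Φ t → Φ k a → Entries ms Φ (insert ms k a t)
    insert-Entries []       zero    E φ = leaf φ
    insert-Entries []       (suc _) E φ = E
    insert-Entries (m ∷ ms) {Φ} k {a} E φ with k <ᵇ m in eq
    insert-Entries (m ∷ ms) {Φ} k {a} empty      φ | true  = node (insert-Entries ms k empty φ) empty
    insert-Entries (m ∷ ms) {Φ} k {a} (node L R) φ | true  = node (insert-Entries ms k L φ) R
    insert-Entries (m ∷ ms) {Φ} k {a} empty      φ | false =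
      node empty (insert-Entries ms (k ∸ m) empty (∸-sound {λ i → Φ i a} m k eq φ))
    insert-Entries (m ∷ ms) {Φ} k {a} (node L R) φ | false =
      node L (insert-Entries ms (k ∸ m) R (∸-sound {λ i → Φ i a} m k eq φ))

    find-sound : ∀ ms {Φ} k {a t} → Entries ms Φ t → find ms k t ≡ just a → Φ k a
    find-sound []       zero    (leaf φ)   refl = φ
    find-sound (m ∷ ms) {Φ} k {a} (node L R) eq with k <ᵇ m in lt
    ... | true  = find-sound ms k L eq
    ... | false = subst (λ i → Φ i a) (m+[n∸m]≡n (≮⇒≥ (λ k<m → subst T lt (<⇒<ᵇ {k} {m} k<m)))) (find-sound ms (k ∸ m) R eq)

  attach : ∀ {A : Set} → (A → A) → Maybe A → Maybe A
  attach f nothing  = nothing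
  attach f (just a) = just (f a)

  -- A repeated key and a key out of range both give `nothing`, so a chain of successful marks
  -- proves the keys distinct.
  mark  : List ℕ → ℕ → Tree ⊤ → Maybe (Tree ⊤)
  mark′ : Bool → ℕ → List ℕ → ℕ → Tree ⊤ → Maybe (Tree ⊤)
  mark []       zero    empty = just (leaf tt)
  mark []       _       _     = nothing
  mark (m ∷ ms) k       t     = mark′ (k <ᵇ m) m ms k t
  mark′ true  m ms k empty      = attach (λ l → node l empty) (mark ms k empty)
  mark′ true  m ms k (node l r) = attach (λ l → node l r) (mark ms k l)
  mark′ false m ms k empty      = attach (node empty) (mark ms (k ∸ m) empty)
  mark′ false m ms k (node l r) = attach (node l) (mark ms (k ∸ m) r)
  mark′ _     _ _  _ (leaf _)   = nothing

  Marked : List ℕ → ℕ → Tree ⊤ → Set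
  Marked []       zero (leaf _)   = ⊤
  Marked (m ∷ ms) k    (node l r) = if k <ᵇ m then Marked ms k l else Marked ms (k ∸ m) r
  Marked _        _    _          = ⊥

  ¬Marked-empty : ∀ ms k → ¬ Marked ms k empty
  ¬Marked-empty []       zero    ()
  ¬Marked-empty []       (suc _) ()
  ¬Marked-empty (m ∷ ms) k       ()

  mark-Marked : ∀ ms k t {t′} → mark ms k t ≡ just t′ → Marked ms k t′
  mark-Marked []       zero empty      refl = tt
  mark-Marked (m ∷ ms) k    t          eq with k <ᵇ m in lt
  mark-Marked (m ∷ ms) k    empty      eq | true with mark ms k empty in eq′
  mark-Marked (m ∷ ms) k    empty    refl | true | just l′ rewrite lt = mark-Marked ms k empty eq′
  mark-Marked (m ∷ ms) k    (node l r) eq | true with mark ms k l in eq′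
  mark-Marked (m ∷ ms) k    (node l r) refl | true | just l′ rewrite lt = mark-Marked ms k l eq′
  mark-Marked (m ∷ ms) k    empty      eq | false with mark ms (k ∸ m) empty in eq′
  mark-Marked (m ∷ ms) k    empty    refl | false | just r′ rewrite lt = mark-Marked ms (k ∸ m) empty eq′
  mark-Marked (m ∷ ms) k    (node l r) eq | false with mark ms (k ∸ m) r in eq′
  mark-Marked (m ∷ ms) k    (node l r) refl | false | just r′ rewrite lt = mark-Marked ms (k ∸ m) r eq′

  mark-keeps : ∀ ms k t {t′} j → mark ms k t ≡ just t′ → Marked ms j t → Marked ms j t′
  mark-keeps []       zero (leaf _)   j () M
  mark-keeps []       zero empty      j eq M = ⊥-elim (¬Marked-empty [] j M)
  mark-keeps (m ∷ ms) k    empty      j eq M = ⊥-elim (¬Marked-empty (m ∷ ms) j M)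
  mark-keeps (m ∷ ms) k    (node l r) j eq M with k <ᵇ m
  mark-keeps (m ∷ ms) k    (node l r) j eq M | true with mark ms k l in eq′
  mark-keeps (m ∷ ms) k    (node l r) j refl M | true | just l′ with j <ᵇ m
  ... | true  = mark-keeps ms k l j eq′ M
  ... | false = M
  mark-keeps (m ∷ ms) k    (node l r) j eq M | false with mark ms (k ∸ m) r in eq′
  mark-keeps (m ∷ ms) k    (node l r) j refl M | false | just r′ with j <ᵇ m
  ... | true  = M
  ... | false = mark-keeps ms (k ∸ m) r (j ∸ m) eq′ M

  mark-fails : ∀ ms k t {t′} → Marked ms k t → mark ms k t ≢ just t′
  mark-fails []       zero (leaf _)   M ()
  mark-fails (m ∷ ms) k    (node l r) M eq with k <ᵇ m
  mark-fails (m ∷ ms) k    (node l r) M eq | true with mark ms k l in eq′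
  mark-fails (m ∷ ms) k    (node l r) M refl | true | just _ = mark-fails ms k l M eq′
  mark-fails (m ∷ ms) k    (node l r) M eq | false with mark ms (k ∸ m) r in eq′
  mark-fails (m ∷ ms) k    (node l r) M refl | false | just _ = mark-fails ms (k ∸ m) r M eq′

  distinct  : List ℕ → List ℕ → Tree ⊤ → Bool
  distinct′ : List ℕ → List ℕ → Maybe (Tree ⊤) → Bool
  distinct ms []       t = true
  distinct ms (k ∷ ks) t = distinct′ ms ks (mark ms k t)
  distinct′ ms ks nothing  = false
  distinct′ ms ks (just t) = distinct ms ks t

  -- The second component carries the induction: the first key is marked in the tree that is passed
  -- on, and no later key is marked there.
  distinct-sound : ∀ ms ks t → distinct ms ks t ≡ true → AllPairs _≢_ ks × All (λ k → ¬ Marked ms k t) ks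
  distinct-sound ms []       t ok = [] , []
  distinct-sound ms (k ∷ ks) t ok with mark ms k t in eq
  ... | just t′ with distinct-sound ms ks t′ ok
  ...   | pairs , fresh =
    All.map (λ { ¬M refl → ¬M (mark-Marked ms k t eq) }) fresh ∷ pairs ,
    (λ M → mark-fails ms k t M eq) ∷ All.map (λ {j} ¬M M → ¬M (mark-keeps ms k t j eq M)) fresh

  -- Sets of exponents as digits in base Z, and sumsets as products.

  module Radix (Z-1 : ℕ) where

    Z : ℕ
    Z = suc Z-1

    -- `w` bounds the digits, and `Φ` contains the positions of the nonzero ones; a digit at a
    -- position in `Φ` may be 0. The relation between `w` and `Z` is left open: `w < Z` is demanded
    -- only where digits are extracted.
    data Dig (w : ℕ) (Φ : ℕ → Set) (N : ℕ) : Set₁ where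
      zero : N ≡ 0 → Dig w Φ N
      cons : ∀ d M → N ≡ d + Z * M → d ≤ w → (d ≢ 0 → Φ 0) → Dig w (Φ ∘ suc) M → Dig w Φ N

    -- The other view of a numeral, as a sum of powers with repetitions: as a factor, it enlarges
    -- the digits of the other factor at most by its number of terms.
    data Terms (Φ : ℕ → Set) : ℕ → ℕ → Set₁ where
      zero : ∀ {N} → N ≡ 0 → Terms Φ 0 N
      cons : ∀ {k N} e M → N ≡ Z ^ e + M → Φ e → Terms Φ k M → Terms Φ (suc k) N

    Dig-map : ∀ {w v Φ Ψ N} → w ≤ v → (∀ i → Φ i → Ψ i) → Dig w Φ N → Dig v Ψ N
    Dig-map w≤v f (zero N≡0)            = zero N≡0
    Dig-map w≤v f (cons d M N≡ d≤w φ D) = cons d M N≡ (≤-trans d≤w w≤v) (f 0 ∘ φ) (Dig-map w≤v (f ∘ suc) D)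

    Dig-+ : ∀ {w v Φ M N} → Dig w Φ M → Dig v Φ N → Dig (w + v) Φ (M + N)
    Dig-+ {w} {v} (zero refl) D = Dig-map (m≤n+m v w) (λ _ → id) D
    Dig-+ {w} {v} {Φ} {M} D@(cons _ _ _ _ _ _) (zero refl) =
      subst (Dig (w + v) Φ) (sym (+-identityʳ M)) (Dig-map (m≤m+n w v) (λ _ → id) D)
    Dig-+ {w} {v} {Φ} (cons d M refl d≤w φ D) (cons e N refl e≤v ψ E) =
      cons (d + e) (M + N) (eq d e M N Z) (+-mono-≤ d≤w e≤v) φψ (Dig-+ D E)
      where
      eq : ∀ d e M N Z → d + Z * M + (e + Z * N) ≡ d + e + Z * (M + N)
      eq = solve-∀
      φψ : d + e ≢ 0 → Φ 0
      φψ d+e≢0 with d ≟ 0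
      ... | no d≢0   = φ d≢0
      ... | yes refl = ψ d+e≢0

    Dig-shift : ∀ {w Φ N} k → Dig w (Φ ∘ (k +_)) N → Dig w Φ (Z ^ k * N)
    Dig-shift {w} {Φ} {N} zero D = subst (Dig w Φ) (sym (*-identityˡ N)) D
    Dig-shift {N = N} (suc k) D =
      cons 0 (Z ^ k * N) (*-assoc Z (Z ^ k) N) z≤n (λ 0≢0 → ⊥-elim (0≢0 refl)) (Dig-shift k D)

    -- Each power in `A` shifts the digits of `C`, and the `k` shifted copies are added position by
    -- position. This is where the product becomes a sumset.
    Dig-* : ∀ {w k Φ Ψ Χ A C} → (∀ {e f} → Φ e → Ψ f → Χ (e + f)) → Terms Φ k A → Dig w Ψ C → Dig (k * w) Χ (A * C)
    Dig-* f (zero refl) D = zero refl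
    Dig-* {w} {k = suc k} {Χ = Χ} {C = C} f (cons e M refl φ A) D =
      subst (Dig (w + k * w) Χ) (sym (*-distribʳ-+ C (Z ^ e) M))
        (Dig-+ (Dig-shift e (Dig-map ≤-refl (λ _ → f φ) D)) (Dig-* f A D))

    empty-Dig : ∀ {w Φ N} → (∀ i → ¬ Φ i) → Dig w Φ N → N ≡ 0
    empty-Dig ¬Φ (zero N≡0) = N≡0
    empty-Dig ¬Φ (cons d M refl _ φ D) with d ≟ 0
    ... | no d≢0   = ⊥-elim (¬Φ 0 (φ d≢0))
    ... | yes refl = trans (cong (Z *_) (empty-Dig (¬Φ ∘ suc) D)) (*-zeroʳ Z)

    Dig-join : ∀ {w Φ L H} k → Dig w (λ i → Φ i × i < k) L → Dig w (Φ ∘ (k +_)) H → Dig w Φ (L + Z ^ k * H)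
    Dig-join {w} {Φ} {L} {H} zero D E =
      subst (Dig w Φ) (sym (trans (cong (_+ 1 * H) (empty-Dig (λ { _ (_ , ()) }) D)) (*-identityˡ H))) E
    Dig-join (suc k) (zero refl) E = Dig-shift (suc k) E
    Dig-join {H = H} (suc k) (cons d M refl d≤w φ D) E =
      cons d (M + Z ^ k * H) (eq d M Z (Z ^ k) H) d≤w (proj₁ ∘ φ)
        (Dig-join k (Dig-map ≤-refl (λ _ (φ , i<k) → φ , s≤s⁻¹ i<k) D) E)
      where
      eq : ∀ d M Z Y H → d + Z * M + Z * Y * H ≡ d + Z * (M + Y * H)
      eq = solve-∀

    record Cut (w : ℕ) (Φ : ℕ → Set) (k N : ℕ) : Set₁ where
      constructor cut
      field
        low high : ℕ
        spec     : N ≡ low + Z ^ k * high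
        bound    : low < Z ^ k
        lowDig   : Dig w (λ i → Φ i × i < k) low
        highDig  : Dig w (Φ ∘ (k +_)) high

    -- Here `w < Z` enters: the low digits then form a number below `Z ^ k`, so the formal expansion
    -- agrees with remainder and quotient.
    Dig-cut : ∀ {w Φ N} → w < Z → ∀ k → Dig w Φ N → Cut w Φ k N
    Dig-cut {N = N} w<Z zero D = cut 0 N (sym (*-identityˡ N)) (s≤s z≤n) (zero refl) D
    Dig-cut w<Z (suc k) (zero refl) =
      cut 0 0 (sym (*-zeroʳ (Z ^ suc k))) (m^n>0 Z (suc k)) (zero refl) (zero refl)
    Dig-cut {w} w<Z (suc k) (cons d M refl d≤w φ D) =
      cut (d + Z * c.low) c.high (trans (cong (λ x → d + Z * x) c.spec) (eq d c.low Z (Z ^ k) c.high))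
          bound
          (cons d c.low refl d≤w (λ d≢0 → φ d≢0 , s≤s z≤n) (Dig-map ≤-refl (λ _ (φ , i<k) → φ , s≤s i<k) c.lowDig))
          c.highDig
      where
      module c = Cut (Dig-cut w<Z k D)
      eq : ∀ d L Z Y H → d + Z * (L + Y * H) ≡ d + Z * L + Z * Y * H
      eq = solve-∀
      bound : d + Z * c.low < Z ^ suc k
      bound = begin-strict
        d + Z * c.low   <⟨ +-monoˡ-< (Z * c.low) (≤-<-trans d≤w w<Z) ⟩
        Z + Z * c.low   ≡⟨ sym (*-suc Z c.low) ⟩
        Z * suc c.low   ≤⟨ *-monoʳ-≤ Z c.bound ⟩
        Z ^ suc k       ∎
        where open ≤-Reasoning

    module _ {w Φ N B k} (w<Z : w < Z) (B≡ : suc B ≡ Z ^ k) (D : Dig w Φ N) where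
      private
        module c = Cut (Dig-cut w<Z k D)
        spec′ : N ≡ c.low + c.high * suc B
        spec′ = trans c.spec (cong (c.low +_) (trans (*-comm (Z ^ k) c.high) (cong (c.high *_) (sym B≡))))
        bound′ : c.low < suc B
        bound′ = subst (c.low <_) (sym B≡) c.bound

      Dig-% : Dig w (λ i → Φ i × i < k) (N %1+ B)
      Dig-% = subst (Dig w _) (sym (trans (cong (_%1+ B) spec′) (%-unique c.high bound′))) c.lowDig

      Dig-/ : Dig w (Φ ∘ (k +_)) (N /1+ B)
      Dig-/ = subst (Dig w _) (sym (trans (cong (_/1+ B) spec′) (/-unique c.high bound′))) c.highDig

    Z^1 : suc Z-1 ≡ Z ^ 1
    Z^1 = sym (*-identityʳ Z)

    Dig-nonzero : ∀ {w Φ N} → Dig w Φ N → N ≢ 0 → ∃ Φ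
    Dig-nonzero (zero N≡0) N≢0 = ⊥-elim (N≢0 N≡0)
    Dig-nonzero (cons d M refl _ φ D) N≢0 with d ≟ 0
    ... | no d≢0   = 0 , φ d≢0
    ... | yes refl with Dig-nonzero D (λ { refl → N≢0 (*-zeroʳ Z) })
    ...   | i , ψ = suc i , ψ

    digits  : ℕ → ℕ → Bool
    digits′ : ℕ → ℕ → ℕ → Bool
    digits zero    N = true
    digits (suc c) N = digits′ (N %1+ Z-1) c N
    digits′ zero    c N = false
    digits′ (suc _) c N = digits c (N /1+ Z-1)

    digits-sound : ∀ {w Φ N} → w < Z → Dig w Φ N → ∀ c → digits c N ≡ true → ∀ i → i < c → Φ i
    digits-sound {N = N} w<Z D (suc c) ok i i<c with N %1+ Z-1 in eq
    digits-sound w<Z D (suc c) ok zero i<c | suc _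
      with Dig-nonzero (Dig-% {k = 1} w<Z Z^1 D) (λ N%≡0 → 1+n≢0 (trans (sym eq) N%≡0))
    ... | zero  , φ , _ = φ
    ... | suc _ , _ , s≤s ()
    digits-sound w<Z D (suc c) ok (suc i) (s≤s i<c) | suc _ =
      digits-sound w<Z (Dig-/ {k = 1} w<Z Z^1 D) c ok i i<c

    Terms-map : ∀ {Φ Ψ k N} → (∀ i → Φ i → Ψ i) → Terms Φ k N → Terms Ψ k N
    Terms-map f (zero N≡0)        = zero N≡0
    Terms-map f (cons e M N≡ φ A) = cons e M N≡ (f e φ) (Terms-map f A)

    Terms-+ : ∀ {Φ k l M N} → Terms Φ k M → Terms Φ l N → Terms Φ (k + l) (M + N)
    Terms-+ (zero refl) B = B
    Terms-+ {N = N} (cons e M refl φ A) B = cons e (M + N) (+-assoc (Z ^ e) M N) φ (Terms-+ A B)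

    Terms-shift : ∀ {Φ k N} m → Terms (Φ ∘ (m +_)) k N → Terms Φ k (Z ^ m * N)
    Terms-shift m (zero refl) = zero (*-zeroʳ (Z ^ m))
    Terms-shift m (cons e M refl φ A) =
      cons (m + e) (Z ^ m * M)
        (trans (*-distribˡ-+ (Z ^ m) (Z ^ e) M) (cong (_+ Z ^ m * M) (sym (^-distribˡ-+-* Z m e))))
        φ (Terms-shift m A)

    -- Repeated squaring. Started with 1 and `Z`, it lists the pairs of 2^j and Z^(2^j), the largest
    -- first, as needed for splitting exponents in halves.
    levels : ℕ → ℕ → ℕ → List (ℕ × ℕ) → List (ℕ × ℕ)
    levels zero    m B l = l
    levels (suc f) m B l = levels f (m + m) (B * B) ((m , B) ∷ l)

    Level : ℕ × ℕ → Set
    Level (m , B) = B ≡ Z ^ m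

    levels-sound : ∀ f {m B l} → B ≡ Z ^ m → All Level l → All Level (levels f m B l)
    levels-sound zero            B≡ ls = ls
    levels-sound (suc f) {m} B≡ ls =
      levels-sound f (trans (cong₂ _*_ B≡ B≡) (sym (^-distribˡ-+-* Z m m))) (B≡ ∷ ls)

    -- The end of the recursion in `powers`: equal exponents merge into one digit 1, and an exponent
    -- that is still positive was out of range and is dropped.
    hasZero : List ℕ → ℕ
    hasZero []           = 0
    hasZero (zero  ∷ es) = 1
    hasZero (suc _ ∷ es) = hasZero es

    -- The sum of Z ^ e over the distinct elements e of the list.
    powers : List (ℕ × ℕ) → List ℕ → ℕ
    split  : ℕ → ℕ → List (ℕ × ℕ) → List ℕ → List ℕ → List ℕ → ℕ
    split′ : Bool → ℕ → ℕ → List (ℕ × ℕ) → ℕ → List ℕ → List ℕ → List ℕ → ℕ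
    powers lv             []         = 0
    powers []             es@(_ ∷ _) = hasZero es
    powers ((m , B) ∷ lv) es@(_ ∷ _) = split m B lv es [] []
    split m B lv []       ls rs = powers lv ls + B * powers lv rs
    split m B lv (e ∷ es) ls rs = split′ (e <ᵇ m) m B lv e es ls rs
    split′ true  m B lv e es ls rs = split m B lv es (e ∷ ls) rs
    split′ false m B lv e es ls rs = split m B lv es ls (e ∸ m ∷ rs)

    hasZero-Dig : ∀ {Φ} es → All Φ es → Dig 1 Φ (hasZero es)
    hasZero-Dig []           []       = zero refl
    hasZero-Dig (zero  ∷ es) (φ ∷ _)  = cons 1 0 (cong suc (sym (*-zeroʳ Z))) ≤-refl (λ _ → φ) (zero refl)
    hasZero-Dig (suc _ ∷ es) (_ ∷ φs) = hasZero-Dig es φs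

    powers-Dig : ∀ {Φ lv} → All Level lv → ∀ es → All Φ es → Dig 1 Φ (powers lv es)
    split-Dig  : ∀ {Φ m B lv} → B ≡ Z ^ m → All Level lv → ∀ es {ls rs} → All Φ es →
                 All (λ e → Φ e × e < m) ls → All (Φ ∘ (m +_)) rs → Dig 1 Φ (split m B lv es ls rs)
    powers-Dig lvs        []           φs = zero refl
    powers-Dig []         es@(_ ∷ _)   φs = hasZero-Dig es φs
    powers-Dig {lv = (m , B) ∷ _} (l ∷ lvs)  es@(_ ∷ _)   φs = split-Dig {m = m} l lvs es φs [] []
    split-Dig {m = m} refl lvs [] φs ls rs = Dig-join m (powers-Dig lvs _ ls) (powers-Dig lvs _ rs)
    split-Dig {Φ} {m} B≡ lvs (e ∷ es) (φ ∷ φs) ls rs with e <ᵇ m in eq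
    ... | true  = split-Dig {m = m} B≡ lvs es φs ((φ , <ᵇ⇒< e m (if-true eq)) ∷ ls) rs
    ... | false = split-Dig {m = m} B≡ lvs es φs ls (∸-sound {Φ} m e eq φ ∷ rs)

    -- An inequality, because merged and dropped exponents contribute no term.
    AtMost : (ℕ → Set) → ℕ → ℕ → Set₁
    AtMost Φ k N = ∃[ l ] (l ≤ k × Terms Φ l N)

    AtMost-+ : ∀ {Φ k l M N} → AtMost Φ k M → AtMost Φ l N → AtMost Φ (k + l) (M + N)
    AtMost-+ (a , a≤ , A) (b , b≤ , B) = a + b , +-mono-≤ a≤ b≤ , Terms-+ A B

    hasZero-Terms : ∀ {Φ} es → All Φ es → AtMost Φ (length es) (hasZero es)
    hasZero-Terms []           []       = 0 , z≤n , zero refl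
    hasZero-Terms (zero  ∷ es) (φ ∷ _)  = 1 , s≤s z≤n , cons 0 0 refl φ (zero refl)
    hasZero-Terms (suc _ ∷ es) (_ ∷ φs) with hasZero-Terms es φs
    ... | l , l≤ , A = l , m≤n⇒m≤1+n l≤ , A

    powers-Terms : ∀ {Φ lv} → All Level lv → ∀ es → All Φ es → AtMost Φ (length es) (powers lv es)
    split-Terms  : ∀ {Φ m B lv} → B ≡ Z ^ m → All Level lv → ∀ es {ls rs} → All Φ es →
                   All Φ ls → All (Φ ∘ (m +_)) rs →
                   AtMost Φ (length es + (length ls + length rs)) (split m B lv es ls rs)
    powers-Terms lvs       []         φs = 0 , z≤n , zero refl
    powers-Terms []        es@(_ ∷ _) φs = hasZero-Terms es φs
    powers-Terms {Φ} {(m , B) ∷ lv} (l ∷ lvs) es@(_ ∷ _) φs =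
      subst (λ k → AtMost Φ k (split m B lv es [] [])) (+-identityʳ (length es)) (split-Terms {m = m} l lvs es φs [] [])
    split-Terms {m = m} refl lvs [] {ls} {rs} φs Ls Rs with powers-Terms lvs rs Rs
    ... | l , l≤ , A = AtMost-+ (powers-Terms lvs ls Ls) (l , l≤ , Terms-shift m A)
    split-Terms {Φ} {m} {B} {lv} B≡ lvs (e ∷ es) {ls} {rs} (φ ∷ φs) Ls Rs with e <ᵇ m in eq
    ... | true  = subst (λ k → AtMost Φ k (split m B lv es (e ∷ ls) rs)) (+-suc (length es) (length ls + length rs))
                    (split-Terms {m = m} B≡ lvs es φs (φ ∷ Ls) Rs)
    ... | false = subst (λ k → AtMost Φ k (split m B lv es ls (e ∸ m ∷ rs)))
                    (trans (cong (length es +_) (+-suc (length ls) (length rs))) (+-suc (length es) (length ls + length rs)))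
                    (split-Terms {m = m} B≡ lvs es φs Ls (∸-sound {Φ} m e eq φ ∷ Rs))

    -- A long numeral kept as a list of blocks: `b` is the position where the first one begins and
    -- `S` the distance between beginnings. A block may have more than `S` digits, so consecutive
    -- blocks may overlap.
    data Rows (P : ℕ → ℕ → Set₁) (S : ℕ) : ℕ → List ℕ → Set₁ where
      []  : ∀ {b} → Rows P S b []
      _∷_ : ∀ {b x xs} → P b x → Rows P S (S + b) xs → Rows P S b (x ∷ xs)

    Rows-map : ∀ {P Q S b xs} → (∀ {b x} → P b x → Q b x) → Rows P S b xs → Rows Q S b xs
    Rows-map f []       = []
    Rows-map f (p ∷ ps) = f p ∷ Rows-map f ps

    Rows-++ : ∀ {P S b xs ys} → Rows P S b xs → Rows P S (length xs * S + b) ys → Rows P S b (xs ++ ys)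
    Rows-++ []       qs = qs
    Rows-++ {P} {S} {b} {_ ∷ xs} {ys} (p ∷ ps) qs = p ∷ Rows-++ ps (subst (λ c → Rows P S c ys) (eq S (length xs) b) qs)
      where
      eq : ∀ S l b → S + l * S + b ≡ l * S + (S + b)
      eq = solve-∀

    DigAt : ℕ → (ℕ → Set) → ℕ → ℕ → Set₁
    DigAt w Φ b = Dig w (Φ ∘ (b +_))

    data TermRows (Φ : ℕ → Set) (S : ℕ) : ℕ → ℕ → List ℕ → Set₁ where
      []  : ∀ {b} → TermRows Φ S 0 b []
      _∷_ : ∀ {k l b x xs} → Terms (Φ ∘ (b +_)) k x → TermRows Φ S l (S + b) xs → TermRows Φ S (k + l) b (x ∷ xs)

    TermRows-++ : ∀ {Φ S k l b xs ys} → TermRows Φ S k b xs → TermRows Φ S l (length xs * S + b) ys →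
                  TermRows Φ S (k + l) b (xs ++ ys)
    TermRows-++ [] qs = qs
    TermRows-++ {Φ} {S} {l = l} {b} {x ∷ xs} {ys} (_∷_ {k} {k′} p ps) qs =
      subst (λ m → TermRows Φ S m b (x ∷ xs ++ ys)) (sym (+-assoc k k′ l))
        (p ∷ TermRows-++ ps (subst (λ c → TermRows Φ S l c ys) (eq S (length xs) b) qs))
      where
      eq : ∀ S l b → S + l * S + b ≡ l * S + (S + b)
      eq = solve-∀

    -- The number powers lv es, cut into 2 ^ κ blocks of S digits.
    blocks  : ℕ → ℕ → List (ℕ × ℕ) → List ℕ → List ℕ
    bsplit  : ℕ → ℕ → ℕ → List (ℕ × ℕ) → List ℕ → List ℕ → List ℕ → List ℕ
    bsplit′ : Bool → ℕ → ℕ → ℕ → List (ℕ × ℕ) → ℕ → List ℕ → List ℕ → List ℕ → List ℕ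
    blocks zero    S lv es = powers lv es ∷ []
    blocks (suc κ) S lv es = bsplit κ (2 ^ κ * S) S lv es [] []
    bsplit κ m S lv []       ls rs = blocks κ S lv ls ++ blocks κ S lv rs
    bsplit κ m S lv (e ∷ es) ls rs = bsplit′ (e <ᵇ m) κ m S lv e es ls rs
    bsplit′ true  κ m S lv e es ls rs = bsplit κ m S lv es (e ∷ ls) rs
    bsplit′ false κ m S lv e es ls rs = bsplit κ m S lv es ls (e ∸ m ∷ rs)

    length-blocks : ∀ κ S lv es → length (blocks κ S lv es) ≡ 2 ^ κ
    length-bsplit : ∀ κ m S lv es ls rs → length (bsplit κ m S lv es ls rs) ≡ 2 ^ κ + (2 ^ κ + 0)
    length-blocks zero    S lv es = refl
    length-blocks (suc κ) S lv es = length-bsplit κ _ S lv es [] []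
    length-bsplit κ m S lv [] ls rs = trans (length-++ (blocks κ S lv ls))
      (cong₂ _+_ (length-blocks κ S lv ls) (trans (length-blocks κ S lv rs) (sym (+-identityʳ _))))
    length-bsplit κ m S lv (e ∷ es) ls rs with e <ᵇ m
    ... | true  = length-bsplit κ m S lv es (e ∷ ls) rs
    ... | false = length-bsplit κ m S lv es ls (e ∸ m ∷ rs)

    blocks-Dig : ∀ {Φ lv S} → All Level lv → ∀ κ b es → All (Φ ∘ (b +_)) es → Rows (DigAt 1 Φ) S b (blocks κ S lv es)
    bsplit-Dig : ∀ {Φ lv S m} → All Level lv → ∀ κ b → m ≡ 2 ^ κ * S → ∀ es {ls rs} →
                 All (Φ ∘ (b +_)) es → All (Φ ∘ (b +_)) ls → All (Φ ∘ (m + b +_)) rs →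
                 Rows (DigAt 1 Φ) S b (bsplit κ m S lv es ls rs)
    blocks-Dig lvs zero    b es φs = powers-Dig lvs es φs ∷ []
    blocks-Dig {Φ} lvs (suc κ) b es φs = bsplit-Dig {Φ} lvs κ b refl es φs [] []
    bsplit-Dig {Φ} {lv} {S} {m} lvs κ b m≡ [] {ls} {rs} φs Ls Rs =
      Rows-++ (blocks-Dig {Φ} lvs κ b ls Ls)
        (subst (λ c → Rows (DigAt 1 Φ) S c (blocks κ S lv rs))
          (cong (_+ b) (trans m≡ (cong (_* S) (sym (length-blocks κ S lv ls)))))
          (blocks-Dig {Φ} lvs κ (m + b) rs Rs))
    bsplit-Dig {Φ} {m = m} lvs κ b m≡ (e ∷ es) (φ ∷ φs) Ls Rs with e <ᵇ m in eq
    ... | true  = bsplit-Dig {Φ} lvs κ b m≡ es φs (φ ∷ Ls) Rs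
    ... | false = bsplit-Dig {Φ} lvs κ b m≡ es φs Ls (reassoc Φ b m e (∸-sound {Φ ∘ (b +_)} m e eq φ) ∷ Rs)
      where
      reassoc : ∀ (Φ : ℕ → Set) b m e → Φ (b + (m + (e ∸ m))) → Φ (m + b + (e ∸ m))
      reassoc Φ b m e = subst Φ (trans (sym (+-assoc b m (e ∸ m))) (cong (_+ (e ∸ m)) (+-comm b m)))

    AtMostRows : (ℕ → Set) → ℕ → ℕ → ℕ → List ℕ → Set₁
    AtMostRows Φ S k b xs = ∃[ l ] (l ≤ k × TermRows Φ S l b xs)

    blocks-Terms : ∀ {Φ lv S} → All Level lv → ∀ κ b es → All (Φ ∘ (b +_)) es →
                   AtMostRows Φ S (length es) b (blocks κ S lv es)
    bsplit-Terms : ∀ {Φ lv S m} → All Level lv → ∀ κ b → m ≡ 2 ^ κ * S → ∀ es {ls rs} →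
                   All (Φ ∘ (b +_)) es → All (Φ ∘ (b +_)) ls → All (Φ ∘ (m + b +_)) rs →
                   AtMostRows Φ S (length es + (length ls + length rs)) b (bsplit κ m S lv es ls rs)
    blocks-Terms {Φ} {lv} {S} lvs zero b es φs with powers-Terms lvs es φs
    ... | l , l≤ , A = l + 0 , subst (_≤ length es) (sym (+-identityʳ l)) l≤ , A ∷ []
    blocks-Terms {Φ} {lv} {S} lvs (suc κ) b es φs =
      subst (λ k → AtMostRows Φ S k b (blocks (suc κ) S lv es)) (+-identityʳ (length es))
        (bsplit-Terms {Φ} lvs κ b refl es φs [] [])
    bsplit-Terms {Φ} {lv} {S} {m} lvs κ b m≡ [] {ls} {rs} φs Ls Rs
      with blocks-Terms {Φ} lvs κ b ls Ls | blocks-Terms {Φ} lvs κ (m + b) rs Rs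
    ... | k , k≤ , A | l , l≤ , B =
      k + l , +-mono-≤ k≤ l≤ , TermRows-++ A
        (subst (λ c → TermRows Φ S l c (blocks κ S lv rs))
          (cong (_+ b) (trans m≡ (cong (_* S) (sym (length-blocks κ S lv ls))))) B)
    bsplit-Terms {Φ} {lv} {S} {m} lvs κ b m≡ (e ∷ es) {ls} {rs} (φ ∷ φs) Ls Rs with e <ᵇ m in eq
    ... | true  = subst (λ k → AtMostRows Φ S k b (bsplit κ m S lv es (e ∷ ls) rs)) (+-suc (length es) (length ls + length rs))
                    (bsplit-Terms {Φ} lvs κ b m≡ es φs (φ ∷ Ls) Rs)
    ... | false = subst (λ k → AtMostRows Φ S k b (bsplit κ m S lv es ls (e ∸ m ∷ rs)))
                    (trans (cong (length es +_) (+-suc (length ls) (length rs))) (+-suc (length es) (length ls + length rs)))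
                    (bsplit-Terms {Φ} lvs κ b m≡ es φs Ls (reassoc Φ b m e (∸-sound {Φ ∘ (b +_)} m e eq φ) ∷ Rs))
      where
      reassoc : ∀ (Φ : ℕ → Set) b m e → Φ (b + (m + (e ∸ m))) → Φ (m + b + (e ∸ m))
      reassoc Φ b m e = subst Φ (trans (sym (+-assoc b m (e ∸ m))) (cong (_+ (e ∸ m)) (+-comm b m)))

    add : List ℕ → List ℕ → List ℕ
    add []       ys       = ys
    add (x ∷ xs) []       = x ∷ xs
    add (x ∷ xs) (y ∷ ys) = x + y ∷ add xs ys

    scale : ℕ → List ℕ → List ℕ
    scale a []       = []
    scale a (x ∷ xs) = a * x ∷ scale a xs

    -- The product of two block lists as polynomials in `Z ^ S`.
    conv : List ℕ → List ℕ → List ℕ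
    conv []       ys = []
    conv (x ∷ xs) ys = add (scale x ys) (0 ∷ conv xs ys)

    add-Dig : ∀ {w v Φ S b xs ys} → Rows (DigAt w Φ) S b xs → Rows (DigAt v Φ) S b ys →
              Rows (DigAt (w + v) Φ) S b (add xs ys)
    add-Dig {w} {v} []       qs       = Rows-map (Dig-map (m≤n+m v w) (λ _ → id)) qs
    add-Dig {w} {v} (p ∷ ps) []       = Rows-map (Dig-map (m≤m+n w v) (λ _ → id)) (p ∷ ps)
    add-Dig {Φ = Φ} (p ∷ ps) (q ∷ qs) = Dig-+ p q ∷ add-Dig {Φ = Φ} ps qs

    module _ {w S : ℕ} {Φ Ψ Χ : ℕ → Set} (f : ∀ {d e} → Φ d → Ψ e → Χ (d + e)) where

      private
        swap-+ : ∀ a S b → S + (a + b) ≡ a + (S + b)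
        swap-+ = solve-∀
        interchange : ∀ a b d e → a + d + (b + e) ≡ a + b + (d + e)
        interchange = solve-∀

      scale-Dig : ∀ {k a b x ys} → Terms (Φ ∘ (a +_)) k x → Rows (DigAt w Ψ) S b ys →
                  Rows (DigAt (k * w) Χ) S (a + b) (scale x ys)
      scale-Dig A [] = []
      scale-Dig {k} {a} {b} {x} {y ∷ ys} A (q ∷ qs) =
        Dig-* (λ {d} {e} φ ψ → subst Χ (interchange a b d e) (f φ ψ)) A q ∷
        subst (λ c → Rows (DigAt (k * w) Χ) S c (scale x ys)) (sym (swap-+ a S b)) (scale-Dig A qs)

      -- `TermRows` adds up the terms of all blocks, so the digits are bounded by the total number
      -- of terms, however these are spread over the blocks.
      conv-Dig : ∀ {k a b xs ys} → TermRows Φ S k a xs → Rows (DigAt w Ψ) S b ys →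
                 Rows (DigAt (k * w) Χ) S (a + b) (conv xs ys)
      conv-Dig [] qs = []
      conv-Dig {a = a} {b} {x ∷ xs} {ys} (_∷_ {k} {l} A As) qs =
        subst (λ v → Rows (DigAt v Χ) S (a + b) (conv (x ∷ xs) ys)) (sym (*-distribʳ-+ w k l))
          (add-Dig {Φ = Χ} (scale-Dig A qs)
            (zero refl ∷ subst (λ c → Rows (DigAt (l * w) Χ) S c (conv xs ys)) (+-assoc S a b) (conv-Dig As qs)))

    -- A product of two blocks spans two blocks; its upper part is added to the next one. Digits are
    -- added without being normalised, so their bound doubles.
    carry : ℕ → ℕ → List ℕ → List ℕ
    carry B h []       = h ∷ []
    carry B h (x ∷ xs) = h + x %1+ B ∷ carry B (x /1+ B) xs

    carry-Dig : ∀ {w Φ S B b h xs} → w < Z → suc B ≡ Z ^ S → DigAt w Φ b h → Rows (DigAt w Φ) S b xs →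
                Rows (DigAt (w + w) Φ) S b (carry B h xs)
    carry-Dig {w} w<Z B≡ H [] = Dig-map (m≤m+n w w) (λ _ → id) H ∷ []
    carry-Dig {w} {Φ} {S} {B} {b} w<Z B≡ H (p ∷ ps) =
      Dig-+ H (Dig-map ≤-refl (λ _ → proj₁) (Dig-% {k = S} w<Z B≡ p)) ∷
      carry-Dig {Φ = Φ} w<Z B≡ (Dig-map ≤-refl (λ i → subst Φ (eq b S i)) (Dig-/ {k = S} w<Z B≡ p)) ps
      where
      eq : ∀ b S i → b + (S + i) ≡ S + b + i
      eq = solve-∀

    -- With `B` equal to `Z ^ W`, these are the numbers Z^(2^j W) - 1 for j < β, the largest first:
    -- the divisors that halve a block of 2^β rows until single rows remain.
    halves : ℕ → ℕ → List ℕ → List ℕ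
    halves zero    B l = l
    halves (suc β) B l = halves β (B * B) (pred B ∷ l)

    data Halves (W : ℕ) : ℕ → List ℕ → Set where
      []  : Halves W 0 []
      _∷_ : ∀ {β B l} → suc B ≡ Z ^ (2 ^ β * W) → Halves W β l → Halves W (suc β) (B ∷ l)

    halves-sound : ∀ {W} β {γ B l} → B ≡ Z ^ (2 ^ γ * W) → Halves W γ l → Halves W (β + γ) (halves β B l)
    halves-sound zero B≡ hs = hs
    halves-sound {W} (suc β) {γ} {B} {l} B≡ hs =
      subst (λ k → Halves W k (halves β (B * B) (pred B ∷ l))) (+-suc β γ) (halves-sound β BB≡ (B≡′ ∷ hs))
      where
      BB≡ : B * B ≡ Z ^ (2 ^ suc γ * W)
      BB≡ = trans (cong₂ _*_ B≡ B≡) (trans (sym (^-distribˡ-+-* Z (2 ^ γ * W) (2 ^ γ * W))) (cong (Z ^_) (eq (2 ^ γ) W)))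
        where
        eq : ∀ x W → x * W + x * W ≡ (x + (x + 0)) * W
        eq = solve-∀
      B≡′ : suc (pred B) ≡ Z ^ (2 ^ γ * W)
      B≡′ = trans (suc-pred B {{>-nonZero (subst (0 <_) (sym B≡) (m^n>0 Z (2 ^ γ * W)))}}) B≡

    -- B + 1 is Z to the length of a row.
    unblock : ℕ → List ℕ → ℕ → List ℕ
    unblock B []       v = v %1+ B ∷ []
    unblock B (C ∷ hs) v = unblock B hs (v %1+ C) ++ unblock B hs (v /1+ C)

    unblocks : ℕ → List ℕ → List ℕ → List ℕ
    unblocks B hs []       = []
    unblocks B hs (v ∷ vs) = unblock B hs v ++ unblocks B hs vs

    module _ {w W B : ℕ} (w<Z : w < Z) (B≡ : suc B ≡ Z ^ W) where

      length-unblock : ∀ {β hs} → Halves W β hs → ∀ v → length (unblock B hs v) ≡ 2 ^ β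
      length-unblock []                 v = refl
      length-unblock (_∷_ {β} {C} {hs} _ Hs) v = trans (length-++ (unblock B hs (v %1+ C)))
        (cong₂ _+_ (length-unblock Hs (v %1+ C)) (trans (length-unblock Hs (v /1+ C)) (sym (+-identityʳ (2 ^ β)))))

      RowAt : (ℕ → Set) → ℕ → ℕ → Set₁
      RowAt Φ b = Dig w (λ c → Φ (b + c) × c < W)

      unblock-Dig : ∀ {Φ b β hs v} → Halves W β hs → DigAt w Φ b v → Rows (RowAt Φ) W b (unblock B hs v)
      unblock-Dig [] D = Dig-% {k = W} w<Z B≡ D ∷ []
      unblock-Dig {Φ} {b} {v = v} (_∷_ {β} {C} {hs} C≡ Hs) D =
        Rows-++ (unblock-Dig {Φ} Hs (Dig-map ≤-refl (λ _ → proj₁) (Dig-% {k = 2 ^ β * W} w<Z C≡ D)))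
          (subst (λ k → Rows (RowAt Φ) W (k * W + b) (unblock B hs (v /1+ C))) (sym (length-unblock Hs (v %1+ C)))
            (unblock-Dig {Φ} Hs (Dig-map ≤-refl (λ i → subst Φ (eq b (2 ^ β * W) i)) (Dig-/ {k = 2 ^ β * W} w<Z C≡ D))))
        where
        eq : ∀ b S i → b + (S + i) ≡ S + b + i
        eq = solve-∀

      unblocks-Dig : ∀ {Φ S b β hs vs} → Halves W β hs → S ≡ 2 ^ β * W → Rows (DigAt w Φ) S b vs →
                     Rows (RowAt Φ) W b (unblocks B hs vs)
      unblocks-Dig Hs S≡ [] = []
      unblocks-Dig {Φ} {S} {b} {β} {hs} {v ∷ vs} Hs S≡ (p ∷ ps) =
        Rows-++ (unblock-Dig {Φ} Hs p)
          (subst (λ k → Rows (RowAt Φ) W (k + b) (unblocks B hs vs))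
            (trans S≡ (cong (_* W) (sym (length-unblock Hs v)))) (unblocks-Dig {Φ} Hs S≡ ps))

    -- Row-major numbering of an array of width `W`; `c < W` makes row and column recoverable from
    -- the position.
    At : (ℕ → ℕ → Set) → ℕ → ℕ → Set
    At R W e = ∃[ r ] ∃[ c ] (e ≡ r * W + c × c < W × R r c)

    RowDig : ℕ → (ℕ → ℕ → Set) → ℕ → ℕ → Set₁
    RowDig w R r = Dig w (R r)

    At-unique : ∀ {R W r c} → At R (suc W) (r * suc W + c) → c < suc W → R r c
    At-unique {R} {W} {r} {c} (r′ , c′ , eq , c′<W , ρ) c<W = subst₂ R r′≡r c′≡c ρ
      where
      eq′ : c + r * suc W ≡ c′ + r′ * suc W
      eq′ = trans (+-comm c (r * suc W)) (trans eq (+-comm (r′ * suc W) c′))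
      c′≡c : c′ ≡ c
      c′≡c = trans (sym (%-unique r′ c′<W)) (trans (cong (_%1+ W) (sym eq′)) (%-unique r c<W))
      r′≡r : r′ ≡ r
      r′≡r = trans (sym (/-unique r′ c′<W)) (trans (cong (_/1+ W) (sym eq′)) (/-unique r c<W))

    rows : ∀ {w R W r xs} → Rows (λ b → Dig w (λ c → At R (suc W) (b + c) × c < suc W)) (suc W) (r * suc W) xs →
           Rows (RowDig w R) 1 r xs
    rows []       = []
    rows {R = R} (p ∷ ps) = Dig-map ≤-refl (λ _ (a , c<W) → At-unique {R} a c<W) p ∷ rows ps

    Rows-take : ∀ {P b xs} k → Rows P 1 b xs → Rows P 1 b (take k xs)
    Rows-take zero    ps       = []
    Rows-take (suc k) []       = []
    Rows-take (suc k) (p ∷ ps) = p ∷ Rows-take k ps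

    Rows-drop : ∀ {P b xs} k → Rows P 1 b xs → Rows P 1 (k + b) (drop k xs)
    Rows-drop zero    ps       = ps
    Rows-drop (suc k) []       = []
    Rows-drop {P} {b} {_ ∷ xs} (suc k) (p ∷ ps) = subst (λ c → Rows P 1 c (drop k xs)) (+-suc k b) (Rows-drop k ps)

    overlay : ℕ → List ℕ → List ℕ → List ℕ
    overlay B []       ys       = []
    overlay B (x ∷ xs) []       = x ∷ xs
    overlay B (x ∷ xs) (y ∷ ys) = x + B * y ∷ overlay B xs ys

    overlay-Dig : ∀ {w R k σ b xs ys} → (∀ {r c} → R (k + r) c → R r (σ + c)) →
                  Rows (RowDig w R) 1 b xs → Rows (RowDig w R) 1 (k + b) ys → Rows (RowDig (w + w) R) 1 b (overlay (Z ^ σ) xs ys)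
    overlay-Dig wrap [] qs = []
    overlay-Dig {w} wrap (p ∷ ps) [] = Rows-map (Dig-map (m≤m+n w w) (λ _ → id)) (p ∷ ps)
    overlay-Dig {w} {R} {k} {σ} {b} {_} {_ ∷ ys} wrap (p ∷ ps) (q ∷ qs) =
      Dig-+ p (Dig-shift σ (Dig-map ≤-refl (λ _ → wrap) q)) ∷
      overlay-Dig {R = R} wrap ps (subst (λ c → Rows (RowDig w R) 1 c ys) (sym (+-suc k b)) qs)

    -- The lattice identifies row `k + r` with row `r`, up to a shift of the columns by σ; `B` is
    -- `Z ^ σ`.
    wrapRows : ℕ → ℕ → List ℕ → List ℕ
    wrapRows k B xs = overlay B (take k xs) (drop k xs)

    -- Columns modulo `w₂`, when `suc B` is `Z ^ w₂`.
    fold : ℕ → ℕ → ℕ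
    fold B v = v /1+ B + v %1+ B

    fold-Dig : ∀ {w Φ B k v} → w < Z → suc B ≡ Z ^ k → (∀ {c} → Φ (k + c) → Φ c) → Dig w Φ v → Dig (w + w) Φ (fold B v)
    fold-Dig {k = k} w<Z B≡ wrap D =
      Dig-+ (Dig-map ≤-refl (λ _ → wrap) (Dig-/ {k = k} w<Z B≡ D)) (Dig-map ≤-refl (λ _ → proj₁) (Dig-% {k = k} w<Z B≡ D))

    -- The first argument tells whether a vertical line already covers the whole row. Two foldings,
    -- because a sum of two columns shifted by σ may exceed 2 w₂.
    checkRow : ℕ → ℕ → ℕ → ℕ → Bool
    checkRow zero    B w₂ v = digits w₂ (fold B (fold B v))
    checkRow (suc _) B w₂ v = true

    -- From one row to the next `X` loses its lowest digit, and `D` is multiplied by `Z` since a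
    -- diagonal advances by one column per row. `Y`, the horizontal lines, stays.
    checkRows : ℕ → ℕ → ℕ → ℕ → ℕ → ℕ → List ℕ → Bool
    checkRows B w₂ Y zero    X D vs       = true
    checkRows B w₂ Y (suc k) X D []       = false
    checkRows B w₂ Y (suc k) X D (v ∷ vs) = checkRow (X %1+ Z-1) B w₂ (v + (Y + D)) ∧ checkRows B w₂ Y k (X /1+ Z-1) (Z * D) vs

    Diagonal : (ℕ → ℕ → Set) → ℕ → ℕ → Set
    Diagonal R r c = ∃[ d ] (c ≡ r + d × (∀ u → R u (u + d)))

    module _ {R : ℕ → ℕ → Set} {w B w₂ Y : ℕ} (4w<Z : (w + 2 + (w + 2)) + (w + 2 + (w + 2)) < Z) (B≡ : suc B ≡ Z ^ w₂)
             (wrap : ∀ {r c} → R r (w₂ + c) → R r c) (Ys : Dig 1 (λ c → ∀ r → R r c) Y) where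

      private
        2w<Z : w + 2 + (w + 2) < Z
        2w<Z = ≤-<-trans (m≤m+n (w + 2 + (w + 2)) (w + 2 + (w + 2))) 4w<Z
        1w<Z : w + 2 < Z
        1w<Z = ≤-<-trans (m≤m+n (w + 2) (w + 2)) 2w<Z
        1<Z : 1 < Z
        1<Z = ≤-<-trans (≤-trans (s≤s z≤n) (m≤n+m 2 w)) 1w<Z

      checkRow-sound : ∀ {r X D v} → Dig 1 (λ i → ∀ c → R (i + r) c) X → Dig 1 (Diagonal R r) D → Dig w (R r) v →
                       checkRow (X %1+ Z-1) B w₂ (v + (Y + D)) ≡ true → ∀ c → c < w₂ → R r c
      checkRow-sound {r} {X} {D} {v} Xs Ds Vs ok c c<w with X %1+ Z-1 in eq
      ... | zero = digits-sound 4w<Z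
                     (fold-Dig 2w<Z B≡ wrap (fold-Dig 1w<Z B≡ wrap (Dig-+ Vs (Dig-+ (Dig-map ≤-refl (λ _ f → f r) Ys)
                       (Dig-map ≤-refl (λ { _ (d , refl , f) → f r }) Ds))))) w₂ ok c c<w
      ... | suc _ with Dig-nonzero (Dig-% {k = 1} 1<Z Z^1 Xs) (λ X%≡0 → 1+n≢0 (trans (sym eq) X%≡0))
      ...   | zero  , φ , _ = φ c
      ...   | suc _ , _ , s≤s ()

      checkRows-sound : ∀ k {r X D vs} → Dig 1 (λ i → ∀ c → R (i + r) c) X → Dig 1 (Diagonal R r) D →
                        Rows (RowDig w R) 1 r vs → checkRows B w₂ Y k X D vs ≡ true →
                        ∀ i → i < k → ∀ c → c < w₂ → R (i + r) c
      checkRows-sound (suc k) {r} {X} {D} {v ∷ vs} Xs Ds (V ∷ Vs) ok zero _ = checkRow-sound Xs Ds V (proj₁ (∧-true ok))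
      checkRows-sound (suc k) {r} {X} {D} {v ∷ vs} Xs Ds (V ∷ Vs) ok (suc i) (s≤s i<k) c c<w =
        subst (λ u → R u c) (+-suc i r)
          (checkRows-sound k (Dig-map ≤-refl (λ j f c → subst (λ u → R u c) (sym (+-suc j r)) (f c)) (Dig-/ {k = 1} 1<Z Z^1 Xs))
            (subst (Dig 1 _) (cong (_* D) (*-identityʳ Z)) (Dig-shift 1 (Dig-map ≤-refl (λ { _ (d , refl , f) → d , refl , f }) Ds)))
            Vs (proj₂ (∧-true {checkRow (X %1+ Z-1) B w₂ (v + (Y + D))} ok)) i i<k c c<w)

    square : ℕ → ℕ → ℕ
    square zero    B = B
    square (suc β) B = square β (B * B)

    square-sound : ∀ {W} β γ {B} → B ≡ Z ^ (2 ^ γ * W) → square β B ≡ Z ^ (2 ^ (β + γ) * W)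
    square-sound zero γ B≡ = B≡
    square-sound {W} (suc β) γ {B} B≡ = trans (square-sound β (suc γ)
      (trans (cong₂ _*_ B≡ B≡) (trans (sym (^-distribˡ-+-* Z (2 ^ γ * W) (2 ^ γ * W))) (cong (Z ^_) (eq (2 ^ γ) W)))))
      (cong (λ k → Z ^ (2 ^ k * W)) (+-suc β γ))
      where
      eq : ∀ x W → x * W + x * W ≡ (x + (x + 0)) * W
      eq = solve-∀

    suc-pred-^ : ∀ k → suc (pred (Z ^ k)) ≡ Z ^ k
    suc-pred-^ k = suc-pred (Z ^ k) {{m^n≢0 Z k}}

    -- Keys and curve points are added on a cylinder of w₁ rows and w₂ columns.
    module Cover (κ β W-1 w₁ w₂ σ : ℕ) where

      W S : ℕ
      W = suc W-1
      S = 2 ^ β * W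

      cover′ : ℕ → List (ℕ × ℕ) → List ℕ → List ℕ → List ℕ → List ℕ → List ℕ → Bool
      cover′ ZW lv keys curve xs ys ds =
        checkRows (pred (Z ^ w₂)) w₂ (powers lv ys) w₁ (powers lv xs) (powers lv ds)
          (wrapRows w₁ (Z ^ σ) (unblocks (pred ZW) (halves β ZW [])
            (carry (pred (square β ZW)) 0 (conv (blocks κ S lv keys) (blocks κ S lv curve)))))

      -- For k keys the digits of the product are at most k. The carry doubles this, the wrapping of
      -- rows doubles it again, horizontal and diagonal lines add 2, and each of the two foldings
      -- doubles: 4 (4 k + 2) = 16 k + 8.
      cover : ℕ → List ℕ → List ℕ → List ℕ → List ℕ → List ℕ → Bool
      cover f keys curve xs ys ds = (16 * length keys + 8 <ᵇ Z) ∧ cover′ (Z ^ W) (levels f 1 Z []) keys curve xs ys ds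

      cover-sound : ∀ {R Φ Ψ} f {keys curve xs ys ds} →
                    (∀ {d e} → Φ d → Ψ e → At R W (d + e)) →
                    (∀ {r c} → R (w₁ + r) c → R r (σ + c)) →
                    (∀ {r c} → R r (w₂ + c) → R r c) →
                    All Φ keys → All Ψ curve → All (λ i → ∀ c → R i c) xs → All (λ c → ∀ r → R r c) ys →
                    All (λ d → ∀ u → R u (u + d)) ds →
                    cover f keys curve xs ys ds ≡ true → ∀ i → i < w₁ → ∀ c → c < w₂ → R i c
      cover-sound {R} {Φ} {Ψ} f {keys} {curve} {xs} {ys} {ds} φψ wrap₁ wrap₂ φs ψs Xs Ys Ds ok i i<w₁ c c<w₂ =
        subst (λ u → R u c) (+-identityʳ i)
          (checkRows-sound 4w<Z (suc-pred-^ w₂) wrap₂ (powers-Dig lvs ys Ys) w₁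
            (powers-Dig lvs xs (All.map (λ {i} ρ c → subst (λ u → R u c) (sym (+-identityʳ i)) (ρ c)) Xs))
            (powers-Dig lvs ds (All.map (λ {d} ρ → d , refl , ρ) Ds))
            (overlay-Dig {R = R} wrap₁ (Rows-take w₁ table) (Rows-drop w₁ table))
            (proj₂ (∧-true {16 * length keys + 8 <ᵇ Z} ok)) i i<w₁ c c<w₂)
        where
        lvs : All Level (levels f 1 Z [])
        lvs = levels-sound f {1} (sym (*-identityʳ Z)) []
        k = length keys
        16k<Z : 16 * k + 8 < Z
        16k<Z = <ᵇ⇒< (16 * k + 8) Z (if-true (proj₁ (∧-true ok)))
        4w<Z : (k + k + (k + k) + 2 + (k + k + (k + k) + 2)) + (k + k + (k + k) + 2 + (k + k + (k + k) + 2)) < Z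
        4w<Z = subst (_< Z) (eq k) 16k<Z
          where
          eq : ∀ k → 16 * k + 8 ≡ (k + k + (k + k) + 2 + (k + k + (k + k) + 2)) + (k + k + (k + k) + 2 + (k + k + (k + k) + 2))
          eq = solve-∀
        2k<Z : k + k < Z
        2k<Z = ≤-<-trans (≤-trans (≤-trans (m≤m+n (k + k) (k + k)) (m≤m+n (k + k + (k + k)) 2))
                           (≤-trans (m≤m+n _ (k + k + (k + k) + 2)) (m≤m+n _ _))) 4w<Z
        k<Z : k < Z
        k<Z = ≤-<-trans (m≤m+n k k) 2k<Z
        terms = blocks-Terms {Φ} {S = S} lvs κ 0 keys φs
        convolution : Rows (DigAt k (At R W)) S 0 (conv (blocks κ S (levels f 1 Z []) keys) (blocks κ S (levels f 1 Z []) curve))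
        convolution = Rows-map (Dig-map (subst (_≤ k) (sym (*-identityʳ (proj₁ terms))) (proj₁ (proj₂ terms))) (λ _ → id))
          (conv-Dig {w = 1} {Φ = Φ} {Ψ} {At R W} φψ (proj₂ (proj₂ terms)) (blocks-Dig {Ψ} lvs κ 0 curve ψs))
        ZS≡ : suc (pred (square β (Z ^ W))) ≡ Z ^ S
        ZS≡ = trans (cong (suc ∘ pred) sq) (trans (suc-pred-^ S) refl)
          where
          sq : square β (Z ^ W) ≡ Z ^ S
          sq = trans (square-sound β 0 (cong (Z ^_) (sym (*-identityˡ W)))) (cong (λ j → Z ^ (2 ^ j * W)) (+-identityʳ β))
        table : Rows (RowDig (k + k) R) 1 0 (unblocks (pred (Z ^ W)) (halves β (Z ^ W) [])
                  (carry (pred (square β (Z ^ W))) 0 (conv (blocks κ S (levels f 1 Z []) keys) (blocks κ S (levels f 1 Z []) curve))))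
        table = rows (unblocks-Dig 2k<Z (suc-pred-^ W) {At R W}
                  (subst (λ j → Halves W j (halves β (Z ^ W) [])) (+-identityʳ β) (halves-sound β (cong (Z ^_) (sym (*-identityˡ W))) []))
                  refl (carry-Dig {Φ = At R W} k<Z ZS≡ (zero refl) convolution))

-- Finite fields: characteristic, Fermat's theorem, number of roots.

module Fields where

  open Numerals
  open import Algebra.Bundles using (CommutativeRing)
  import Algebra.Properties.CommutativeMonoid.Sum as Sum
  import Algebra.Solver.Ring.NaturalCoefficients.Default as Solver
  open import Data.Empty using (⊥-elim)
  open import Data.Fin.Base using (Fin; zero; suc; punchIn)
  import Data.Fin.Permutation as Perm
  import Data.Fin.Properties as Fin
  open import Data.List.Base using (List; []; _∷_; length)
  open import Data.List.Relation.Unary.All using (All; []; _∷_)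
  open import Data.Nat.Base using (ℕ; zero; suc; _≤_; s≤s)
  import Data.Nat.Base as ℕ
  import Data.Nat.Properties as ℕ
  open import Data.Product.Base using (_,_; proj₁; proj₂)
  open import Data.Vec.Base using ([]; _∷_)
  open import Function.Base using (_∘_; id)
  open import Function.Definitions using (Injective)
  open import Level using (0ℓ)
  open import Relation.Binary.PropositionalEquality
  open import Relation.Nullary using (Dec; yes; no)

  module Field {n : ℕ} (F : FiniteField (suc n)) where
    open FiniteField F public renaming (_+_ to infixl 6 _+_; _*_ to infixl 7 _*_; -_ to infix 8 -_)

    K : Set
    K = Fin (suc n)

    ring : CommutativeRing 0ℓ 0ℓ
    ring = record { isCommutativeRing = isCommutativeRing }

    open CommutativeRing ring public using
      ( +-assoc; +-comm; +-identityˡ; +-identityʳ; *-assoc; *-comm; *-identityˡ; *-identityʳ; zeroˡ; zeroʳ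
      ; distribˡ; distribʳ; -‿inverseˡ; -‿inverseʳ; +-commutativeMonoid; *-commutativeMonoid; commutativeSemiring )
    open Solver commutativeSemiring public using (solve; _:+_; _:*_; _:=_; con)

    infix 4 _≟_
    _≟_ : (x y : K) → Dec (x ≡ y)
    _≟_ = Fin._≟_

    inv : ∀ {x} → x ≢ 0F → K
    inv x≢0 = proj₁ (inverse _ x≢0)

    inv-* : ∀ {x} (x≢0 : x ≢ 0F) → inv x≢0 * x ≡ 1F
    inv-* x≢0 = trans (*-comm _ _) (proj₂ (inverse _ x≢0))

    *-cancelˡ : ∀ {x} y z → x ≢ 0F → x * y ≡ x * z → y ≡ z
    *-cancelˡ {x} y z x≢0 xy≡xz = begin
      y                 ≡⟨ undo y ⟨
      inv x≢0 * (x * y) ≡⟨ cong (inv x≢0 *_) xy≡xz ⟩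
      inv x≢0 * (x * z) ≡⟨ undo z ⟩
      z                 ∎
      where
      open ≡-Reasoning
      undo : ∀ y → inv x≢0 * (x * y) ≡ y
      undo y = trans (sym (*-assoc _ x y)) (trans (cong (_* y) (inv-* x≢0)) (*-identityˡ y))

    *-nonzero : ∀ {x y} → x ≢ 0F → y ≢ 0F → x * y ≢ 0F
    *-nonzero {x} {y} x≢0 y≢0 xy≡0 = y≢0 (*-cancelˡ y 0F x≢0 (trans xy≡0 (sym (zeroʳ x))))

    +-cancelˡ : ∀ x {y z} → x + y ≡ x + z → y ≡ z
    +-cancelˡ x {y} {z} eq = begin
      y             ≡⟨ undo y ⟨
      - x + (x + y) ≡⟨ cong (- x +_) eq ⟩
      - x + (x + z) ≡⟨ undo z ⟩
      z             ∎
      where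
      open ≡-Reasoning
      undo : ∀ y → - x + (x + y) ≡ y
      undo y = trans (sym (+-assoc (- x) x y)) (trans (cong (_+ y) (-‿inverseˡ x)) (+-identityˡ y))

    infixr 8 _^_
    _^_ : K → ℕ → K
    x ^ zero  = 1F
    x ^ suc k = x * x ^ k

    ^-+ : ∀ x j k → x ^ (j ℕ.+ k) ≡ x ^ j * x ^ k
    ^-+ x zero    k = sym (*-identityˡ _)
    ^-+ x (suc j) k = trans (cong (x *_) (^-+ x j k)) (sym (*-assoc x (x ^ j) (x ^ k)))

    1^ : ∀ k → 1F ^ k ≡ 1F
    1^ zero    = refl
    1^ (suc k) = trans (*-identityˡ _) (1^ k)

    ^-* : ∀ x j k → x ^ (j ℕ.* k) ≡ (x ^ k) ^ j
    ^-* x zero    k = refl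
    ^-* x (suc j) k = trans (^-+ x k (j ℕ.* k)) (cong (x ^ k *_) (^-* x j k))

    ^-nonzero : ∀ {x} → x ≢ 0F → ∀ k → x ^ k ≢ 0F
    ^-nonzero x≢0 zero    = 0≢1 ∘ sym
    ^-nonzero x≢0 (suc k) = *-nonzero x≢0 (^-nonzero x≢0 k)

    num : ℕ → K
    num zero    = 0F
    num (suc k) = 1F + num k

    num-+ : ∀ j k → num (j ℕ.+ k) ≡ num j + num k
    num-+ zero    k = sym (+-identityˡ _)
    num-+ (suc j) k = trans (cong (1F +_) (num-+ j k)) (sym (+-assoc 1F (num j) (num k)))

    num-* : ∀ j k → num (j ℕ.* k) ≡ num j * num k
    num-* zero    k = sym (zeroˡ _)
    num-* (suc j) k = begin
      num (k ℕ.+ j ℕ.* k)      ≡⟨ num-+ k (j ℕ.* k) ⟩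
      num k + num (j ℕ.* k)    ≡⟨ cong₂ _+_ (sym (*-identityˡ _)) (num-* j k) ⟩
      1F * num k + num j * num k ≡⟨ distribʳ (num k) 1F (num j) ⟨
      (1F + num j) * num k     ∎
      where open ≡-Reasoning

    num-^ : ∀ p e → num (p ℕ.^ e) ≡ num p ^ e
    num-^ p zero    = +-identityʳ 1F
    num-^ p (suc e) = trans (num-* p (p ℕ.^ e)) (cong (num p *_) (num-^ p e))

    -- Translation by 1 permutes the field, so the sum of all elements does not change when 1 is added to each.
    num-q : num (suc n) ≡ 0F
    num-q = sym (+-cancelˡ total (begin
      total + 0F                        ≡⟨ +-identityʳ total ⟩
      total                             ≡⟨ S.sum-permute id translation ⟩
      S.sum (λ x → x + 1F)              ≡⟨ S.∑-distrib-+ {suc n} id (λ _ → 1F) ⟩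
      total + S.sum {suc n} (λ _ → 1F)  ≡⟨ cong (total +_) (ones (suc n)) ⟩
      total + num (suc n)               ∎))
      where
      open ≡-Reasoning
      module S = Sum +-commutativeMonoid
      total : K
      total = S.sum {suc n} id
      ones : ∀ k → S.sum {k} (λ _ → 1F) ≡ num k
      ones zero    = refl
      ones (suc k) = cong (1F +_) (ones k)
      undo : ∀ x {a b} → a + b ≡ 0F → x + a + b ≡ x
      undo x {a} {b} ab≡0 = trans (+-assoc x a b) (trans (cong (x +_) ab≡0) (+-identityʳ x))
      translation : Perm.Permutation (suc n) (suc n)
      translation = Perm.permutation (_+ 1F) (_+ - 1F)
        (λ x → undo x (-‿inverseˡ 1F)) (λ x → undo x (-‿inverseʳ 1F))

    -- The `e`-th power of `num p` is `num` of the order, which is 0, and nonzero elements have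
    -- nonzero powers.
    num-char : ∀ p e → suc n ≡ p ℕ.^ e → num p ≡ 0F
    num-char p e q≡p^e with num p ≟ 0F
    ... | yes p≡0 = p≡0
    ... | no p≢0  = ⊥-elim (^-nonzero p≢0 e (trans (sym (num-^ p e)) (trans (cong num (sym q≡p^e)) num-q)))

    module P = Sum *-commutativeMonoid

    ∏-nonzero : ∀ {k} (f : Fin k → K) → (∀ i → f i ≢ 0F) → P.sum f ≢ 0F
    ∏-nonzero {zero}  f f≢0 = 0≢1 ∘ sym
    ∏-nonzero {suc k} f f≢0 = *-nonzero (f≢0 zero) (∏-nonzero (f ∘ suc) (f≢0 ∘ suc))

    ∏-const : ∀ {k} {f : Fin k → K} {x} → (∀ i → f i ≡ x) → P.sum f ≡ x ^ k
    ∏-const {zero}  f≡x = refl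
    ∏-const {suc k} f≡x = cong₂ _*_ (f≡x zero) (∏-const (f≡x ∘ suc))

    -- Puts 1 at the element 0, so that a product over the nonzero elements becomes a product over
    -- the whole carrier, which can be permuted.
    unit : K → K → K
    unit c x with x ≟ 0F
    ... | yes _ = 1F
    ... | no  _ = c

    unit-zero : ∀ c → unit c 0F ≡ 1F
    unit-zero c with 0F ≟ 0F
    ... | yes _   = refl
    ... | no  0≢0 = ⊥-elim (0≢0 refl)

    unit-nonzero : ∀ c {x} → x ≢ 0F → unit c x ≡ c
    unit-nonzero c {x} x≢0 with x ≟ 0F
    ... | yes x≡0 = ⊥-elim (x≢0 x≡0)
    ... | no  _   = refl

    -- Multiplication by `a` permutes the nonzero elements, so their product equals itself times
    -- `a ^ n`; being nonzero, it cancels.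
    fermat : ∀ {a} → a ≢ 0F → a ^ n ≡ 1F
    fermat {a} a≢0 = *-cancelˡ (a ^ n) 1F (∏-nonzero self self≢0) (begin
      total * a ^ n           ≡⟨ *-comm total (a ^ n) ⟩
      a ^ n * total           ≡⟨ cong (_* total) ∏-unit ⟨
      P.sum (unit a) * total  ≡⟨ P.∑-distrib-+ (unit a) self ⟨
      P.sum (λ x → unit a x * self x) ≡⟨ P.sum-cong-≗ step ⟨
      P.sum (λ x → self (a * x))      ≡⟨ P.sum-permute self scaling ⟨
      total                   ≡⟨ *-identityʳ total ⟨
      total * 1F              ∎)
      where
      open ≡-Reasoning
      self : K → K
      self x = unit x x
      total : K
      total = P.sum self
      self≢0 : ∀ x → self x ≢ 0F
      self≢0 x with x ≟ 0F
      ... | yes _   = 0≢1 ∘ sym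
      ... | no  x≢0 = x≢0
      step : ∀ x → self (a * x) ≡ unit a x * self x
      step x with x ≟ 0F
      ... | yes refl = trans (cong self (zeroʳ a)) (trans (unit-zero 0F) (sym (*-identityʳ 1F)))
      ... | no  x≢0  = unit-nonzero (a * x) (*-nonzero a≢0 x≢0)
      ∏-unit : P.sum (unit a) ≡ a ^ n
      ∏-unit = begin
        P.sum (unit a)                                       ≡⟨ P.sum-remove {i = 0F} (unit a) ⟩
        unit a 0F * P.sum (λ i → unit a (punchIn 0F i))      ≡⟨ cong₂ _*_ (unit-zero a) (∏-const (λ i → unit-nonzero a (Fin.punchInᵢ≢i 0F i))) ⟩
        1F * a ^ n                                           ≡⟨ *-identityˡ _ ⟩
        a ^ n                                                ∎
      scaling : Perm.Permutation (suc n) (suc n)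
      scaling = Perm.permutation (a *_) (inv a≢0 *_)
        (λ x → trans (sym (*-assoc a _ x)) (trans (cong (_* x) (proj₂ (inverse a a≢0))) (*-identityˡ x)))
        (λ x → trans (sym (*-assoc _ a x)) (trans (cong (_* x) (inv-* a≢0)) (*-identityˡ x)))

    -- Polynomials, constant coefficient first.
    poly : List K → K → K
    poly []       x = 0F
    poly (c ∷ cs) x = c + x * poly cs x

    quotient : K → List K → List K
    quotient a []       = []
    quotient a (c ∷ cs) = poly (c ∷ cs) a ∷ quotient a cs

    length-quotient : ∀ a cs → length (quotient a cs) ≡ length cs
    length-quotient a []       = refl
    length-quotient a (c ∷ cs) = cong suc (length-quotient a cs)

    -- x p(x) - a p(a) = (x - a) quotient(x), without subtraction.
    quotient-spec : ∀ a cs x → x * poly cs x + a * poly (quotient a cs) x ≡ a * poly cs a + x * poly (quotient a cs) x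
    quotient-spec a []       x = trans (cong₂ _+_ (zeroʳ x) (zeroʳ a)) (sym (cong₂ _+_ (zeroʳ a) (zeroʳ x)))
    quotient-spec a (c ∷ cs) x = begin
      x * (c + x * s) + a * (c + a * s′ + x * t)          ≡⟨ solve 6 (λ x a c s s′ t → x :* (c :+ x :* s) :+ a :* (c :+ a :* s′ :+ x :* t)
                                                                := x :* c :+ a :* (c :+ a :* s′) :+ x :* (x :* s :+ a :* t)) refl x a c s s′ t ⟩
      x * c + a * (c + a * s′) + x * (x * s + a * t)      ≡⟨ cong (λ y → x * c + a * (c + a * s′) + x * y) (quotient-spec a cs x) ⟩
      x * c + a * (c + a * s′) + x * (a * s′ + x * t)     ≡⟨ solve 6 (λ x a c s s′ t → x :* c :+ a :* (c :+ a :* s′) :+ x :* (a :* s′ :+ x :* t)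
                                                                := a :* (c :+ a :* s′) :+ x :* (c :+ a :* s′ :+ x :* t)) refl x a c s s′ t ⟩
      a * (c + a * s′) + x * (c + a * s′ + x * t)         ∎
      where
      open ≡-Reasoning
      s s′ t : K
      s  = poly cs x
      s′ = poly cs a
      t  = poly (quotient a cs) x

    Zero : List K → Set
    Zero = All (_≡ 0F)

    poly-Zero : ∀ {cs} → Zero cs → ∀ x → poly cs x ≡ 0F
    poly-Zero []          x = refl
    poly-Zero (refl ∷ zs) x = trans (+-identityˡ _) (trans (cong (x *_) (poly-Zero zs x)) (zeroʳ x))

    leading : ∀ {c cs x} → Zero cs → poly (c ∷ cs) x ≡ 0F → c ≡ 0F
    leading {c} {cs} {x} zs p≡0 =
      trans (sym (+-identityʳ c)) (trans (cong (c +_) (sym (trans (cong (x *_) (poly-Zero zs x)) (zeroʳ x)))) p≡0)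

    quotient-Zero : ∀ a cs → Zero (quotient a cs) → Zero cs
    quotient-Zero a []       []       = []
    quotient-Zero a (c ∷ cs) (z ∷ zs) = leading {c} {cs} {a} (quotient-Zero a cs zs) z ∷ quotient-Zero a cs zs

    -- With `a` the first root, (x - a) Q(x) = 0 at every other root x, where Q is the quotient
    -- built from the tail. By induction Q is zero, hence so is the tail, and then the constant
    -- coefficient.
    roots : ∀ {k} cs (f : Fin k → K) → Injective _≡_ _≡_ f → length cs ≤ k → (∀ i → poly cs (f i) ≡ 0F) → Zero cs
    roots []       f f-inj _         root = []
    roots {suc k} (c ∷ cs) f f-inj (s≤s len) root = leading {c} {cs} {a} zs (root zero) ∷ zs
      where
      a : K
      a = f zero
      vanish : ∀ i → poly (quotient a cs) (f (suc i)) ≡ 0F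
      vanish i with poly (quotient a cs) (f (suc i)) ≟ 0F
      ... | yes Q≡0 = Q≡0
      ... | no  Q≢0 = ⊥-elim (Fin.0≢1+n (f-inj (*-cancelˡ a x Q≢0 (trans (*-comm Q a) (trans (+-cancelˡ (x * poly cs x) eq) (*-comm x Q))))))
        where
        x Q : K
        x = f (suc i)
        Q = poly (quotient a cs) x
        eq : x * poly cs x + a * Q ≡ x * poly cs x + x * Q
        eq = trans (quotient-spec a cs x) (cong (_+ x * Q) (+-cancelˡ c (trans (root zero) (sym (root (suc i))))))
      zs : Zero cs
      zs = quotient-Zero a cs
        (roots (quotient a cs) (f ∘ suc) (Fin.suc-injective ∘ f-inj) (subst (_≤ k) (sym (length-quotient a cs)) len) vanish)

-- Residue arithmetic, existence of a root, discrete and Zech logarithms.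

module Logarithms where

  open Numerals
  open Fields
  open import Data.Bool.Base using (Bool; true; if_then_else_; _∧_)
  open import Data.Empty using (⊥-elim)
  open import Data.Fin.Base using (zero; suc; punchIn)
  import Data.Fin.Properties as Fin
  open import Data.List.Base using (List; []; _∷_; length)
  open import Data.List.Relation.Unary.All using ([]; _∷_)
  open import Data.Maybe.Base using (Maybe; just; nothing)
  open import Data.Nat.Base using (ℕ; zero; suc; _≤_; _<_; s≤s; _≡ᵇ_)
  import Data.Nat.Base as ℕ
  import Data.Nat.Properties as ℕ
  open import Data.Product.Base using (∃; _×_; _,_; proj₁; proj₂)
  open import Data.Vec.Base using (Vec; []; _∷_)
  open import Relation.Binary.PropositionalEquality
  open import Relation.Nullary using (¬_; yes; no)

  -- Residues modulo X^(m+1) = r over the integers modulo p, leading coefficient first.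
  Residue : ℕ → Set
  Residue m = Vec ℕ (suc m)

  module Residues (p-1 : ℕ) {m : ℕ} (r : Residue m) where

    -- `t` is the coefficient that overflows to X^(m+1) and is replaced by `t` times `r`.
    shift : ∀ {k} → ℕ → Vec ℕ k → Vec ℕ (suc k) → Vec ℕ (suc k)
    shift t []       (y ∷ []) = (t ℕ.* y) %1+ p-1 ∷ []
    shift t (x ∷ xs) (y ∷ ys) = (x ℕ.+ t ℕ.* y) %1+ p-1 ∷ shift t xs ys

    timesX : Residue m → Residue m
    timesX (t ∷ xs) = shift t xs r

    minus1 : ∀ {k} → Residue k → Residue k
    minus1 (x ∷ [])     = (x ℕ.+ p-1) %1+ p-1 ∷ []
    minus1 (x ∷ y ∷ xs) = x ∷ minus1 (y ∷ xs)

    constant : ∀ {k} → ℕ → Residue k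
    constant {zero}  c = c ∷ []
    constant {suc k} c = 0 ∷ constant c

    code : ∀ {k} → ℕ → Vec ℕ k → ℕ
    code a []       = a
    code a (x ∷ xs) = code (a ℕ.* suc p-1 ℕ.+ x) xs

    same : ∀ {k} → Vec ℕ k → Vec ℕ k → Bool
    same []       []       = true
    same (x ∷ xs) (y ∷ ys) = (x ≡ᵇ y) ∧ same xs ys

    same-sound : ∀ {k} (xs ys : Vec ℕ k) → same xs ys ≡ true → xs ≡ ys
    same-sound []       []       ok = refl
    same-sound (x ∷ xs) (y ∷ ys) ok =
      cong₂ _∷_ (ℕ.≡ᵇ⇒≡ x y (if-true (proj₁ (∧-true ok)))) (same-sound xs ys (proj₂ (∧-true {x ≡ᵇ y} ok)))

    power : ℕ → Residue m → Residue m
    power zero    v = v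
    power (suc k) v = power k (timesX v)

  module Tables (p-1 : ℕ) {m : ℕ} (r : Residue m) (ms : List ℕ) where
    open Residues p-1 r public

    logs : ℕ → ℕ → Residue m → Tree (Residue m × ℕ) → Tree (Residue m × ℕ)
    logs zero    d v t = t
    logs (suc k) d v t = logs k (suc d) (timesX v) (insert ms (code 0 v) (v , d) t)

    log′ : Residue m → Maybe (Residue m × ℕ) → Maybe ℕ
    log′ v nothing        = nothing
    -- Comparing the stored residue with `v` takes the place of a proof that `code` is injective.
    log′ v (just (w , d)) = if same v w then just d else nothing

    log : Tree (Residue m × ℕ) → Residue m → Maybe ℕ
    log t v = log′ v (find ms (code 0 v) t)

    -- Zech logarithms: d ↦ e when X^d = 1 + X^e.
    zechs  : Tree (Residue m × ℕ) → ℕ → ℕ → Residue m → Tree ℕ → Maybe (Tree ℕ)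
    zechs′ : Maybe ℕ → Tree (Residue m × ℕ) → ℕ → ℕ → Residue m → Tree ℕ → Maybe (Tree ℕ)
    zechs t zero    d v z = just z
    zechs t (suc k) d v z = zechs′ (log t (minus1 v)) t k d v z
    zechs′ nothing  t k d v z = nothing
    zechs′ (just e) t k d v z = zechs t k (suc d) (timesX v) (insert ms d e z)

  module Roots {n : ℕ} (F : FiniteField (suc n)) (p-1 : ℕ) {m : ℕ} (r : Residue m)
               (p≡0 : Field.num F (suc p-1) ≡ FiniteField.0F F) where
    open Field F
    open Residues p-1 r

    num-% : ∀ x → num (x %1+ p-1) ≡ num x
    num-% x = begin
      num (x %1+ p-1)                                       ≡⟨ +-identityʳ _ ⟨
      num (x %1+ p-1) + 0F                                  ≡⟨ cong (num (x %1+ p-1) +_) (trans (cong (num (x /1+ p-1) *_) p≡0) (zeroʳ _)) ⟨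
      num (x %1+ p-1) + num (x /1+ p-1) * num (suc p-1)     ≡⟨ cong (num (x %1+ p-1) +_) (num-* (x /1+ p-1) (suc p-1)) ⟨
      num (x %1+ p-1) + num (x /1+ p-1 ℕ.* suc p-1)         ≡⟨ num-+ (x %1+ p-1) _ ⟨
      num (x %1+ p-1 ℕ.+ x /1+ p-1 ℕ.* suc p-1)             ≡⟨ cong num (%/-spec x p-1) ⟨
      num x                                                 ∎
      where open ≡-Reasoning

    ev : ∀ {k} → K → Vec ℕ k → K
    ev a []               = 0F
    ev a (_∷_ {k} c cs) = num c * a ^ k + ev a cs

    ev-shift : ∀ a t {k} (xs : Vec ℕ k) ys → ev a (shift t xs ys) ≡ a * ev a xs + num t * ev a ys
    ev-shift a t [] (y ∷ []) = begin
      num ((t ℕ.* y) %1+ p-1) * 1F + 0F     ≡⟨ cong (λ c → c * 1F + 0F) (trans (num-% (t ℕ.* y)) (num-* t y)) ⟩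
      num t * num y * 1F + 0F               ≡⟨ solve 3 (λ a t y → t :* y :* con 1 :+ con 0 := a :* con 0 :+ t :* (y :* con 1 :+ con 0)) refl a (num t) (num y) ⟩
      a * 0F + num t * (num y * 1F + 0F)    ∎
      where open ≡-Reasoning
    ev-shift a t (_∷_ {k} x xs) (y ∷ ys) = begin
      num ((x ℕ.+ t ℕ.* y) %1+ p-1) * A + ev a (shift t xs ys)
        ≡⟨ cong₂ (λ c e → c * A + e) (trans (num-% (x ℕ.+ t ℕ.* y)) (trans (num-+ x (t ℕ.* y)) (cong (num x +_) (num-* t y)))) (ev-shift a t xs ys) ⟩
      (num x + num t * num y) * (a * a ^ k) + (a * ev a xs + num t * ev a ys)
        ≡⟨ solve 7 (λ a t x y B u v → (x :+ t :* y) :* (a :* B) :+ (a :* u :+ t :* v) := a :* (x :* B :+ u) :+ t :* (y :* (a :* B) :+ v))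
             refl a (num t) (num x) (num y) (a ^ k) (ev a xs) (ev a ys) ⟩
      a * (num x * a ^ k + ev a xs) + num t * (num y * A + ev a ys) ∎
      where
      open ≡-Reasoning
      A : K
      A = a ^ suc k

    -- Adding p - 1 to the constant coefficient subtracts 1, since p vanishes in the field.
    ev-minus1 : ∀ a {k} (v : Residue k) → 1F + ev a (minus1 v) ≡ ev a v
    ev-minus1 a (x ∷ []) = begin
      1F + (num ((x ℕ.+ p-1) %1+ p-1) * 1F + 0F) ≡⟨ cong (λ c → 1F + (c * 1F + 0F)) (trans (num-% (x ℕ.+ p-1)) (num-+ x p-1)) ⟩
      1F + ((num x + num p-1) * 1F + 0F)         ≡⟨ solve 2 (λ x p → con 1 :+ ((x :+ p) :* con 1 :+ con 0) := x :* con 1 :+ con 0 :+ (con 1 :+ p)) refl (num x) (num p-1) ⟩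
      num x * 1F + 0F + (1F + num p-1)           ≡⟨ cong (num x * 1F + 0F +_) p≡0 ⟩
      num x * 1F + 0F + 0F                       ≡⟨ +-identityʳ _ ⟩
      num x * 1F + 0F                            ∎
      where open ≡-Reasoning
    ev-minus1 a (_∷_ {k} x (y ∷ xs)) = begin
      1F + (num x * a ^ k + ev a (minus1 (y ∷ xs))) ≡⟨ solve 2 (λ u v → con 1 :+ (u :+ v) := u :+ (con 1 :+ v)) refl (num x * a ^ k) (ev a (minus1 (y ∷ xs))) ⟩
      num x * a ^ k + (1F + ev a (minus1 (y ∷ xs))) ≡⟨ cong (num x * a ^ k +_) (ev-minus1 a (y ∷ xs)) ⟩
      num x * a ^ k + ev a (y ∷ xs)                 ∎
      where open ≡-Reasoning

    ev-constant : ∀ a {k} c → ev a (constant {k} c) ≡ num c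
    ev-constant a {zero}  c = trans (+-identityʳ _) (*-identityʳ _)
    ev-constant a {suc k} c = trans (cong (_+ ev a (constant {k} c)) (zeroˡ _)) (trans (+-identityˡ _) (ev-constant a {k} c))

    ev-1 : ∀ a → ev a (constant {m} 1) ≡ 1F
    ev-1 a = trans (ev-constant a {m} 1) (+-identityʳ 1F)

    top : Residue m → ℕ
    top (t ∷ _) = t

    -- X v = timesX v + t (X^(m+1) - r), with the negative term moved across. The identity is
    -- polynomial: it holds at every `a`, before any root is known.
    ev-timesX : ∀ a v → a * ev a v + num (top v) * ev a r ≡ ev a (timesX v) + num (top v) * a ^ suc m
    ev-timesX a (t ∷ xs) = begin
      a * (num t * a ^ m + ev a xs) + num t * ev a r        ≡⟨ solve 5 (λ a t B u v → a :* (t :* B :+ u) :+ t :* v := a :* u :+ t :* v :+ t :* (a :* B)) refl a (num t) (a ^ m) (ev a xs) (ev a r) ⟩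
      a * ev a xs + num t * ev a r + num t * (a * a ^ m)    ≡⟨ cong (_+ num t * (a * a ^ m)) (ev-shift a t xs r) ⟨
      ev a (shift t xs r) + num t * a ^ suc m               ∎
      where open ≡-Reasoning

    -- The coefficients of the quotient of X^k v by X^(m+1) - r, constant coefficient first.
    tops : ℕ → Residue m → List K → List K
    tops zero    v cs = cs
    tops (suc k) v cs = tops k (timesX v) (num (top v) ∷ cs)

    length-tops : ∀ k v cs → length (tops k v cs) ≡ k ℕ.+ length cs
    length-tops zero    v cs = refl
    length-tops (suc k) v cs = trans (length-tops k (timesX v) (num (top v) ∷ cs)) (ℕ.+-suc k (length cs))

    -- Long division as an invariant: a^j minus the value of the residue is h(a) (a^(m+1) - r(a)). A
    -- step multiplies by X, and the coefficient it eliminates becomes the new constant coefficient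
    -- of h.
    division : ∀ a k j v cs → a ^ j + poly cs a * ev a r ≡ ev a v + poly cs a * a ^ suc m →
               a ^ (k ℕ.+ j) + poly (tops k v cs) a * ev a r ≡ ev a (power k v) + poly (tops k v cs) a * a ^ suc m
    division a zero    j v cs eq = eq
    division a (suc k) j v cs eq =
      subst (λ i → a ^ i + poly (tops k v′ cs′) a * ev a r ≡ ev a (power k v′) + poly (tops k v′ cs′) a * a ^ suc m) (ℕ.+-suc k j)
        (division a k (suc j) v′ cs′ (begin
          a * a ^ j + (t + a * h) * R          ≡⟨ solve 5 (λ a A t h R → a :* A :+ (t :+ a :* h) :* R := a :* (A :+ h :* R) :+ t :* R) refl a (a ^ j) t h R ⟩
          a * (a ^ j + h * R) + t * R          ≡⟨ cong (λ x → a * x + t * R) eq ⟩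
          a * (ev a v + h * B) + t * R         ≡⟨ solve 6 (λ a V t h R B → a :* (V :+ h :* B) :+ t :* R := a :* V :+ t :* R :+ a :* h :* B) refl a (ev a v) t h R B ⟩
          a * ev a v + t * R + a * h * B       ≡⟨ cong (_+ a * h * B) (ev-timesX a v) ⟩
          ev a v′ + t * B + a * h * B          ≡⟨ solve 5 (λ a V t h B → V :+ t :* B :+ a :* h :* B := V :+ (t :+ a :* h) :* B) refl a (ev a v′) t h B ⟩
          ev a v′ + (t + a * h) * B            ∎))
      where
      open ≡-Reasoning
      v′ = timesX v
      cs′ = num (top v) ∷ cs
      t h R B : K
      t = num (top v)
      h = poly cs a
      R = ev a r
      B = a ^ suc m

    Root : K → Set
    Root a = a ^ suc m ≡ ev a r

    module _ (period : power n (constant 1) ≡ constant 1) where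

      private
        h : List K
        h = tops n (constant 1) []

        X^n : ∀ a → a ^ n + poly h a * ev a r ≡ 1F + poly h a * a ^ suc m
        X^n a = subst₂ (λ i e → a ^ i + poly h a * ev a r ≡ e + poly h a * a ^ suc m) (ℕ.+-identityʳ n)
          (trans (cong (ev a) period) (ev-1 a))
          (division a n 0 (constant 1) [] (trans (cong (1F +_) (zeroˡ _)) (sym (cong₂ _+_ (ev-1 a) (zeroˡ _)))))

      -- X^n - 1 = (X^(m+1) - r) h, where h has too small a degree to vanish at every nonzero element.
      root : 0 < n → ∃ Root
      root 0<n with Fin.any? (λ a → a ^ suc m ≟ ev a r)
      ... | yes ∃root = ∃root
      -- Without a root, h vanishes at all n nonzero elements; having only n coefficients, it is the
      -- zero polynomial. Then X^n = 1 would hold at 0 as well.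
      ... | no  ¬root = ⊥-elim (0≢1 (begin
        0F                       ≡⟨ 0^ 0<n ⟨
        0F ^ n                   ≡⟨ +-identityʳ _ ⟨
        0F ^ n + 0F              ≡⟨ cong (0F ^ n +_) (h≡0 (ev 0F r)) ⟨
        0F ^ n + poly h 0F * ev 0F r      ≡⟨ X^n 0F ⟩
        1F + poly h 0F * 0F ^ suc m       ≡⟨ cong (1F +_) (h≡0 (0F ^ suc m)) ⟩
        1F + 0F                           ≡⟨ +-identityʳ 1F ⟩
        1F                                ∎))
        where
        open ≡-Reasoning
        0^ : ∀ {k} → 0 < k → 0F ^ k ≡ 0F
        0^ (s≤s _) = zeroˡ _
        vanish : ∀ a → a ≢ 0F → poly h a ≡ 0F
        vanish a a≢0 with poly h a ≟ 0F
        ... | yes h≡0 = h≡0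
        ... | no  h≢0 = ⊥-elim (¬root (a , sym (*-cancelˡ (ev a r) (a ^ suc m) h≢0
                          (+-cancelˡ 1F (trans (cong (_+ poly h a * ev a r) (sym (fermat a≢0))) (X^n a))))))
        zs : Zero h
        zs = roots h (punchIn 0F) (Fin.punchIn-injective 0F _ _) (ℕ.≤-reflexive (trans (length-tops n (constant 1) []) (ℕ.+-identityʳ n)))
               (λ i → vanish (punchIn 0F i) (Fin.punchInᵢ≢i 0F i))
        h≡0 : ∀ x → poly h 0F * x ≡ 0F
        h≡0 x = trans (cong (_* x) (poly-Zero zs 0F)) (zeroˡ x)

    module Logarithms (ms : List ℕ) {α : K} (α-root : Root α) where
      open Tables p-1 r ms using (logs; log; zechs)

      ev-timesX′ : ∀ v → ev α (timesX v) ≡ α * ev α v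
      ev-timesX′ v = +-cancelˡ (num (top v) * ev α r) (begin
        num (top v) * ev α r + ev α (timesX v)      ≡⟨ +-comm _ _ ⟩
        ev α (timesX v) + num (top v) * ev α r      ≡⟨ cong (λ x → ev α (timesX v) + num (top v) * x) α-root ⟨
        ev α (timesX v) + num (top v) * α ^ suc m   ≡⟨ ev-timesX α v ⟨
        α * ev α v + num (top v) * ev α r           ≡⟨ +-comm _ _ ⟩
        num (top v) * ev α r + α * ev α v           ∎)
        where open ≡-Reasoning

      step : ∀ v d → ev α v ≡ α ^ d → ev α (timesX v) ≡ α ^ suc d
      step v d eq = trans (ev-timesX′ v) (cong (α *_) eq)

      ev-power : ∀ k v d → ev α v ≡ α ^ d → ev α (power k v) ≡ α ^ (k ℕ.+ d)
      ev-power zero    v d eq = eq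
      ev-power (suc k) v d eq = trans (ev-power k (timesX v) (suc d) (step v d eq)) (cong (α ^_) (ℕ.+-suc k d))

      Log : ℕ → Residue m × ℕ → Set
      Log _ (v , d) = ev α v ≡ α ^ d

      Zech : ℕ → ℕ → Set
      Zech d e = α ^ d ≡ 1F + α ^ e

      logs-sound : ∀ k d v {t} → ev α v ≡ α ^ d → Entries ms Log t → Entries ms Log (logs k d v t)
      logs-sound zero    d v eq E = E
      logs-sound (suc k) d v eq E = logs-sound k (suc d) (timesX v) (step v d eq) (insert-Entries ms (code 0 v) E eq)

      log-sound : ∀ {t} v {d} → Entries ms Log t → log t v ≡ just d → ev α v ≡ α ^ d
      log-sound {t} v E eq with find ms (code 0 v) t in found
      ... | just (w , d) with same v w in v≡w
      log-sound {t} v E refl | just (w , d) | true =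
        trans (cong (ev α) (same-sound v w v≡w)) (find-sound ms (code 0 v) E found)

      -- The second component, that a logarithm was found for every exponent in the range, later
      -- yields the order of α.
      zechs-sound : ∀ {t} k d v {z z′} → Entries ms Log t → ev α v ≡ α ^ d → Entries ms Zech z →
                    zechs t k d v z ≡ just z′ → Entries ms Zech z′ × (∀ i → i < k → ∃ (Zech (i ℕ.+ d)))
      zechs-sound zero    d v L eq E refl = E , λ _ ()
      zechs-sound {t} (suc k) d v L eq E ok with log t (minus1 v) in found
      ... | just e with zechs-sound k (suc d) (timesX v) L (step v d eq) (insert-Entries ms d E zech) ok
        where
        zech : Zech d e
        zech = trans (sym eq) (trans (sym (ev-minus1 α v)) (cong (1F +_) (log-sound (minus1 v) L found)))
      ... | E′ , rest = E′ , λ where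
        zero    _         → e , trans (sym eq) (trans (sym (ev-minus1 α v)) (cong (1F +_) (log-sound (minus1 v) L found)))
        (suc i) (s≤s i<k) → subst (λ j → ∃ (Zech j)) (ℕ.+-suc i d) (rest i i<k)

-- Certificates and the Boolean check.

module Certificates where

  open Numerals
  open Logarithms
  open import Data.Bool.Base using (Bool; true; false; if_then_else_; _∧_; _∨_)
  open import Data.List.Base using (List; []; _∷_; _++_; length; map)
  open import Data.Maybe.Base using (Maybe; just; nothing)
  open import Data.Nat.Base
  open import Data.Product.Base using (_×_; _,_)
  open import Data.Vec.Base using ([]; _∷_)

  -- (i , j) stands for the point (α^i : α^j : 1).
  Point : Set
  Point = ℕ × ℕ

  data Direction : Set where
    up flat : Direction
    slope   : ℕ → Direction

  -- The lines x = α^i, y = α^j, y = α^d x and y = α^s x + α^t.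
  data Line : Set where
    vertical horizontal diagonal : ℕ → Line
    oblique : ℕ → ℕ → Line

  module Shifts (n-1 : ℕ) (ss : List Point) where

    n : ℕ
    n = suc n-1

    infixl 6 _⊖_
    _⊖_ : ℕ → ℕ → ℕ
    a ⊖ b = (a + (n ∸ b %1+ n-1)) %1+ n-1

    move : Point → Point → Point
    move (i , j) (a , b) = (i + a) %1+ n-1 , (j + b) %1+ n-1

    orbits : List Point → List Point
    orbits []       = []
    orbits (P ∷ Ps) = map (move P) ((0 , 0) ∷ ss) ++ orbits Ps

    number : Point → ℕ
    number (i , j) = i * n + j

    member : Point → List Point → Bool
    member (a , b) []              = false
    member (a , b) ((c , d) ∷ Ps) = ((a ≡ᵇ c) ∧ (b ≡ᵇ d)) ∨ member (a , b) Ps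

    closedAt : List Point → Point → List Point → Bool
    closedAt full s []        = true
    closedAt full s (s′ ∷ ss) = member (move s s′) full ∧ closedAt full s ss

    closed : List Point → List Point → Bool
    closed full []       = true
    closed full (s ∷ ss) = closedAt full s full ∧ closed full ss

  module Scan (n-1 : ℕ) (ms : List ℕ) (z : Tree ℕ) (ss : List Point) where
    open Shifts n-1 ss public

    -- Zech logarithms turn differences of coordinates into powers: the first difference is α^(i+b),
    -- the second α^(j+a), and the slope is their quotient.
    slopeOf : ℕ → ℕ → Maybe ℕ → Maybe ℕ → Maybe Direction
    slopeOf i j (just b) (just a) = just (slope ((j + a) ⊖ (i + b)))
    slopeOf i j _        _        = nothing

    direction′ : ℕ → ℕ → ℕ → ℕ → Maybe Direction
    direction′ i j zero      zero      = nothing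
    direction′ i j zero      (suc _)   = just up
    direction′ i j (suc _)   zero      = just flat
    direction′ i j b@(suc _) a@(suc _) = slopeOf i j (find ms b z) (find ms a z)

    direction : ℕ → ℕ → Point → Maybe Direction
    direction i j (i′ , j′) = direction′ i j (i′ ⊖ i) (j′ ⊖ j)

    prepend : Maybe Direction → Maybe (List Direction) → Maybe (List Direction)
    prepend (just d) (just ds) = just (d ∷ ds)
    prepend _        _         = nothing

    directions : ℕ → ℕ → List Point → Maybe (List Direction)
    directions i j []       = just []
    directions i j (Q ∷ Qs) = prepend (direction i j Q) (directions i j Qs)

    -- Slopes are below `n`, which leaves `n` and `suc n` for the two directions parallel to the
    -- axes.
    code : Direction → ℕ
    code up        = suc n
    code flat      = n
    code (slope s) = s

    obliqueLine : ℕ → ℕ → Maybe ℕ → List Line → List Line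
    obliqueLine s k nothing  ls = ls
    obliqueLine s k (just e) ls = oblique s (k + e) ∷ ls

    -- The intercept α^j - α^(s+i) vanishes for a diagonal line. Otherwise its logarithm is s + i +
    -- e, where e is the Zech logarithm of the difference of the two exponents.
    slopeLine : ℕ → ℕ → ℕ → ℕ → List Line → List Line
    slopeLine i j s zero      ls = diagonal s ∷ ls
    slopeLine i j s d@(suc _) ls = obliqueLine s (s + i) (find ms d z) ls

    line : ℕ → ℕ → Direction → List Line → List Line
    line i j up        ls = vertical i ∷ ls
    line i j flat      ls = horizontal j ∷ ls
    line i j (slope s) ls = slopeLine i j s (j ⊖ (s + i)) ls

    lines : ℕ → ℕ → List Direction → List Line → List Line
    lines i j []       ls = ls
    lines i j (d ∷ ds) ls = line i j d (lines i j ds ls)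

    -- From a representative only the rest of its orbit and the later orbits are inspected: a triple
    -- that meets an earlier orbit was excluded there, and a bisecant that meets one was recorded
    -- there up to translation.
    scan  : List Point → Maybe (List Line)
    scan′ : ℕ → ℕ → Maybe (List Direction) → Maybe (List Line) → Maybe (List Line)
    scan []             = just []
    scan ((i , j) ∷ Ps) = scan′ i j (directions i j (map (move (i , j)) ss ++ orbits Ps)) (scan Ps)
    scan′ i j (just ds) (just ls) = if distinct ms (map code ds) empty then just (lines i j ds ls) else nothing
    scan′ i j _         _         = nothing

  -- The translations (w₁ , τ) and (0 , w₂) of the exponents, σ = - τ; the periods of the exponents on the three axes.
  record Lattice : Set where
    field
      w₁-1 w₂-1 σ τ πx-1 πy-1 πd-1 : ℕ
      shifts : List Point

  module Exponents (n-1 : ℕ) (L : Lattice) (_⊖_ : ℕ → ℕ → ℕ) where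
    open Lattice L

    W-1 : ℕ
    W-1 = w₂-1 + suc w₂-1 + σ

    -- Removing u / w₁ copies of the translation (w₁ , τ) adds as many copies of - τ = σ to the
    -- second exponent, which is then taken modulo w₂.
    reduce : ℕ → ℕ → ℕ
    reduce u v = (u %1+ w₁-1) * suc W-1 + (v + (u /1+ w₁-1) * σ) %1+ w₂-1

    -- The line y = α^s x + α^t is the curve y = x + 1 scaled by α^(t-s) in x and by α^t in y.
    keys : List Line → List ℕ
    keys []                 = []
    keys (oblique s t ∷ ls) = reduce (t ⊖ s) t ∷ keys ls
    keys (_ ∷ ls)           = keys ls

    curve  : List ℕ → Tree ℕ → ℕ → List ℕ
    curve′ : List ℕ → Tree ℕ → ℕ → Maybe ℕ → List ℕ
    curve ms z zero    = []
    curve ms z (suc d) = curve′ ms z d (find ms d z)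
    curve′ ms z d nothing  = curve ms z d
    curve′ ms z d (just e) = reduce e d ∷ curve ms z d

    -- In the array of `Cover` rows are indexed by the exponent of x. A vertical line therefore
    -- fills a row of the array, and the numbers collected by `rowsOf` are columns of it.
    columns : List Line → List ℕ
    columns []                = []
    columns (vertical i ∷ ls) = i %1+ w₁-1 ∷ columns ls
    columns (_ ∷ ls)          = columns ls

    -- A shift (a , b) moves the line to second exponent b + j; every translate fills a column of
    -- the array of its own.
    rowsFor : ℕ → List Point → List ℕ → List ℕ
    rowsFor j []              l = l
    rowsFor j ((a , b) ∷ ps) l = (b + j) %1+ w₂-1 ∷ rowsFor j ps l

    rowsOf : List Point → List Line → List ℕ
    rowsOf ps []                  = []
    rowsOf ps (horizontal j ∷ ls) = rowsFor j ps (rowsOf ps ls)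
    rowsOf ps (_ ∷ ls)            = rowsOf ps ls

    -- The shift (a , b) turns y = α^d x into y = α^(b+d-a) x.
    diagonalsFor : ℕ → List Point → List ℕ → List ℕ
    diagonalsFor d []              l = l
    diagonalsFor d ((a , b) ∷ ps) l = ((b + d) ⊖ a) %1+ w₂-1 ∷ diagonalsFor d ps l

    diagonalsOf : List Point → List Line → List ℕ
    diagonalsOf ps []                = []
    diagonalsOf ps (diagonal d ∷ ls) = diagonalsFor d ps (diagonalsOf ps ls)
    diagonalsOf ps (_ ∷ ls)          = diagonalsOf ps ls

    -- μ is the logarithm of -1: an oblique line meets y = 0 at x = - α^(t-s).
    axisX : ℕ → List Line → List ℕ
    axisX μ []                 = []
    axisX μ (oblique s t ∷ ls) = ((μ + t) ⊖ s) %1+ πx-1 ∷ axisX μ ls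
    axisX μ (vertical i ∷ ls)  = i %1+ πx-1 ∷ axisX μ ls
    axisX μ (_ ∷ ls)           = axisX μ ls

    axisY : List Line → List ℕ
    axisY []                  = []
    axisY (oblique s t ∷ ls)  = t %1+ πy-1 ∷ axisY ls
    axisY (horizontal j ∷ ls) = j %1+ πy-1 ∷ axisY ls
    axisY (_ ∷ ls)            = axisY ls

    infinity : List Line → List ℕ
    infinity []                 = []
    infinity (oblique s t ∷ ls) = s %1+ πd-1 ∷ infinity ls
    infinity (diagonal d ∷ ls)  = d %1+ πd-1 ∷ infinity ls
    infinity (_ ∷ ls)           = infinity ls

    -- These lines pass through the vertices (0 : 1 : 0), (1 : 0 : 0) and (0 : 0 : 1), which lie on
    -- no oblique line.
    hasVertical hasHorizontal hasDiagonal : List Line → Bool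
    hasVertical []               = false
    hasVertical (vertical _ ∷ _) = true
    hasVertical (_ ∷ ls)         = hasVertical ls
    hasHorizontal []                 = false
    hasHorizontal (horizontal _ ∷ _) = true
    hasHorizontal (_ ∷ ls)           = hasHorizontal ls
    hasDiagonal []               = false
    hasDiagonal (diagonal _ ∷ _) = true
    hasDiagonal (_ ∷ ls)         = hasDiagonal ls

  bits : ℕ → ℕ → ℕ
  bits zero       k         = 0
  bits (suc fuel) zero      = 0
  bits (suc fuel) k@(suc _) = suc (bits fuel (k /1+ 1))

  thresholds : ℕ → List ℕ
  thresholds zero    = []
  thresholds (suc f) = 2 ^ f ∷ thresholds f

  -- Two digits in base n per point, the lower one being the exponent of y.
  decode : ℕ → ℕ → ℕ → List Point
  decode n-1 zero    N = []
  decode n-1 (suc k) N = ((N /1+ n-1) %1+ n-1 , N %1+ n-1) ∷ decode n-1 k ((N /1+ n-1) /1+ n-1)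

  -- A field with n-1 + 2 elements generated by a root of X^(m+1) = r, and orbit representatives encoded in base n.
  record Certificate : Set where
    constructor certificate
    field
      n-1 p-1 : ℕ
      {m}     : ℕ
      r       : Residue m
      lattice : Lattice
      count N : ℕ

  module Check (c : Certificate) where
    open Certificate c
    open Lattice lattice

    n : ℕ
    n = suc n-1

    ms : List ℕ
    ms = thresholds (bits 20 (suc n))

    full : List Point
    full = (0 , 0) ∷ shifts

    open Residues p-1 r using (timesX; constant; same; power)
    module Tb = Tables p-1 r
    module Sc (ms : List ℕ) (z : Tree ℕ) = Scan n-1 ms z shifts
    open Shifts n-1 shifts using (_⊖_; orbits; number; member; closed)
    module Ex = Exponents n-1 lattice _⊖_

    matches : (Point → Bool) → List Point → Bool
    matches f []       = false
    matches f (P ∷ Ps) = f P ∨ matches f Ps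

    -- The shifts are closed under addition and contain both generators, and σ is - τ. For each axis
    -- some shift acts on its exponents as the asserted period; on the line at infinity (a , b) acts
    -- as b - a.
    latticeOK : Bool
    latticeOK = closed full full ∧ member (suc w₁-1 %1+ n-1 , τ %1+ n-1) full ∧ member (0 , suc w₂-1 %1+ n-1) full
              ∧ ((σ + τ) %1+ n-1 ≡ᵇ 0)
              ∧ matches (λ (a , b) → a ≡ᵇ suc πx-1 %1+ n-1) full ∧ matches (λ (a , b) → b ≡ᵇ suc πy-1 %1+ n-1) full
              ∧ matches (λ (a , b) → b ≡ᵇ (a + suc πd-1) %1+ n-1) full

    circle : (Z-1 : ℕ) → List (ℕ × ℕ) → ℕ → List ℕ → Bool
    circle Z-1 lv π es = Radix.digits Z-1 π (Radix.powers Z-1 lv es)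

    cover′ : ℕ → ℕ → ℕ → List ℕ → List ℕ → List ℕ → List ℕ → List ℕ → ℕ → Bool
    cover′ κ β f keys curve xs ys ds Z-1 = Radix.Cover.cover Z-1 κ β Ex.W-1 (suc w₁-1) (suc w₂-1) σ f keys curve xs ys ds

    -- Blocks have 2^4 rows. `κ` makes 2^κ blocks contain all w₁ rows, and `f` makes the powers of
    -- two below 2^f address every digit of a block.
    β κ f : ℕ
    β = 4
    κ = bits 20 (w₁-1 /1+ 15)
    f = bits 30 (2 ^ β * suc Ex.W-1)

    coverOK : List ℕ → Tree ℕ → List Line → List ℕ → Bool
    coverOK ms z ls keys = cover′ κ β f keys (Ex.curve ms z n) (Ex.columns ls) (Ex.rowsOf full ls) (Ex.diagonalsOf full ls)
                             -- The radix is the least power of two above the bound demanded by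
                             -- `cover`.
                             (pred (2 ^ bits 30 (16 * length keys + 8)))

    -- On an axis sets are only united, never added, so digits stay at most 1 and radix 2 (the
    -- argument 1 of `circle`) suffices.
    axesOK : ℕ → List Line → List (ℕ × ℕ) → Bool
    axesOK μ ls lv = circle 1 lv (suc πx-1) (Ex.axisX μ ls) ∧ circle 1 lv (suc πy-1) (Ex.axisY ls) ∧ circle 1 lv (suc πd-1) (Ex.infinity ls)
                   ∧ Ex.hasVertical ls ∧ Ex.hasHorizontal ls ∧ Ex.hasDiagonal ls

    linesOK : List ℕ → ℕ → Tree ℕ → Maybe (List Line) → Bool
    linesOK ms μ z nothing   = false
    linesOK ms μ z (just ls) = axesOK μ ls (Radix.levels 1 (bits 20 n) 1 2 []) ∧ coverOK ms z ls (Ex.keys ls)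

    reps : List Point
    reps = decode n-1 count N

    tablesOK : List ℕ → Maybe ℕ → Maybe (Tree ℕ) → Bool
    tablesOK ms (just μ) (just z) = linesOK ms μ z (Sc.scan ms z reps)
    tablesOK ms _        _        = false

    logsOK : List ℕ → Tree (Residue m × ℕ) → Bool
    logsOK ms t = tablesOK ms (Tb.log ms t (constant p-1)) (Tb.zechs ms t n-1 1 (timesX (constant 1)) empty)

    -- X^n = 1 among the residues provides a root of X^(m+1) = r in every field of this order; that
    -- the root is primitive comes out of the Zech table.
    fieldOK : Bool
    fieldOK = (suc p-1 ^ suc m ≡ᵇ suc n) ∧ same (power n (constant 1)) (constant 1)

    pointsOK : Bool
    pointsOK = distinct (thresholds (bits 30 (n * n))) (map number (orbits reps)) empty

    check′ : List ℕ → Bool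
    check′ ms = fieldOK ∧ latticeOK ∧ pointsOK ∧ logsOK ms (Tb.logs ms n 0 (constant 1) empty)

    check : Bool
    check = check′ ms

    size : ℕ
    size = count * length full

  -- When n is twice `suc h-1`, α to the power `suc h-1` is -1: the shifts of `klein` are the
  -- changes of sign of the two coordinates.
  trivial klein : ℕ → Lattice
  trivial n-1 = record
    { w₁-1 = n-1 ; w₂-1 = n-1 ; σ = 0 ; τ = 0 ; πx-1 = n-1 ; πy-1 = n-1 ; πd-1 = n-1 ; shifts = [] }
  klein h-1 = record
    { w₁-1 = h-1 ; w₂-1 = h-1 ; σ = 0 ; τ = 0 ; πx-1 = h-1 ; πy-1 = h-1 ; πd-1 = h-1
    ; shifts = (suc h-1 , 0) ∷ (0 , suc h-1) ∷ (suc h-1 , suc h-1) ∷ [] }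

  multiples : ℕ → ℕ → ℕ → List Point
  multiples n-1 w zero    = []
  multiples n-1 w (suc k) = ((suc k * w) %1+ n-1 , (suc k * (suc n-1 ∸ w)) %1+ n-1) ∷ multiples n-1 w k

  -- The translations by multiples of (w , - w), where w * suc k = n.
  hyperbolic : ℕ → ℕ → ℕ → Lattice
  hyperbolic n-1 w-1 k = record
    { w₁-1 = w-1 ; w₂-1 = n-1 ; σ = suc w-1 ; τ = n-1 ∸ w-1 ; πx-1 = w-1 ; πy-1 = w-1
    -- The translation (w , - w) moves slopes by - 2 w. Modulo n = w * suc k this generates the
    -- multiples of w if `suc k` is odd, and those of 2 w otherwise.
    ; πd-1 = if k %1+ 1 ≡ᵇ 0 then w-1 else w-1 + suc w-1
    ; shifts = multiples n-1 (suc w-1) k }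

-- Points, lines and directions on the torus; the scanned set is an arc.

module Geometry where

  open Numerals
  open Fields
  open Logarithms
  open Certificates
  open import Data.Bool.Base using (true; false; _∧_; _∨_)
  open import Data.Empty using (⊥; ⊥-elim)
  open import Data.Fin.Base using (Fin; zero; suc; toℕ)
  import Data.Fin.Properties as Fin
  open import Data.List.Base using (List; []; _∷_; _++_; map; lookup)
  open import Data.List.Membership.Propositional using (_∈_)
  open import Data.List.Membership.Propositional.Properties using (∈-map⁺; ∈-map⁻; ∈-++⁺ˡ; ∈-++⁺ʳ; ∈-++⁻)
  open import Data.List.Relation.Unary.All using (All; []; _∷_)
  import Data.List.Relation.Unary.All as All
  open import Data.List.Relation.Unary.AllPairs using (AllPairs; []; _∷_)
  open import Data.List.Relation.Unary.Any using (here; there)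
  open import Data.Maybe.Base using (just; nothing)
  open import Data.Nat.Base using (ℕ; zero; suc; _≤_; _<_; z≤n; s≤s; _≡ᵇ_; _∸_)
  import Data.Nat.Base as ℕ
  import Data.Nat.Properties as ℕ
  open import Data.Product.Base using (∃-syntax; _×_; _,_; proj₁; proj₂)
  open import Data.Sum.Base using (_⊎_; inj₁; inj₂)
  open import Function.Base using (_∘_)
  open import Relation.Binary.Definitions using (tri<; tri≈; tri>)
  open import Relation.Binary.PropositionalEquality
  open import Relation.Nullary using (¬_; yes; no)

  ∨-true : ∀ {a b} → a ∨ b ≡ true → a ≡ true ⊎ b ≡ true
  ∨-true {true}  _  = inj₁ refl
  ∨-true {false} eq = inj₂ eq

  module Generated {n-1 : ℕ} (F : FiniteField (suc (suc n-1))) {α : Fin (suc (suc n-1))}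
                   (α^n≡1 : Field._^_ F α (suc n-1) ≡ FiniteField.1F F)
                   (order : ∀ d → 0 < d → d < suc n-1 → Field._^_ F α d ≢ FiniteField.1F F) where

    open Field F public
    open Plane F public

    n : ℕ
    n = suc n-1

    α≢0 : α ≢ 0F
    α≢0 refl = 0≢1 (trans (sym (zeroˡ _)) α^n≡1)

    α^≢0 : ∀ k → α ^ k ≢ 0F
    α^≢0 = ^-nonzero α≢0

    ^-n : ∀ a → (α ^ a) ^ n ≡ 1F
    ^-n a = trans (sym (^-* α n a)) (trans (cong (α ^_) (ℕ.*-comm n a)) (trans (^-* α a n) (trans (cong (_^ a) α^n≡1) (1^ a))))

    ^-% : ∀ k → α ^ (k %1+ n-1) ≡ α ^ k
    ^-% k = begin
      α ^ (k %1+ n-1)                              ≡⟨ *-identityʳ _ ⟨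
      α ^ (k %1+ n-1) * 1F                         ≡⟨ cong (α ^ (k %1+ n-1) *_) (^-n (k /1+ n-1)) ⟨
      α ^ (k %1+ n-1) * (α ^ (k /1+ n-1)) ^ n      ≡⟨ cong (α ^ (k %1+ n-1) *_) (trans (cong (α ^_) (ℕ.*-comm (k /1+ n-1) n)) (^-* α n (k /1+ n-1))) ⟨
      α ^ (k %1+ n-1) * α ^ (k /1+ n-1 ℕ.* n)      ≡⟨ ^-+ α (k %1+ n-1) _ ⟨
      α ^ (k %1+ n-1 ℕ.+ k /1+ n-1 ℕ.* n)          ≡⟨ cong (α ^_) (%/-spec k n-1) ⟨
      α ^ k                                        ∎
      where open ≡-Reasoning

    α-injective< : ∀ {s t} → s < t → t < n → α ^ s ≢ α ^ t
    α-injective< {s} {t} s<t t<n eq = order (t ∸ s) (ℕ.m<n⇒0<n∸m s<t) (ℕ.≤-<-trans (ℕ.m∸n≤m t s) t<n)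
      (*-cancelˡ _ _ (α^≢0 s) (trans (sym (^-+ α s (t ∸ s))) (trans (cong (α ^_) (ℕ.m+[n∸m]≡n (ℕ.<⇒≤ s<t))) (trans (sym eq) (sym (*-identityʳ _))))))

    α-injective : ∀ {s t} → s < n → t < n → α ^ s ≡ α ^ t → s ≡ t
    α-injective {s} {t} s<n t<n eq with ℕ.<-cmp s t
    ... | tri< s<t _ _ = ⊥-elim (α-injective< s<t t<n eq)
    ... | tri≈ _ s≡t _ = s≡t
    ... | tri> _ _ t<s = ⊥-elim (α-injective< t<s s<n (sym eq))

    -- Pigeonhole: 0, x and the n distinct powers of α would be n + 2 elements of a field with n +
    -- 1.
    generator : ∀ {x} → x ≢ 0F → ∃[ k ] x ≡ α ^ k
    generator {x} x≢0 with Fin.any? (λ (i : Fin n) → x ≟ α ^ toℕ i)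
    ... | yes (i , x≡α^i) = toℕ i , x≡α^i
    ... | no  ¬power      = ⊥-elim (ℕ.1+n≰n (Fin.injective⇒≤ {f = f} f-injective))
      where
      f : Fin (suc (suc n)) → K
      f zero          = 0F
      f (suc zero)    = x
      f (suc (suc i)) = α ^ toℕ i
      f-injective : ∀ {i j} → f i ≡ f j → i ≡ j
      f-injective {zero}        {zero}        eq = refl
      f-injective {zero}        {suc zero}    eq = ⊥-elim (x≢0 (sym eq))
      f-injective {zero}        {suc (suc j)} eq = ⊥-elim (α^≢0 (toℕ j) (sym eq))
      f-injective {suc zero}    {zero}        eq = ⊥-elim (x≢0 eq)
      f-injective {suc zero}    {suc zero}    eq = refl
      f-injective {suc zero}    {suc (suc j)} eq = ⊥-elim (¬power (j , eq))
      f-injective {suc (suc i)} {zero}        eq = ⊥-elim (α^≢0 (toℕ i) eq)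
      f-injective {suc (suc i)} {suc zero}    eq = ⊥-elim (¬power (i , sym eq))
      f-injective {suc (suc i)} {suc (suc j)} eq =
        cong (λ i → suc (suc i)) (Fin.toℕ-injective (α-injective (Fin.toℕ<n i) (Fin.toℕ<n j) eq))

    pt : Point → Vec3
    pt (i , j) = ⟨ α ^ i , α ^ j , 1F ⟩

    act : K → K → Vec3 → Vec3
    act a b ⟨ x , y , z ⟩ = ⟨ a * x , b * y , z ⟩

    coefficients : Line → Vec3
    coefficients (vertical i)   = ⟨ 1F , 0F , - (α ^ i) ⟩
    coefficients (horizontal j) = ⟨ 0F , 1F , - (α ^ j) ⟩
    coefficients (diagonal d)   = ⟨ α ^ d , - 1F , 0F ⟩
    coefficients (oblique s t)  = ⟨ α ^ s , - 1F , α ^ t ⟩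

    coefficients≢0 : ∀ ℓ → NonZero3 (coefficients ℓ)
    coefficients≢0 (vertical i)   (1≡0 , _)     = 0≢1 (sym 1≡0)
    coefficients≢0 (horizontal j) (_ , 1≡0 , _) = 0≢1 (sym 1≡0)
    coefficients≢0 (diagonal d)   (eq , _)      = α^≢0 d eq
    coefficients≢0 (oblique s t)  (eq , _)      = α^≢0 s eq

    -1* : ∀ y → - 1F * y + y ≡ 0F
    -1* y = trans (cong (- 1F * y +_) (sym (*-identityˡ y))) (trans (sym (distribʳ y (- 1F) 1F)) (trans (cong (_* y) (-‿inverseˡ 1F)) (zeroˡ y)))

    on-vertical : ∀ i y → Incident (coefficients (vertical i)) ⟨ α ^ i , y , 1F ⟩
    on-vertical i y = trans (solve 3 (λ x m y → con 1 :* x :+ (con 0 :* y :+ m :* con 1) := m :+ x) refl (α ^ i) (- (α ^ i)) y) (-‿inverseˡ (α ^ i))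

    on-horizontal : ∀ j x → Incident (coefficients (horizontal j)) ⟨ x , α ^ j , 1F ⟩
    on-horizontal j x = trans (solve 3 (λ x y m → con 0 :* x :+ (con 1 :* y :+ m :* con 1) := m :+ y) refl x (α ^ j) (- (α ^ j))) (-‿inverseˡ (α ^ j))

    on-diagonal : ∀ d {x y} z → y ≡ α ^ d * x → Incident (coefficients (diagonal d)) ⟨ x , y , z ⟩
    on-diagonal d {x} z refl = trans (solve 4 (λ σ x m z → σ :* x :+ (m :* (σ :* x) :+ con 0 :* z) := m :* (σ :* x) :+ σ :* x) refl (α ^ d) x (- 1F) z) (-1* (α ^ d * x))

    on-oblique : ∀ s t {x y z} → y ≡ α ^ s * x + α ^ t * z → Incident (coefficients (oblique s t)) ⟨ x , y , z ⟩
    on-oblique s t {x} {y} {z} refl = trans (solve 5 (λ σ x m τ z → σ :* x :+ (m :* (σ :* x :+ τ :* z) :+ τ :* z) := m :* (σ :* x :+ τ :* z) :+ (σ :* x :+ τ :* z)) refl (α ^ s) x (- 1F) (α ^ t) z) (-1* _)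

    module _ {a b : K} (a≢0 : a ≢ 0F) (b≢0 : b ≢ 0F) where

      private
        undo : ∀ {c} (c≢0 : c ≢ 0F) l x → l * inv c≢0 * (c * x) ≡ l * x
        undo {c} c≢0 l x = trans (solve 4 (λ l i c x → l :* i :* (c :* x) := l :* (i :* c) :* x) refl l (inv c≢0) c x)
          (cong (_* x) (trans (cong (l *_) (inv-* c≢0)) (*-identityʳ l)))

        zero-inv : ∀ {c l} (c≢0 : c ≢ 0F) → l * inv c≢0 ≡ 0F → l ≡ 0F
        zero-inv {c} {l} c≢0 eq = trans (sym (trans (cong (l *_) (inv-* c≢0)) (*-identityʳ l)))
          (trans (sym (*-assoc l _ c)) (trans (cong (_* c) eq) (zeroˡ c)))

        -- A diagonal map acts on line coordinates by its inverse.
        dual : Vec3 → Vec3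
        dual ⟨ l , m , k ⟩ = ⟨ l * inv a≢0 , m * inv b≢0 , k ⟩

        dual-Incident : ∀ L P → Incident L P → Incident (dual L) (act a b P)
        dual-Incident ⟨ l , m , k ⟩ ⟨ x , y , z ⟩ = subst₂ (λ u v → u + (v + k * z) ≡ 0F) (sym (undo a≢0 l x)) (sym (undo b≢0 m y))

      act-Collinear : ∀ {P Q R} → Collinear P Q R → Collinear (act a b P) (act a b Q) (act a b R)
      act-Collinear {P} {Q} {R} (L@(⟨ l , m , k ⟩) , L≢0 , p , q , r) =
        dual L , (λ (l≡0 , m≡0 , k≡0) → L≢0 (zero-inv a≢0 l≡0 , zero-inv b≢0 m≡0 , k≡0)) ,
        dual-Incident L P p , dual-Incident L Q q , dual-Incident L R r

      act-injective : ∀ {P Q} → act a b P ≡ act a b Q → P ≡ Q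
      act-injective {⟨ x , y , z ⟩} {⟨ x′ , y′ , z′ ⟩} eq =
        ⟨⟩-cong (*-cancelˡ x x′ a≢0 (cong Vec3.x eq)) (*-cancelˡ y y′ b≢0 (cong Vec3.y eq)) (cong Vec3.z eq)
        where
        ⟨⟩-cong : x ≡ x′ → y ≡ y′ → z ≡ z′ → ⟨ x , y , z ⟩ ≡ ⟨ x′ , y′ , z′ ⟩
        ⟨⟩-cong refl refl refl = refl

    -- A nonzero difference vector together with its direction; `s < n` makes the slope canonical,
    -- so that equal directions are equal data.
    data Offset (a b : K) : Direction → Set where
      up    : a ≡ 0F → b ≢ 0F → Offset a b up
      flat  : a ≢ 0F → b ≡ 0F → Offset a b flat
      slope : ∀ {s} → a ≢ 0F → b ≡ α ^ s * a → s < n → Offset a b (slope s)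

    Sees : Vec3 → Vec3 → Direction → Set
    Sees ⟨ x , y , _ ⟩ ⟨ x′ , y′ , _ ⟩ d = ∃[ a ] ∃[ b ] (x′ ≡ x + a × y′ ≡ y + b × Offset a b d)

    -- The kernel of a nonzero form (l , m) is a line through the origin, hence a single direction.
    Offset-unique : ∀ {l m a b a′ b′ d e} → ¬ (l ≡ 0F × m ≡ 0F) → l * a + m * b ≡ 0F → l * a′ + m * b′ ≡ 0F →
                    Offset a b d → Offset a′ b′ e → d ≡ e
    Offset-unique {l} {m} {a} {b} {a′} {b′} lm≢0 eq eq′ o o′ = case o o′
      where
      cancel : ∀ {u v} → v ≢ 0F → u * v ≡ 0F → u ≡ 0F
      cancel {u} {v} v≢0 uv≡0 with u ≟ 0F
      ... | yes u≡0 = u≡0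
      ... | no  u≢0 = ⊥-elim (*-nonzero u≢0 v≢0 uv≡0)
      up-m : ∀ {a b} → l * a + m * b ≡ 0F → a ≡ 0F → b ≢ 0F → m ≡ 0F
      up-m eq refl b≢0 = cancel b≢0 (trans (sym (trans (cong (_+ _) (zeroʳ l)) (+-identityˡ _))) eq)
      flat-l : ∀ {a b} → l * a + m * b ≡ 0F → a ≢ 0F → b ≡ 0F → l ≡ 0F
      flat-l eq a≢0 refl = cancel a≢0 (trans (sym (trans (cong (_ +_) (zeroʳ m)) (+-identityʳ _))) eq)
      slope-lm : ∀ {a b} s → l * a + m * b ≡ 0F → a ≢ 0F → b ≡ α ^ s * a → l + m * α ^ s ≡ 0F
      slope-lm {a} s eq a≢0 refl = cancel a≢0 (trans (solve 4 (λ l m σ a → (l :+ m :* σ) :* a := l :* a :+ m :* (σ :* a)) refl l m (α ^ s) a) eq)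
      drop-m : ∀ s → l + m * α ^ s ≡ 0F → m ≡ 0F → l ≡ 0F
      drop-m s eq refl = trans (sym (trans (cong (l +_) (zeroˡ _)) (+-identityʳ l))) eq
      drop-l : ∀ s → l + m * α ^ s ≡ 0F → l ≡ 0F → m ≡ 0F
      drop-l s eq refl = cancel (α^≢0 s) (trans (sym (+-identityˡ _)) eq)
      case : ∀ {d e} → Offset a b d → Offset a′ b′ e → d ≡ e
      case (up p q)   (up p′ q′)   = refl
      case (up p q)   (flat p′ q′) = ⊥-elim (lm≢0 (flat-l eq′ p′ q′ , up-m eq p q))
      case (up p q)   (slope {s} p′ q′ _) = ⊥-elim (lm≢0 (drop-m s (slope-lm s eq′ p′ q′) (up-m eq p q) , up-m eq p q))
      case (flat p q) (up p′ q′)   = ⊥-elim (lm≢0 (flat-l eq p q , up-m eq′ p′ q′))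
      case (flat p q) (flat p′ q′) = refl
      case (flat p q) (slope {s} p′ q′ _) = ⊥-elim (lm≢0 (flat-l eq p q , drop-l s (slope-lm s eq′ p′ q′) (flat-l eq p q)))
      case (slope {s} p q _) (up p′ q′)   = ⊥-elim (lm≢0 (drop-m s (slope-lm s eq p q) (up-m eq′ p′ q′) , up-m eq′ p′ q′))
      case (slope {s} p q _) (flat p′ q′) = ⊥-elim (lm≢0 (flat-l eq′ p′ q′ , drop-l s (slope-lm s eq p q) (flat-l eq′ p′ q′)))
      case (slope {s} p q s<n) (slope {t} p′ q′ t<n) with m ≟ 0F
      ... | yes m≡0 = ⊥-elim (lm≢0 (drop-m s (slope-lm s eq p q) m≡0 , m≡0))
      ... | no  m≢0 = cong slope (α-injective s<n t<n (*-cancelˡ _ _ m≢0 (+-cancelˡ l (trans (slope-lm s eq p q) (sym (slope-lm t eq′ p′ q′))))))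

    offset-line : ∀ {l m k x y x′ y′ a b} → Incident ⟨ l , m , k ⟩ ⟨ x , y , 1F ⟩ → Incident ⟨ l , m , k ⟩ ⟨ x′ , y′ , 1F ⟩ →
                  x′ ≡ x + a → y′ ≡ y + b → l * a + m * b ≡ 0F
    offset-line {l} {m} {k} {x} {y} {a = a} {b} p q refl refl = begin
      l * a + m * b                                        ≡⟨ +-identityˡ _ ⟨
      0F + (l * a + m * b)                                 ≡⟨ cong (_+ (l * a + m * b)) p ⟨
      l * x + (m * y + k * 1F) + (l * a + m * b)           ≡⟨ solve 7 (λ l m k x y a b → l :* x :+ (m :* y :+ k :* con 1) :+ (l :* a :+ m :* b)
                                                               := l :* (x :+ a) :+ (m :* (y :+ b) :+ k :* con 1)) refl l m k x y a b ⟩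
      l * (x + a) + (m * (y + b) + k * 1F)                 ≡⟨ q ⟩
      0F                                                   ∎
      where open ≡-Reasoning

    -- A line through an affine point is not the line at infinity, so its part (l , m) is nonzero
    -- and both offsets lie in the kernel of this form.
    collinear-Sees : ∀ {x y Q R d e} → Vec3.z Q ≡ 1F → Vec3.z R ≡ 1F → Collinear ⟨ x , y , 1F ⟩ Q R →
                     Sees ⟨ x , y , 1F ⟩ Q d → Sees ⟨ x , y , 1F ⟩ R e → d ≡ e
    collinear-Sees {x} {y} refl refl (⟨ l , m , k ⟩ , L≢0 , p , q , r) (a , b , x≡ , y≡ , o) (a′ , b′ , x≡′ , y≡′ , o′) =
      Offset-unique lm≢0 (offset-line p q x≡ y≡) (offset-line p r x≡′ y≡′) o o′
      where
      lm≢0 : ¬ (l ≡ 0F × m ≡ 0F)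
      lm≢0 (refl , refl) = L≢0 (refl , refl ,
        trans (sym (trans (cong₂ _+_ (zeroˡ x) (cong₂ _+_ (zeroˡ y) (*-identityʳ k))) (trans (+-identityˡ _) (+-identityˡ k)))) p)

    vec-cong : ∀ {x x′ y y′ z z′} → x ≡ x′ → y ≡ y′ → z ≡ z′ → ⟨ x , y , z ⟩ ≡ ⟨ x′ , y′ , z′ ⟩
    vec-cong refl refl refl = refl

    difference : ∀ x x′ → x′ ≡ x + (x′ + - x)
    difference x x′ = sym (trans (solve 3 (λ x x′ y → x :+ (x′ :+ y) := y :+ x :+ x′) refl x x′ (- x))
      (trans (cong (_+ x′) (-‿inverseˡ x)) (+-identityˡ x′)))

    difference≢0 : ∀ {x x′} → x′ ≢ x → x′ + - x ≢ 0F
    difference≢0 {x} {x′} x′≢x eq = x′≢x (trans (difference x x′) (trans (cong (x +_) eq) (+-identityʳ x)))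

    module Scanned (ms : List ℕ) (z : Tree ℕ) (ss : List Point) (Zs : Entries ms (λ d e → α ^ d ≡ 1F + α ^ e) z) where

      open Scan n-1 ms z ss hiding (n) public

      full : List Point
      full = (0 , 0) ∷ ss

      ⊖-spec : ∀ a b → α ^ (a ⊖ b) * α ^ b ≡ α ^ a
      ⊖-spec a b = begin
        α ^ (a ⊖ b) * α ^ b                                  ≡⟨ cong₂ _*_ (^-% (a ℕ.+ (n ∸ r))) (sym (^-% b)) ⟩
        α ^ (a ℕ.+ (n ∸ r)) * α ^ r                          ≡⟨ ^-+ α (a ℕ.+ (n ∸ r)) r ⟨
        α ^ (a ℕ.+ (n ∸ r) ℕ.+ r)                            ≡⟨ cong (α ^_) (trans (ℕ.+-assoc a (n ∸ r) r) (cong (a ℕ.+_) (ℕ.m∸n+n≡m (ℕ.<⇒≤ (%-bound b n-1))))) ⟩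
        α ^ (a ℕ.+ n)                                        ≡⟨ ^-+ α a n ⟩
        α ^ a * α ^ n                                        ≡⟨ trans (cong (α ^ a *_) α^n≡1) (*-identityʳ _) ⟩
        α ^ a                                                ∎
        where
        open ≡-Reasoning
        r : ℕ
        r = b %1+ n-1

      ⊖-zero : ∀ a b → a ⊖ b ≡ 0 → α ^ a ≡ α ^ b
      ⊖-zero a b eq = trans (sym (⊖-spec a b)) (trans (cong (λ k → α ^ k * α ^ b) eq) (*-identityˡ _))

      ⊖-nonzero : ∀ a b {k} → a ⊖ b ≡ suc k → α ^ a ≢ α ^ b
      ⊖-nonzero a b {k} eq α^a≡α^b = order (suc k) (s≤s z≤n) (subst (_< n) eq (%-bound (a ℕ.+ (n ∸ b %1+ n-1)) n-1))
        (*-cancelˡ _ _ (α^≢0 b) (trans (*-comm _ _) (trans (cong (λ k → α ^ k * α ^ b) (sym eq)) (trans (⊖-spec a b) (trans α^a≡α^b (sym (*-identityʳ _)))))))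

      ⊖-zech : ∀ a b {k} → α ^ (a ⊖ b) ≡ 1F + α ^ k → α ^ a ≡ α ^ b + α ^ (b ℕ.+ k)
      ⊖-zech a b {k} eq = begin
        α ^ a                     ≡⟨ ⊖-spec a b ⟨
        α ^ (a ⊖ b) * α ^ b       ≡⟨ cong (_* α ^ b) eq ⟩
        (1F + α ^ k) * α ^ b      ≡⟨ solve 2 (λ u v → (con 1 :+ u) :* v := v :+ v :* u) refl (α ^ k) (α ^ b) ⟩
        α ^ b + α ^ b * α ^ k     ≡⟨ cong (α ^ b +_) (^-+ α b k) ⟨
        α ^ b + α ^ (b ℕ.+ k)     ∎
        where open ≡-Reasoning

      direction-sound : ∀ i j X {d} → direction i j X ≡ just d → Sees (pt (i , j)) (pt X) d
      direction-sound i j (i′ , j′) eq with i′ ⊖ i in eqi | j′ ⊖ j in eqj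
      direction-sound i j (i′ , j′) refl | zero  | suc _ =
        0F , α ^ j′ + - (α ^ j) , trans (⊖-zero i′ i eqi) (sym (+-identityʳ _)) , difference _ _ , up refl (difference≢0 (⊖-nonzero j′ j eqj))
      direction-sound i j (i′ , j′) refl | suc _ | zero  =
        α ^ i′ + - (α ^ i) , 0F , difference _ _ , trans (⊖-zero j′ j eqj) (sym (+-identityʳ _)) , flat (difference≢0 (⊖-nonzero i′ i eqi)) refl
      direction-sound i j (i′ , j′) eq | suc b | suc a with find ms (suc b) z in eqb | find ms (suc a) z in eqa
      direction-sound i j (i′ , j′) refl | suc b | suc a | just b′ | just a′ =
        α ^ (i ℕ.+ b′) , α ^ (j ℕ.+ a′) ,
        ⊖-zech i′ i (trans (cong (α ^_) eqi) (find-sound ms (suc b) Zs eqb)) ,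
        ⊖-zech j′ j (trans (cong (α ^_) eqj) (find-sound ms (suc a) Zs eqa)) ,
        slope (α^≢0 (i ℕ.+ b′)) (sym (⊖-spec (j ℕ.+ a′) (i ℕ.+ b′))) (%-bound (j ℕ.+ a′ ℕ.+ (n ∸ (i ℕ.+ b′) %1+ n-1)) n-1)

      pts : List Point → List Vec3
      pts Ps = map pt (orbits Ps)

      pts⁻ : ∀ Ps {Q} → Q ∈ pts Ps → ∃[ X ] (X ∈ orbits Ps × Q ≡ pt X)
      pts⁻ Ps = ∈-map⁻ pt {xs = orbits Ps}

      member-sound : ∀ P Ps → member P Ps ≡ true → P ∈ Ps
      member-sound (a , b) ((c , d) ∷ Ps) eq with ∨-true {(a ≡ᵇ c) ∧ (b ≡ᵇ d)} eq
      ... | inj₁ eq₁ = here (cong₂ _,_ (ℕ.≡ᵇ⇒≡ a c (if-true (proj₁ (∧-true eq₁)))) (ℕ.≡ᵇ⇒≡ b d (if-true (proj₂ (∧-true {a ≡ᵇ c} eq₁)))))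
      ... | inj₂ eq₂ = there (member-sound (a , b) Ps eq₂)

      closedAt-sound : ∀ {fs s} ts → closedAt fs s ts ≡ true → ∀ {t} → t ∈ ts → move s t ∈ fs
      closedAt-sound {fs} {s} (t ∷ ts) ok (here refl) = member-sound (move s t) fs (proj₁ (∧-true ok))
      closedAt-sound {fs} {s} (t ∷ ts) ok (there t∈)  = closedAt-sound ts (proj₂ (∧-true {member (move s t) fs} ok)) t∈

      closed-sound : ∀ {fs} ts → closed fs ts ≡ true → ∀ {s t} → s ∈ ts → t ∈ fs → move s t ∈ fs
      closed-sound {fs} (s ∷ ts) ok (here refl) = closedAt-sound fs (proj₁ (∧-true ok))
      closed-sound {fs} (s ∷ ts) ok (there s∈)  = closed-sound ts (proj₂ (∧-true {closedAt fs s fs} ok)) s∈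

      pt-move : ∀ P s → pt (move P s) ≡ act (α ^ proj₁ s) (α ^ proj₂ s) (pt P)
      pt-move (i , j) (a , b) = vec-cong (eq i a) (eq j b) refl
        where
        eq : ∀ i a → α ^ ((i ℕ.+ a) %1+ n-1) ≡ α ^ a * α ^ i
        eq i a = trans (^-% (i ℕ.+ a)) (trans (^-+ α i a) (*-comm _ _))

      pt-move₀ : ∀ P → pt (move P (0 , 0)) ≡ pt P
      pt-move₀ P = trans (pt-move P (0 , 0)) (vec-cong (*-identityˡ _) (*-identityˡ _) refl)

      pt-rep : ∀ {P} Ps → P ∈ Ps → pt P ∈ pts Ps
      pt-rep {P} (_ ∷ Ps) (here refl) = here (sym (pt-move₀ P))
      pt-rep (P ∷ Ps) (there P∈) with pts⁻ Ps (pt-rep Ps P∈)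
      ... | X , X∈ , eq = subst (_∈ pts (P ∷ Ps)) (sym eq) (∈-map⁺ pt (∈-++⁺ʳ (map (move P) full) X∈))

      pts-z : ∀ Ps {Q} → Q ∈ pts Ps → Vec3.z Q ≡ 1F
      pts-z Ps Q∈ with pts⁻ Ps Q∈
      ... | _ , _ , refl = refl

      module _ (full-closed : ∀ {s t} → s ∈ full → t ∈ full → move s t ∈ full) where

        orbits-closed : ∀ Ps {X s} → s ∈ full → X ∈ orbits Ps → ∃[ Y ] (Y ∈ orbits Ps × pt Y ≡ act (α ^ proj₁ s) (α ^ proj₂ s) (pt X))
        orbits-closed (P ∷ Ps) {X} {s} s∈ X∈ with ∈-++⁻ (map (move P) full) X∈
        ... | inj₂ X∈′ with orbits-closed Ps s∈ X∈′
        ...   | Y , Y∈ , eq = Y , ∈-++⁺ʳ (map (move P) full) Y∈ , eq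
        orbits-closed (P ∷ Ps) {X} {s} s∈ X∈ | inj₁ X∈′ with ∈-map⁻ (move P) {xs = full} X∈′
        ... | t , t∈ , refl = move P (move t s) , ∈-++⁺ˡ {xs = map (move P) full} (∈-map⁺ (move P) {xs = full} (full-closed t∈ s∈)) ,
                trans (pt-move P (move t s)) (trans (vec-cong (eq (proj₁ t) (proj₁ s) (proj₁ P)) (eq (proj₂ t) (proj₂ s) (proj₂ P)) refl)
                  (cong (act (α ^ proj₁ s) (α ^ proj₂ s)) (sym (pt-move P t))))
          where
          eq : ∀ t s i → α ^ ((t ℕ.+ s) %1+ n-1) * α ^ i ≡ α ^ s * (α ^ t * α ^ i)
          eq t s i = trans (cong (_* α ^ i) (trans (^-% (t ℕ.+ s)) (trans (^-+ α t s) (*-comm _ _)))) (*-assoc _ _ _)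

        pts-closed : ∀ Ps {Q s} → s ∈ full → Q ∈ pts Ps → act (α ^ proj₁ s) (α ^ proj₂ s) Q ∈ pts Ps
        pts-closed Ps s∈ Q∈ with pts⁻ Ps Q∈
        ... | X , X∈ , refl with orbits-closed Ps s∈ X∈
        ...   | Y , Y∈ , eq = subst (_∈ pts Ps) eq (∈-map⁺ pt Y∈)

        pts-closed^ : ∀ Ps {Q s} → s ∈ full → Q ∈ pts Ps → ∀ k → act ((α ^ proj₁ s) ^ k) ((α ^ proj₂ s) ^ k) Q ∈ pts Ps
        pts-closed^ Ps {Q} s∈ Q∈ zero = subst (_∈ pts Ps) (sym (vec-cong (*-identityˡ _) (*-identityˡ _) refl)) Q∈
        pts-closed^ Ps {Q} {s} s∈ Q∈ (suc k) =
          subst (_∈ pts Ps) (sym (vec-cong (*-assoc _ _ _) (*-assoc _ _ _) refl)) (pts-closed Ps s∈ (pts-closed^ Ps s∈ Q∈ k))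

        directions-distinct : ∀ i j Xs {ds} → directions i j Xs ≡ just ds → AllPairs _≢_ (map code ds) →
                              ∀ {X Y} → X ∈ Xs → Y ∈ Xs → X ≢ Y →
                              ∃[ d ] ∃[ e ] (Sees (pt (i , j)) (pt X) d × Sees (pt (i , j)) (pt Y) e × d ≢ e)
        seen : ∀ i j Xs {ds} → directions i j Xs ≡ just ds → ∀ {X} → X ∈ Xs → ∃[ d ] (d ∈ ds × Sees (pt (i , j)) (pt X) d)
        seen i j (X ∷ Xs) eq X∈ with direction i j X in eq₁ | directions i j Xs in eq₂
        seen i j (X ∷ Xs) refl (here refl) | just d | just ds = d , here refl , direction-sound i j X eq₁
        seen i j (X ∷ Xs) refl (there X∈)  | just d | just ds with seen i j Xs eq₂ X∈
        ... | e , e∈ , sees = e , there e∈ , sees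
        directions-distinct i j (X ∷ Xs) eq pairs X∈ Y∈ X≢Y with direction i j X in eq₁ | directions i j Xs in eq₂
        directions-distinct i j (X ∷ Xs) refl (ps ∷ pairs) (here refl) (here refl) X≢Y | just d | just ds = ⊥-elim (X≢Y refl)
        directions-distinct i j (X ∷ Xs) refl (ps ∷ pairs) (here refl) (there Y∈)  X≢Y | just d | just ds with seen i j Xs eq₂ Y∈
        ... | e , e∈ , sees = d , e , direction-sound i j X eq₁ , sees , λ { refl → All.lookup ps (∈-map⁺ code e∈) refl }
        directions-distinct i j (X ∷ Xs) refl (ps ∷ pairs) (there X∈)  (here refl) X≢Y | just d | just ds with seen i j Xs eq₂ X∈
        ... | e , e∈ , sees = e , d , sees , direction-sound i j X eq₁ , λ { refl → All.lookup ps (∈-map⁺ code e∈) refl }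
        directions-distinct i j (X ∷ Xs) refl (ps ∷ pairs) (there X∈)  (there Y∈)  X≢Y | just d | just ds =
          directions-distinct i j Xs eq₂ pairs X∈ Y∈ X≢Y

        scan-inv : ∀ i j Ps {ls} → scan ((i , j) ∷ Ps) ≡ just ls →
                   ∃[ ds ] ∃[ ks ] (directions i j (map (move (i , j)) ss ++ orbits Ps) ≡ just ds × scan Ps ≡ just ks ×
                                    AllPairs _≢_ (map code ds) × ls ≡ lines i j ds ks)
        scan-inv i j Ps eq with directions i j (map (move (i , j)) ss ++ orbits Ps) | scan Ps
        ... | just ds | just ks with distinct ms (map code ds) empty in ok
        scan-inv i j Ps refl | just ds | just ks | true = ds , ks , refl , refl , proj₁ (distinct-sound ms (map code ds) empty ok) , refl

        NoThree : List Vec3 → Set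
        NoThree A = ∀ {P Q R} → P ∈ A → Q ∈ A → R ∈ A → P ≢ Q → P ≢ R → Q ≢ R → ¬ Collinear P Q R

        -- A translation in the lattice moves P to the representative, from which all other points are seen in different directions.
        head-noThree : ∀ i j Ps {ds} → directions i j (map (move (i , j)) ss ++ orbits Ps) ≡ just ds → AllPairs _≢_ (map code ds) →
                       ∀ {P Q R} → P ∈ map pt (map (move (i , j)) full) → Q ∈ pts ((i , j) ∷ Ps) → R ∈ pts ((i , j) ∷ Ps) →
                       P ≢ Q → P ≢ R → Q ≢ R → ¬ Collinear P Q R
        head-noThree i j Ps eq pairs {P} {Q} {R} P∈ Q∈ R∈ P≢Q P≢R Q≢R col with ∈-map⁻ pt {xs = map (move (i , j)) full} P∈
        ... | _ , P∈′ , refl with ∈-map⁻ (move (i , j)) {xs = full} P∈′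
        ...   | s@(a , b) , s∈ , refl = contra
          where
          -- The translation inverse to that by (a , b), written as its power n - 1, so that
          -- `pts-closed^` keeps the other points in the set.
          A B : K
          A = (α ^ a) ^ n-1
          B = (α ^ b) ^ n-1
          A≢0 : A ≢ 0F
          A≢0 = ^-nonzero (α^≢0 a) n-1
          B≢0 : B ≢ 0F
          B≢0 = ^-nonzero (α^≢0 b) n-1
          back : act A B (pt (move (i , j) s)) ≡ pt (i , j)
          back = trans (cong (act A B) (pt-move (i , j) s)) (vec-cong (eq₁ a (α ^ i)) (eq₁ b (α ^ j)) refl)
            where
            eq₁ : ∀ a x → (α ^ a) ^ n-1 * (α ^ a * x) ≡ x
            eq₁ a x = trans (solve 3 (λ u v x → u :* (v :* x) := v :* u :* x) refl ((α ^ a) ^ n-1) (α ^ a) x)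
              (trans (cong (_* x) (^-n a)) (*-identityˡ x))
          other : ∀ {Q} → Q ∈ pts ((i , j) ∷ Ps) → pt (move (i , j) s) ≢ Q →
                  ∃[ X ] (X ∈ map (move (i , j)) ss ++ orbits Ps × act A B Q ≡ pt X)
          other Q∈ P≢Q with pts⁻ ((i , j) ∷ Ps) (pts-closed^ ((i , j) ∷ Ps) {s = a , b} s∈ Q∈ n-1)
          ... | X , here refl , eq = ⊥-elim (P≢Q (act-injective A≢0 B≢0 (trans back (sym (trans eq (pt-move₀ (i , j)))))))
          ... | X , there X∈  , eq = X , X∈ , eq
          contra : ⊥
          contra with other Q∈ P≢Q | other R∈ P≢R
          ... | X , X∈ , eqX | Y , Y∈ , eqY
            with directions-distinct i j _ eq pairs X∈ Y∈ (λ { refl → Q≢R (act-injective A≢0 B≢0 (trans eqX (sym eqY))) })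
          ...   | d , e , seesX , seesY , d≢e =
            d≢e (collinear-Sees refl refl (subst₂ (λ P (Q , R) → Collinear P Q R) back (cong₂ _,_ eqX eqY) (act-Collinear A≢0 B≢0 col)) seesX seesY)

        swap₁₂ : ∀ {P Q R} → Collinear P Q R → Collinear Q P R
        swap₁₂ (L , L≢0 , p , q , r) = L , L≢0 , q , p , r

        swap₁₃ : ∀ {P Q R} → Collinear P Q R → Collinear R Q P
        swap₁₃ (L , L≢0 , p , q , r) = L , L≢0 , r , q , p

        -- If one of the three points lies in the first orbit, symmetry of collinearity brings it to
        -- the front; otherwise all three lie in the remaining orbits.
        scan-noThree : ∀ Ps {ls} → scan Ps ≡ just ls → NoThree (pts Ps)
        scan-noThree ((i , j) ∷ Ps) eq {P} {Q} {R} P∈ Q∈ R∈ P≢Q P≢R Q≢R col with scan-inv i j Ps eq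
        ... | ds , ks , eq₁ , eq₂ , pairs , _ with part P∈ | part Q∈ | part R∈
          where
          part : ∀ {Q} → Q ∈ pts ((i , j) ∷ Ps) → Q ∈ map pt (map (move (i , j)) full) ⊎ Q ∈ pts Ps
          part Q∈ with pts⁻ ((i , j) ∷ Ps) Q∈
          ... | X , X∈ , refl with ∈-++⁻ (map (move (i , j)) full) X∈
          ...   | inj₁ X∈′ = inj₁ (∈-map⁺ pt X∈′)
          ...   | inj₂ X∈′ = inj₂ (∈-map⁺ pt X∈′)
        ... | inj₁ P∈′ | _        | _        = head-noThree i j Ps eq₁ pairs P∈′ Q∈ R∈ P≢Q P≢R Q≢R col
        ... | _        | inj₁ Q∈′ | _        = head-noThree i j Ps eq₁ pairs Q∈′ P∈ R∈ (P≢Q ∘ sym) Q≢R P≢R (swap₁₂ col)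
        ... | _        | _        | inj₁ R∈′ = head-noThree i j Ps eq₁ pairs R∈′ Q∈ P∈ (Q≢R ∘ sym) (P≢R ∘ sym) (P≢Q ∘ sym) (swap₁₃ col)
        ... | inj₂ P∈′ | inj₂ Q∈′ | inj₂ R∈′ = scan-noThree Ps eq₂ P∈′ Q∈′ R∈′ P≢Q P≢R Q≢R col

      Bisects : List Vec3 → Line → Set
      Bisects A ℓ = ∃[ Q ] ∃[ R ] (Q ∈ A × R ∈ A × Q ≢ R × Incident (coefficients ℓ) Q × Incident (coefficients ℓ) R)

      Sees-≢ : ∀ {P Q d} → Sees P Q d → P ≢ Q
      Sees-≢ {⟨ x , y , _ ⟩} (a , b , x≡ , y≡ , up _ b≢0) refl = b≢0 (+-cancelˡ y (trans (sym y≡) (sym (+-identityʳ y))))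
      Sees-≢ {⟨ x , y , _ ⟩} (a , b , x≡ , y≡ , flat a≢0 _) refl = a≢0 (+-cancelˡ x (trans (sym x≡) (sym (+-identityʳ x))))
      Sees-≢ {⟨ x , y , _ ⟩} (a , b , x≡ , y≡ , slope a≢0 _ _) refl = a≢0 (+-cancelˡ x (trans (sym x≡) (sym (+-identityʳ x))))

      line-Bisects : ∀ {A} i j {Q d ls} → pt (i , j) ∈ A → Q ∈ A → Vec3.z Q ≡ 1F → Sees (pt (i , j)) Q d →
                     All (Bisects A) ls → All (Bisects A) (line i j d ls)
      line-Bisects i j {⟨ x′ , y′ , _ ⟩} P∈ Q∈ refl sees@(a , b , refl , refl , up refl _) Bs =
        (_ , _ , P∈ , Q∈ , Sees-≢ sees , on-vertical i _ , subst (λ x → Incident (coefficients (vertical i)) ⟨ x , y′ , 1F ⟩) (sym (+-identityʳ _)) (on-vertical i _)) ∷ Bs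
      line-Bisects i j {⟨ x′ , y′ , _ ⟩} P∈ Q∈ refl sees@(a , b , refl , refl , flat _ refl) Bs =
        (_ , _ , P∈ , Q∈ , Sees-≢ sees , on-horizontal j _ , subst (λ y → Incident (coefficients (horizontal j)) ⟨ x′ , y , 1F ⟩) (sym (+-identityʳ _)) (on-horizontal j _)) ∷ Bs
      line-Bisects {A} i j {⟨ x′ , y′ , _ ⟩} {ls = ls} P∈ Q∈ refl sees@(a , b , refl , refl , slope {s} _ refl _) Bs with j ⊖ (s ℕ.+ i) in eq
      ... | zero = (_ , _ , P∈ , Q∈ , Sees-≢ sees , on-diagonal s 1F y≡ , on-diagonal s 1F (trans (cong (_+ α ^ s * a) y≡) (sym (distribˡ _ _ _)))) ∷ Bs
        where
        y≡ : α ^ j ≡ α ^ s * α ^ i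
        y≡ = trans (⊖-zero j (s ℕ.+ i) eq) (^-+ α s i)
      ... | suc d with find ms (suc d) z in eqd
      -- A missing table entry only costs a bisecant.
      ...   | nothing = Bs
      ...   | just e  = (_ , _ , P∈ , Q∈ , Sees-≢ sees , on-oblique s (s ℕ.+ i ℕ.+ e) y≡ ,
                         on-oblique s (s ℕ.+ i ℕ.+ e) (trans (cong (_+ α ^ s * a) y≡) (solve 4 (λ σ x a t → σ :* x :+ t :* con 1 :+ σ :* a := σ :* (x :+ a) :+ t :* con 1) refl (α ^ s) (α ^ i) a (α ^ (s ℕ.+ i ℕ.+ e))))) ∷ Bs
        where
        y≡ : α ^ j ≡ α ^ s * α ^ i + α ^ (s ℕ.+ i ℕ.+ e) * 1F
        y≡ = trans (⊖-zech j (s ℕ.+ i) (trans (cong (α ^_) eq) (find-sound ms (suc d) Zs eqd))) (cong₂ _+_ (^-+ α s i) (sym (*-identityʳ _)))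

      lines-Bisects : ∀ {A} i j Xs {ds ls} → pt (i , j) ∈ A → (∀ {X} → X ∈ Xs → pt X ∈ A) → directions i j Xs ≡ just ds →
                      All (Bisects A) ls → All (Bisects A) (lines i j ds ls)
      lines-Bisects i j []       P∈ Xs⊆ refl Bs = Bs
      lines-Bisects i j (X ∷ Xs) P∈ Xs⊆ eq   Bs with direction i j X in eq₁ | directions i j Xs in eq₂
      lines-Bisects i j (X ∷ Xs) P∈ Xs⊆ refl Bs | just d | just ds =
        line-Bisects i j P∈ (Xs⊆ (here refl)) refl (direction-sound i j X eq₁) (lines-Bisects i j Xs P∈ (Xs⊆ ∘ there) eq₂ Bs)

      scan-Bisects : (full-closed : ∀ {s t} → s ∈ full → t ∈ full → move s t ∈ full) →
                     ∀ {A} Ps {ls} → (∀ {X} → X ∈ orbits Ps → pt X ∈ A) → scan Ps ≡ just ls → All (Bisects A) ls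
      scan-Bisects fc [] ⊆A refl = []
      scan-Bisects fc {A} ((i , j) ∷ Ps) ⊆A eq with scan-inv fc i j Ps eq
      ... | ds , ks , eq₁ , eq₂ , _ , refl =
        lines-Bisects i j _ (subst (_∈ A) (pt-move₀ (i , j)) (⊆A (here refl))) (⊆A ∘ there) eq₁
          (scan-Bisects fc Ps (⊆A ∘ ∈-++⁺ʳ (map (move (i , j)) full)) eq₂)

-- Covered points on the torus and on the coordinate triangle; completeness.

module Coverings where

  open Numerals
  open Fields
  open Logarithms
  open Certificates
  open Geometry
  open import Data.Bool.Base using (true; T)
  open import Data.Empty using (⊥-elim)
  open import Data.Fin.Base using (Fin; zero; suc)
  import Data.Fin.Properties as Fin
  open import Data.List.Base using (List; []; _∷_; _++_; map; lookup)
  open import Data.List.Membership.Propositional using (_∈_)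
  open import Data.List.Membership.Propositional.Properties using (∈-map⁺; ∈-map⁻; ∈-++⁻; ∈-lookup)
  open import Data.List.Relation.Unary.All using (All; []; _∷_)
  import Data.List.Relation.Unary.All as All
  open import Data.List.Relation.Unary.AllPairs using (AllPairs; []; _∷_)
  open import Data.List.Relation.Unary.Any using (here; there; index)
  open import Data.List.Relation.Unary.Any.Properties using (lookup-index)
  open import Data.Maybe.Base using (just; nothing)
  open import Data.Nat.Base using (ℕ; zero; suc; _≤_; _<_; z≤n; s≤s)
  import Data.Nat.Base as ℕ
  import Data.Nat.Properties as ℕ
  open import Data.Nat.Tactic.RingSolver using (solve-∀)
  open import Data.Product.Base using (∃-syntax; _×_; _,_; proj₁; proj₂)
  open import Data.Sum.Base using (inj₁; inj₂)
  open import Function.Base using (_∘_; id)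
  open import Relation.Binary.PropositionalEquality hiding (resp)
  open import Relation.Nullary using (¬_; yes; no)

  module Covering {n-1 : ℕ} (F : FiniteField (suc (suc n-1))) {α : Fin (suc (suc n-1))}
                  (α^n≡1 : Field._^_ F α (suc n-1) ≡ FiniteField.1F F)
                  (order : ∀ d → 0 < d → d < suc n-1 → Field._^_ F α d ≢ FiniteField.1F F)
                  (ms : List ℕ) (z : Tree ℕ) (ss : List Point)
                  (Zs : Entries ms (λ d e → Field._^_ F α d ≡ FiniteField._+_ F (FiniteField.1F F) (Field._^_ F α e)) z)
                  (full-closed : ∀ {s t} → s ∈ (0 , 0) ∷ ss → t ∈ (0 , 0) ∷ ss → Shifts.move n-1 ss s t ∈ (0 , 0) ∷ ss)
                  (Ps : List Point) where

    open Generated F α^n≡1 order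
    open Scanned ms z ss Zs

    A : List Vec3
    A = pts Ps

    Cov : Vec3 → Set
    Cov P = ∃[ Q ] ∃[ R ] (Q ∈ A × R ∈ A × Q ≢ R × Collinear P Q R)

    cov-line : ∀ ℓ {P} → Bisects A ℓ → Incident (coefficients ℓ) P → Cov P
    cov-line ℓ (Q , R , Q∈ , R∈ , Q≢R , q , r) p = Q , R , Q∈ , R∈ , Q≢R , coefficients ℓ , coefficients≢0 ℓ , p , q , r

    cov-act : ∀ {P} a b → (a , b) ∈ full → Cov P → Cov (act (α ^ a) (α ^ b) P)
    cov-act a b s∈ (Q , R , Q∈ , R∈ , Q≢R , col) =
      _ , _ , pts-closed full-closed Ps {s = a , b} s∈ Q∈ , pts-closed full-closed Ps {s = a , b} s∈ R∈ ,
      Q≢R ∘ act-injective (α^≢0 a) (α^≢0 b) , act-Collinear (α^≢0 a) (α^≢0 b) col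

    cov-scale : ∀ c {x y z x′ y′ z′} → x′ ≡ c * x → y′ ≡ c * y → z′ ≡ c * z → Cov ⟨ x , y , z ⟩ → Cov ⟨ x′ , y′ , z′ ⟩
    cov-scale c {x} {y} {z} refl refl refl (Q , R , Q∈ , R∈ , Q≢R , L@(⟨ l , m , k ⟩) , L≢0 , p , q , r) =
      Q , R , Q∈ , R∈ , Q≢R , L , L≢0 ,
      trans (solve 7 (λ c l m k x y z → l :* (c :* x) :+ (m :* (c :* y) :+ k :* (c :* z)) := c :* (l :* x :+ (m :* y :+ k :* z))) refl c l m k x y z)
        (trans (cong (c *_) p) (zeroʳ c)) , q , r

    record CovT (u v : ℕ) : Set where
      constructor torus
      field cov : Cov (pt (u , v))

    ^-period : ∀ k x → α ^ (k ℕ.* n ℕ.+ x) ≡ α ^ x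
    ^-period k x = trans (^-+ α (k ℕ.* n) x) (trans (cong (_* α ^ x) (trans (^-* α k n) (trans (cong (_^ k) α^n≡1) (1^ k)))) (*-identityˡ _))

    ^-mod : ∀ {a} b → a ≡ b %1+ n-1 → α ^ a ≡ α ^ b
    ^-mod b refl = ^-% b

    -- Predicates that depend on exponents only through powers of α and are preserved by the
    -- lattice. `CovT`, `Key` and `Curve` are such, so keys and curve points can be reduced
    -- separately before they are added.
    record Invariant (R : ℕ → ℕ → Set) : Set where
      field
        resp  : ∀ {u u′ v v′} → α ^ u ≡ α ^ u′ → α ^ v ≡ α ^ v′ → R u v → R u′ v′
        shift : ∀ {a b} → (a , b) ∈ full → ∀ {u v} → R u v → R (a ℕ.+ u) (b ℕ.+ v)

    CovT-Invariant : Invariant CovT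
    CovT-Invariant = record
      { resp  = λ eq₁ eq₂ (torus C) → torus (subst Cov (vec-cong eq₁ eq₂ refl) C)
      ; shift = λ {a} {b} s∈ {u} {v} (torus C) → torus (subst Cov (vec-cong (sym (^-+ α a u)) (sym (^-+ α b v)) refl) (cov-act a b s∈ C)) }

    open Invariant

    private
      ^-assoc : ∀ a r e → α ^ (a ℕ.+ (r ℕ.+ e)) ≡ α ^ (a ℕ.+ r ℕ.+ e)
      ^-assoc a r e = cong (α ^_) (sym (ℕ.+-assoc a r e))
      ^-cong-+ : ∀ r r′ e → α ^ r ≡ α ^ r′ → α ^ (r ℕ.+ e) ≡ α ^ (r′ ℕ.+ e)
      ^-cong-+ r r′ e eq = trans (^-+ α r e) (trans (cong (_* α ^ e) eq) (sym (^-+ α r′ e)))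
      ^-cong-+ʳ : ∀ e r r′ → α ^ r ≡ α ^ r′ → α ^ (e ℕ.+ r) ≡ α ^ (e ℕ.+ r′)
      ^-cong-+ʳ e r r′ eq = trans (^-+ α e r) (trans (cong (α ^ e *_) eq) (sym (^-+ α e r′)))
      ^-swap : ∀ a r e → α ^ (a ℕ.+ (r ℕ.+ e)) ≡ α ^ (r ℕ.+ (a ℕ.+ e))
      ^-swap a r e = cong (α ^_) (eq a r e)
        where
        eq : ∀ a r e → a ℕ.+ (r ℕ.+ e) ≡ r ℕ.+ (a ℕ.+ e)
        eq = solve-∀

    -- The translates of the curve y = 1 + x, in logarithmic coordinates, that consist of covered points.
    Key : ℕ → ℕ → Set
    Key r c = ∀ d e → α ^ d ≡ 1F + α ^ e → CovT (r ℕ.+ e) (c ℕ.+ d)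

    Key-Invariant : Invariant Key
    Key-Invariant = record
      { resp  = λ {u} {u′} {v} {v′} eq₁ eq₂ κ d e ζ → resp CovT-Invariant (^-cong-+ u u′ e eq₁) (^-cong-+ v v′ d eq₂) (κ d e ζ)
      ; shift = λ {a} {b} s∈ {u} {v} κ d e ζ → resp CovT-Invariant (^-assoc a u e) (^-assoc b v d) (shift CovT-Invariant s∈ (κ d e ζ)) }

    -- Dual to `Key`: a pair that yields a covered point when added to any key. Points of y = 1 + x
    -- have this property, and it passes to their lattice translates, which need not lie on the
    -- curve.
    Curve : ℕ → ℕ → Set
    Curve u v = ∀ r c → Key r c → CovT (r ℕ.+ u) (c ℕ.+ v)

    Curve-Invariant : Invariant Curve
    Curve-Invariant = record
      { resp  = λ {u} {u′} {v} {v′} eq₁ eq₂ γ r c κ → resp CovT-Invariant (^-cong-+ʳ r u u′ eq₁) (^-cong-+ʳ c v v′ eq₂) (γ r c κ)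
      ; shift = λ {a} {b} s∈ {u} {v} γ r c κ → resp CovT-Invariant (^-swap a r u) (^-swap b c v) (shift CovT-Invariant s∈ (γ r c κ)) }

    module _ (L : Lattice) where
      open Lattice L
      open Exponents n-1 L _⊖_

      w₁ w₂ : ℕ
      w₁ = suc w₁-1
      w₂ = suc w₂-1

      module _ (g₁∈ : (w₁ %1+ n-1 , τ %1+ n-1) ∈ full) (g₂∈ : (0 , w₂ %1+ n-1) ∈ full) (σ+τ : (σ ℕ.+ τ) %1+ n-1 ≡ 0) where

        module _ {R : ℕ → ℕ → Set} (inv : Invariant R) where

          step₁ : ∀ k {u v} → R u v → R (k ℕ.* w₁ ℕ.+ u) (k ℕ.* τ ℕ.+ v)
          step₁ zero    ρ = ρ
          step₁ (suc k) {u} {v} ρ = resp inv (eq w₁ k u) (eq τ k v) (shift inv g₁∈ (step₁ k ρ))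
            where
            eq : ∀ w k u → α ^ (w %1+ n-1 ℕ.+ (k ℕ.* w ℕ.+ u)) ≡ α ^ (w ℕ.+ k ℕ.* w ℕ.+ u)
            eq w k u = trans (^-cong-+ (w %1+ n-1) w (k ℕ.* w ℕ.+ u) (^-% w)) (^-assoc w (k ℕ.* w) u)

          step₂ : ∀ k {u v} → R u v → R u (k ℕ.* w₂ ℕ.+ v)
          step₂ zero    ρ = ρ
          step₂ (suc k) {u} {v} ρ = resp inv refl (trans (^-cong-+ (w₂ %1+ n-1) w₂ (k ℕ.* w₂ ℕ.+ v) (^-% w₂)) (^-assoc w₂ (k ℕ.* w₂) v)) (shift inv g₂∈ (step₂ k ρ))

          α^στ : ∀ k x → α ^ (k ℕ.* (σ ℕ.+ τ) ℕ.+ x) ≡ α ^ x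
          α^στ k x = trans (^-+ α (k ℕ.* (σ ℕ.+ τ)) x) (trans (cong (_* α ^ x) (trans (^-* α k (σ ℕ.+ τ)) (trans (cong (_^ k) α^στ≡1) (1^ k)))) (*-identityˡ _))
            where
            α^στ≡1 : α ^ (σ ℕ.+ τ) ≡ 1F
            α^στ≡1 = trans (sym (^-% (σ ℕ.+ τ))) (cong (α ^_) σ+τ)

          -- Multiples of n may be added to exponents; this replaces the subtraction of k translations.
          unstep₁ : ∀ k {u v} → R (k ℕ.* w₁ ℕ.+ u) v → R u (k ℕ.* σ ℕ.+ v)
          unstep₁ k {u} {v} ρ = resp inv (trans (cong (α ^_) (eq₁ n-1 k w₁ u)) (^-period (k ℕ.* w₁) u))
            (trans (trans (sym (α^στ k _)) (cong (α ^_) (eq₂ n-1 k σ τ v))) (^-period (k ℕ.* τ) _))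
            (step₁ (n-1 ℕ.* k) ρ)
            where
            eq₁ : ∀ n-1 k w u → n-1 ℕ.* k ℕ.* w ℕ.+ (k ℕ.* w ℕ.+ u) ≡ k ℕ.* w ℕ.* (1 ℕ.+ n-1) ℕ.+ u
            eq₁ = solve-∀
            eq₂ : ∀ n-1 k σ τ v → k ℕ.* (σ ℕ.+ τ) ℕ.+ (n-1 ℕ.* k ℕ.* τ ℕ.+ v) ≡ k ℕ.* τ ℕ.* (1 ℕ.+ n-1) ℕ.+ (k ℕ.* σ ℕ.+ v)
            eq₂ = solve-∀

          unstep₂ : ∀ k {u v} x → R u (x ℕ.+ (k ℕ.* w₂ ℕ.+ v)) → R u (x ℕ.+ v)
          unstep₂ k {u} {v} x ρ = resp inv refl (trans (cong (α ^_) (eq n-1 k w₂ x v)) (^-period (k ℕ.* w₂) _)) (step₂ (n-1 ℕ.* k) ρ)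
            where
            eq : ∀ n-1 k w x v → n-1 ℕ.* k ℕ.* w ℕ.+ (x ℕ.+ (k ℕ.* w ℕ.+ v)) ≡ k ℕ.* w ℕ.* (1 ℕ.+ n-1) ℕ.+ (x ℕ.+ v)
            eq = solve-∀

          mod₂ : ∀ x {u} v → R u (x ℕ.+ v) → R u (x ℕ.+ v %1+ w₂-1)
          mod₂ x {u} v ρ = unstep₂ (v /1+ w₂-1) x (subst (λ w → R u (x ℕ.+ w)) (trans (%/-spec v w₂-1) (ℕ.+-comm (v %1+ w₂-1) _)) ρ)

          mod₁ : ∀ u {v} → R u v → R (u %1+ w₁-1) (v ℕ.+ u /1+ w₁-1 ℕ.* σ)
          mod₁ u {v} ρ = subst (R _) (ℕ.+-comm (u /1+ w₁-1 ℕ.* σ) v)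
            (unstep₁ (u /1+ w₁-1) (subst (λ w → R w v) (trans (%/-spec u w₁-1) (ℕ.+-comm (u %1+ w₁-1) _)) ρ))

          reduced : ∀ u v → R u v → ∃[ r ] ∃[ c ] (reduce u v ≡ r ℕ.* suc W-1 ℕ.+ c × c < w₂ × R r c)
          reduced u v ρ = _ , _ , refl , %-bound (v ℕ.+ u /1+ w₁-1 ℕ.* σ) w₂-1 , mod₂ 0 _ (mod₁ u ρ)

          -- Converse to `reduced`: translations carry the cell of w₁ by w₂ exponents to all
          -- exponents.
          unreduced : (∀ i → i < w₁ → ∀ c → c < w₂ → R i c) → ∀ u v → R u v
          unreduced ρ u v = resp inv (cong (α ^_) (trans (ℕ.+-comm (k ℕ.* w₁) _) (sym (%/-spec u w₁-1)))) eq
            (step₁ k (step₂ (v′ /1+ w₂-1) (ρ (u %1+ w₁-1) (%-bound u w₁-1) (v′ %1+ w₂-1) (%-bound v′ w₂-1))))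
            where
            k v′ : ℕ
            k = u /1+ w₁-1
            v′ = v ℕ.+ k ℕ.* σ
            eq : α ^ (k ℕ.* τ ℕ.+ (v′ /1+ w₂-1 ℕ.* w₂ ℕ.+ v′ %1+ w₂-1)) ≡ α ^ v
            eq = trans (cong (α ^_) (trans (cong (k ℕ.* τ ℕ.+_) (trans (ℕ.+-comm _ (v′ %1+ w₂-1)) (sym (%/-spec v′ w₂-1)))) (eq′ k σ τ v))) (α^στ k v)
              where
              eq′ : ∀ k σ τ v → k ℕ.* τ ℕ.+ (v ℕ.+ k ℕ.* σ) ≡ k ℕ.* (σ ℕ.+ τ) ℕ.+ v
              eq′ = solve-∀

        Reduced : (ℕ → ℕ → Set) → ℕ → Set
        Reduced R x = ∃[ r ] ∃[ c ] (x ≡ r ℕ.* suc W-1 ℕ.+ c × c < w₂ × R r c)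

        keys-sound : ∀ {ls} → All (Bisects A) ls → All (Reduced Key) (keys ls)
        keys-sound [] = []
        keys-sound {vertical _ ∷ _}   (_ ∷ Bs) = keys-sound Bs
        keys-sound {horizontal _ ∷ _} (_ ∷ Bs) = keys-sound Bs
        keys-sound {diagonal _ ∷ _}   (_ ∷ Bs) = keys-sound Bs
        keys-sound {oblique s t ∷ _}  (B ∷ Bs) = reduced Key-Invariant (t ⊖ s) t κ ∷ keys-sound Bs
          where
          κ : Key (t ⊖ s) t
          κ d e ζ = torus (cov-line (oblique s t) B (on-oblique s t (begin
            α ^ (t ℕ.+ d)                                      ≡⟨ ^-+ α t d ⟩
            α ^ t * α ^ d                                      ≡⟨ cong (α ^ t *_) ζ ⟩
            α ^ t * (1F + α ^ e)                               ≡⟨ solve 2 (λ u v → u :* (con 1 :+ v) := u :* v :+ u :* con 1) refl (α ^ t) (α ^ e) ⟩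
            α ^ t * α ^ e + α ^ t * 1F                         ≡⟨ cong (λ x → x * α ^ e + α ^ t * 1F) (⊖-spec t s) ⟨
            α ^ (t ⊖ s) * α ^ s * α ^ e + α ^ t * 1F           ≡⟨ cong (_+ α ^ t * 1F) (solve 3 (λ u v w → u :* v :* w := v :* (u :* w)) refl (α ^ (t ⊖ s)) (α ^ s) (α ^ e)) ⟩
            α ^ s * (α ^ (t ⊖ s) * α ^ e) + α ^ t * 1F         ≡⟨ cong (λ x → α ^ s * x + α ^ t * 1F) (^-+ α (t ⊖ s) e) ⟨
            α ^ s * α ^ (t ⊖ s ℕ.+ e) + α ^ t * 1F             ∎)))
            where open ≡-Reasoning

        curve-sound : ∀ k → All (Reduced Curve) (curve ms z k)
        curve-sound zero = []
        curve-sound (suc d) with find ms d z in eq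
        ... | nothing = curve-sound d
        ... | just e  = reduced Curve-Invariant e d (λ r c κ → κ d e (find-sound ms d Zs eq)) ∷ curve-sound d

        columns-sound : ∀ {ls} → All (Bisects A) ls → All (λ i → ∀ c → CovT i c) (columns ls)
        columns-sound [] = []
        columns-sound {horizontal _ ∷ _} (_ ∷ Bs) = columns-sound Bs
        columns-sound {diagonal _ ∷ _}   (_ ∷ Bs) = columns-sound Bs
        columns-sound {oblique _ _ ∷ _}  (_ ∷ Bs) = columns-sound Bs
        columns-sound {vertical i ∷ _}   (B ∷ Bs) = column ∷ columns-sound Bs
          where
          k : ℕ
          k = i /1+ w₁-1
          column : ∀ c → CovT (i %1+ w₁-1) c
          -- The second exponent is chosen as k τ + c so that the shift by k σ in the reduction
          -- brings it back to `c`.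
          column c = resp CovT-Invariant refl (trans (cong (α ^_) (eq k σ τ c)) (α^στ CovT-Invariant k c))
            (mod₁ CovT-Invariant i {k ℕ.* τ ℕ.+ c} (torus (cov-line (vertical i) B (on-vertical i _))))
            where
            eq : ∀ k σ τ c → k ℕ.* τ ℕ.+ c ℕ.+ k ℕ.* σ ≡ k ℕ.* (σ ℕ.+ τ) ℕ.+ c
            eq = solve-∀

        -- The exponent (n - 1) a + r stands for r - a.
        ^-cycle : ∀ a r → α ^ (a ℕ.+ (n-1 ℕ.* a ℕ.+ r)) ≡ α ^ r
        ^-cycle a r = trans (cong (α ^_) (eq n-1 a r)) (^-period a r)
          where
          eq : ∀ n-1 a r → a ℕ.+ (n-1 ℕ.* a ℕ.+ r) ≡ a ℕ.* (1 ℕ.+ n-1) ℕ.+ r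
          eq = solve-∀

        rowsFor-sound : ∀ j → (∀ u → CovT u j) → ∀ fs → (∀ {s} → s ∈ fs → s ∈ full) → ∀ {l} →
                        All (λ c → ∀ r → CovT r c) l → All (λ c → ∀ r → CovT r c) (rowsFor j fs l)
        rowsFor-sound j cov []             ⊆full Rs = Rs
        rowsFor-sound j cov ((a , b) ∷ fs) ⊆full Rs =
          (λ r → mod₂ CovT-Invariant 0 (b ℕ.+ j) (resp CovT-Invariant (^-cycle a r) refl (shift CovT-Invariant (⊆full (here refl)) (cov (n-1 ℕ.* a ℕ.+ r)))))
          ∷ rowsFor-sound j cov fs (⊆full ∘ there) Rs

        rowsOf-sound : ∀ {ls} → All (Bisects A) ls → All (λ c → ∀ r → CovT r c) (rowsOf full ls)
        rowsOf-sound [] = []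
        rowsOf-sound {vertical _ ∷ _}   (_ ∷ Bs) = rowsOf-sound Bs
        rowsOf-sound {diagonal _ ∷ _}   (_ ∷ Bs) = rowsOf-sound Bs
        rowsOf-sound {oblique _ _ ∷ _}  (_ ∷ Bs) = rowsOf-sound Bs
        rowsOf-sound {horizontal j ∷ _} (B ∷ Bs) =
          rowsFor-sound j (λ u → torus (cov-line (horizontal j) B (on-horizontal j _))) full id (rowsOf-sound Bs)

        diagonalsFor-sound : ∀ d → (∀ u → CovT u (d ℕ.+ u)) → ∀ fs → (∀ {s} → s ∈ fs → s ∈ full) → ∀ {l} →
                             All (λ c → ∀ u → CovT u (u ℕ.+ c)) l → All (λ c → ∀ u → CovT u (u ℕ.+ c)) (diagonalsFor d fs l)
        diagonalsFor-sound d cov []             ⊆full Ds = Ds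
        diagonalsFor-sound d cov ((a , b) ∷ fs) ⊆full Ds =
          (λ u → mod₂ CovT-Invariant u ((b ℕ.+ d) ⊖ a)
            (resp CovT-Invariant (^-cycle a u) (eq u) (shift CovT-Invariant (⊆full (here refl)) (cov (n-1 ℕ.* a ℕ.+ u)))))
          ∷ diagonalsFor-sound d cov fs (⊆full ∘ there) Ds
          where
          open ≡-Reasoning
          eq : ∀ u → α ^ (b ℕ.+ (d ℕ.+ (n-1 ℕ.* a ℕ.+ u))) ≡ α ^ (u ℕ.+ ((b ℕ.+ d) ⊖ a))
          eq u = begin
            α ^ (b ℕ.+ (d ℕ.+ (n-1 ℕ.* a ℕ.+ u)))           ≡⟨ cong (α ^_) (sym (ℕ.+-assoc b d _)) ⟩
            α ^ (b ℕ.+ d ℕ.+ (n-1 ℕ.* a ℕ.+ u))             ≡⟨ ^-+ α (b ℕ.+ d) _ ⟩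
            α ^ (b ℕ.+ d) * α ^ (n-1 ℕ.* a ℕ.+ u)           ≡⟨ cong (_* α ^ (n-1 ℕ.* a ℕ.+ u)) (⊖-spec (b ℕ.+ d) a) ⟨
            α ^ ((b ℕ.+ d) ⊖ a) * α ^ a * α ^ (n-1 ℕ.* a ℕ.+ u)   ≡⟨ *-assoc _ _ _ ⟩
            α ^ ((b ℕ.+ d) ⊖ a) * (α ^ a * α ^ (n-1 ℕ.* a ℕ.+ u)) ≡⟨ cong (α ^ ((b ℕ.+ d) ⊖ a) *_) (trans (sym (^-+ α a _)) (^-cycle a u)) ⟩
            α ^ ((b ℕ.+ d) ⊖ a) * α ^ u                     ≡⟨ *-comm _ _ ⟩
            α ^ u * α ^ ((b ℕ.+ d) ⊖ a)                     ≡⟨ ^-+ α u _ ⟨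
            α ^ (u ℕ.+ ((b ℕ.+ d) ⊖ a))                     ∎

        diagonalsOf-sound : ∀ {ls} → All (Bisects A) ls → All (λ c → ∀ u → CovT u (u ℕ.+ c)) (diagonalsOf full ls)
        diagonalsOf-sound [] = []
        diagonalsOf-sound {vertical _ ∷ _}   (_ ∷ Bs) = diagonalsOf-sound Bs
        diagonalsOf-sound {horizontal _ ∷ _} (_ ∷ Bs) = diagonalsOf-sound Bs
        diagonalsOf-sound {oblique _ _ ∷ _}  (_ ∷ Bs) = diagonalsOf-sound Bs
        diagonalsOf-sound {diagonal d ∷ _}   (B ∷ Bs) =
          diagonalsFor-sound d (λ u → torus (cov-line (diagonal d) B (on-diagonal d 1F (^-+ α d u)))) full id (diagonalsOf-sound Bs)

        torus-covered : ∀ Z-1 κ β f {ls} → All (Bisects A) ls →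
                Radix.Cover.cover Z-1 κ β W-1 w₁ w₂ σ f (keys ls) (curve ms z n) (columns ls) (rowsOf full ls) (diagonalsOf full ls) ≡ true →
                ∀ u v → CovT u v
        torus-covered Z-1 κ β f Bs ok = unreduced CovT-Invariant
          (Radix.Cover.cover-sound Z-1 κ β W-1 w₁ w₂ σ {CovT} {Reduced Key} {Reduced Curve} f combine wrap (λ {r} {c} → unstep₂ CovT-Invariant 1 0 ∘ subst (CovT r) (cong (ℕ._+ c) (sym (ℕ.*-identityˡ w₂))))
            (keys-sound Bs) (curve-sound n) (columns-sound Bs) (rowsOf-sound Bs) (diagonalsOf-sound Bs) ok)
          where
          wrap : ∀ {r c} → CovT (w₁ ℕ.+ r) c → CovT r (σ ℕ.+ c)
          wrap {r} {c} ρ = subst (λ k → CovT r (k ℕ.+ c)) (ℕ.*-identityˡ σ) (unstep₁ CovT-Invariant 1 (subst (λ k → CovT (k ℕ.+ r) c) (sym (ℕ.*-identityˡ w₁)) ρ))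
          -- Both columns are below w₂ and W is at least 2 w₂, so a sum of two positions never runs
          -- into the next row.
          combine : ∀ {d e} → Reduced Key d → Reduced Curve e → Radix.At Z-1 CovT (suc W-1) (d ℕ.+ e)
          combine (r , c , refl , c<w , κ) (r′ , c′ , refl , c′<w , γ) =
            r ℕ.+ r′ , c ℕ.+ c′ , eq r r′ c c′ (suc W-1) , ℕ.<-≤-trans (ℕ.+-mono-< c<w c′<w) (ℕ.m≤m+n (w₂ ℕ.+ w₂) σ) , γ r c κ
            where
            eq : ∀ r r′ c c′ W → r ℕ.* W ℕ.+ c ℕ.+ (r′ ℕ.* W ℕ.+ c′) ≡ (r ℕ.+ r′) ℕ.* W ℕ.+ (c ℕ.+ c′)
            eq = solve-∀

    -- The one-dimensional counterpart of the cylinder, used for the three sides of the triangle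
    -- with their respective periods.
    module Circle (E : ℕ → Set) (π-1 : ℕ) (E-resp : ∀ {u u′} → α ^ u ≡ α ^ u′ → E u → E u′)
                  (E-step : ∀ {v} → E v → E (suc π-1 ℕ.+ v)) where

      steps : ∀ k {v} → E v → E (k ℕ.* suc π-1 ℕ.+ v)
      steps zero    ε = ε
      steps (suc k) ε = subst E (sym (ℕ.+-assoc (suc π-1) (k ℕ.* suc π-1) _)) (E-step (steps k ε))

      residue : ∀ {v} → E v → E (v %1+ π-1)
      residue {v} ε = E-resp (trans (cong (α ^_) (trans (cong (n-1 ℕ.* k ℕ.* suc π-1 ℕ.+_) (%/-spec v π-1)) (eq n-1 k (suc π-1) (v %1+ π-1)))) (^-period (k ℕ.* suc π-1) _))
        (steps (n-1 ℕ.* k) ε)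
        where
        k : ℕ
        k = v /1+ π-1
        eq : ∀ n-1 k π r → n-1 ℕ.* k ℕ.* π ℕ.+ (r ℕ.+ k ℕ.* π) ≡ k ℕ.* π ℕ.* (1 ℕ.+ n-1) ℕ.+ r
        eq = solve-∀

      everywhere : ∀ f {es} → All E es → Radix.digits 1 (suc π-1) (Radix.powers 1 (Radix.levels 1 f 1 2 []) es) ≡ true → ∀ v → E v
      everywhere f {es} εs ok v = subst E (trans (ℕ.+-comm (v /1+ π-1 ℕ.* suc π-1) _) (sym (%/-spec v π-1)))
        (steps (v /1+ π-1) (Radix.digits-sound 1 (s≤s (s≤s z≤n)) (Radix.powers-Dig 1 (Radix.levels-sound 1 f {1} refl []) es εs) (suc π-1) ok (v %1+ π-1) (%-bound v π-1)))

    module Axes (L : Lattice) where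
      open Lattice L
      open Exponents n-1 L _⊖_

      hasVertical-sound : ∀ {ls} → All (Bisects A) ls → hasVertical ls ≡ true → ∃[ i ] Bisects A (vertical i)
      hasVertical-sound {vertical i ∷ _}   (B ∷ _)  ok = i , B
      hasVertical-sound {horizontal _ ∷ _} (_ ∷ Bs) ok = hasVertical-sound Bs ok
      hasVertical-sound {diagonal _ ∷ _}   (_ ∷ Bs) ok = hasVertical-sound Bs ok
      hasVertical-sound {oblique _ _ ∷ _}  (_ ∷ Bs) ok = hasVertical-sound Bs ok

      hasHorizontal-sound : ∀ {ls} → All (Bisects A) ls → hasHorizontal ls ≡ true → ∃[ j ] Bisects A (horizontal j)
      hasHorizontal-sound {horizontal j ∷ _} (B ∷ _)  ok = j , B
      hasHorizontal-sound {vertical _ ∷ _}   (_ ∷ Bs) ok = hasHorizontal-sound Bs ok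
      hasHorizontal-sound {diagonal _ ∷ _}   (_ ∷ Bs) ok = hasHorizontal-sound Bs ok
      hasHorizontal-sound {oblique _ _ ∷ _}  (_ ∷ Bs) ok = hasHorizontal-sound Bs ok

      hasDiagonal-sound : ∀ {ls} → All (Bisects A) ls → hasDiagonal ls ≡ true → ∃[ d ] Bisects A (diagonal d)
      hasDiagonal-sound {diagonal d ∷ _}   (B ∷ _)  ok = d , B
      hasDiagonal-sound {vertical _ ∷ _}   (_ ∷ Bs) ok = hasDiagonal-sound Bs ok
      hasDiagonal-sound {horizontal _ ∷ _} (_ ∷ Bs) ok = hasDiagonal-sound Bs ok
      hasDiagonal-sound {oblique _ _ ∷ _}  (_ ∷ Bs) ok = hasDiagonal-sound Bs ok

      module _ {a b : ℕ} (s∈ : (a , b) ∈ full) (b≡ : b ≡ suc πy-1 %1+ n-1) where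
        private
          module C = Circle (λ v → Cov ⟨ 0F , α ^ v , 1F ⟩) πy-1 (λ eq → subst Cov (vec-cong refl eq refl))
            (λ {v} C → subst Cov (vec-cong (zeroʳ _) (trans (cong (_* α ^ v) (^-mod (suc πy-1) b≡)) (sym (^-+ α (suc πy-1) v))) refl) (cov-act a b s∈ C))

        axisY-sound : ∀ {ls} → All (Bisects A) ls → All (λ v → Cov ⟨ 0F , α ^ v , 1F ⟩) (axisY ls)
        axisY-sound [] = []
        axisY-sound {vertical _ ∷ _}   (_ ∷ Bs) = axisY-sound Bs
        axisY-sound {diagonal _ ∷ _}   (_ ∷ Bs) = axisY-sound Bs
        axisY-sound {horizontal j ∷ _} (B ∷ Bs) = C.residue {j} (cov-line (horizontal j) B (on-horizontal j 0F)) ∷ axisY-sound Bs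
        axisY-sound {oblique s t ∷ _}  (B ∷ Bs) = C.residue {t} (cov-line (oblique s t) B (on-oblique s t
          (solve 2 (λ σ τ → τ := σ :* con 0 :+ τ :* con 1) refl (α ^ s) (α ^ t)))) ∷ axisY-sound Bs

        axisY-covered : ∀ f {ls} → All (Bisects A) ls → Radix.digits 1 (suc πy-1) (Radix.powers 1 (Radix.levels 1 f 1 2 []) (axisY ls)) ≡ true →
                        ∀ v → Cov ⟨ 0F , α ^ v , 1F ⟩
        axisY-covered f Bs ok = C.everywhere f (axisY-sound Bs) ok

      module _ {a b μ : ℕ} (s∈ : (a , b) ∈ full) (a≡ : a ≡ suc πx-1 %1+ n-1) (α^μ : 1F + α ^ μ ≡ 0F) where
        private
          module C = Circle (λ u → Cov ⟨ α ^ u , 0F , 1F ⟩) πx-1 (λ eq → subst Cov (vec-cong eq refl refl))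
            (λ {u} C → subst Cov (vec-cong (trans (cong (_* α ^ u) (^-mod (suc πx-1) a≡)) (sym (^-+ α (suc πx-1) u))) (zeroʳ _) refl) (cov-act a b s∈ C))

        axisX-sound : ∀ {ls} → All (Bisects A) ls → All (λ u → Cov ⟨ α ^ u , 0F , 1F ⟩) (axisX μ ls)
        axisX-sound [] = []
        axisX-sound {horizontal _ ∷ _} (_ ∷ Bs) = axisX-sound Bs
        axisX-sound {diagonal _ ∷ _}   (_ ∷ Bs) = axisX-sound Bs
        axisX-sound {vertical i ∷ _}   (B ∷ Bs) = C.residue {i} (cov-line (vertical i) B (on-vertical i 0F)) ∷ axisX-sound Bs
        axisX-sound {oblique s t ∷ _}  (B ∷ Bs) = C.residue {(μ ℕ.+ t) ⊖ s} (cov-line (oblique s t) B (on-oblique s t (sym (begin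
          α ^ s * α ^ ((μ ℕ.+ t) ⊖ s) + α ^ t * 1F    ≡⟨ cong (_+ α ^ t * 1F) (trans (*-comm _ _) (trans (⊖-spec (μ ℕ.+ t) s) (^-+ α μ t))) ⟩
          α ^ μ * α ^ t + α ^ t * 1F                  ≡⟨ solve 2 (λ m t → m :* t :+ t :* con 1 := (con 1 :+ m) :* t) refl (α ^ μ) (α ^ t) ⟩
          (1F + α ^ μ) * α ^ t                        ≡⟨ trans (cong (_* α ^ t) α^μ) (zeroˡ _) ⟩
          0F                                          ∎)))) ∷ axisX-sound Bs
          where open ≡-Reasoning

        axisX-covered : ∀ f {ls} → All (Bisects A) ls → Radix.digits 1 (suc πx-1) (Radix.powers 1 (Radix.levels 1 f 1 2 []) (axisX μ ls)) ≡ true →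
                        ∀ u → Cov ⟨ α ^ u , 0F , 1F ⟩
        axisX-covered f Bs ok = C.everywhere f (axisX-sound Bs) ok

      module _ {a b : ℕ} (s∈ : (a , b) ∈ full) (b≡ : b ≡ (a ℕ.+ suc πd-1) %1+ n-1) where
        private
          -- The shift sends (1 : α^w : 0) to (α^a : α^(b+w) : 0), which is normalised again by the
          -- inverse of α^a; b - a is the period.
          step : ∀ {w} → Cov ⟨ 1F , α ^ w , 0F ⟩ → Cov ⟨ 1F , α ^ (suc πd-1 ℕ.+ w) , 0F ⟩
          step {w} C = cov-scale i (sym (trans (cong (i *_) (*-identityʳ _)) (inv-* (α^≢0 a)))) (sym (begin
            i * (α ^ b * α ^ w)                          ≡⟨ cong (λ x → i * (x * α ^ w)) (trans (^-mod (a ℕ.+ suc πd-1) b≡) (^-+ α a (suc πd-1))) ⟩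
            i * (α ^ a * α ^ suc πd-1 * α ^ w)           ≡⟨ solve 4 (λ i a π w → i :* (a :* π :* w) := i :* a :* (π :* w)) refl i (α ^ a) (α ^ suc πd-1) (α ^ w) ⟩
            i * α ^ a * (α ^ suc πd-1 * α ^ w)           ≡⟨ cong₂ _*_ (inv-* (α^≢0 a)) (sym (^-+ α (suc πd-1) w)) ⟩
            1F * α ^ (suc πd-1 ℕ.+ w)                    ≡⟨ *-identityˡ _ ⟩
            α ^ (suc πd-1 ℕ.+ w)                         ∎)) (sym (zeroʳ i)) (cov-act a b s∈ C)
            where
            open ≡-Reasoning
            i : K
            i = inv (α^≢0 a)
          module C = Circle (λ w → Cov ⟨ 1F , α ^ w , 0F ⟩) πd-1 (λ eq → subst Cov (vec-cong refl eq refl)) (λ {w} → step {w})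

        infinity-sound : ∀ {ls} → All (Bisects A) ls → All (λ w → Cov ⟨ 1F , α ^ w , 0F ⟩) (infinity ls)
        infinity-sound [] = []
        infinity-sound {vertical _ ∷ _}   (_ ∷ Bs) = infinity-sound Bs
        infinity-sound {horizontal _ ∷ _} (_ ∷ Bs) = infinity-sound Bs
        infinity-sound {diagonal d ∷ _}   (B ∷ Bs) = C.residue {d} (cov-line (diagonal d) B (on-diagonal d 0F (sym (*-identityʳ _)))) ∷ infinity-sound Bs
        infinity-sound {oblique s t ∷ _}  (B ∷ Bs) = C.residue {s} (cov-line (oblique s t) B (on-oblique s t
          (solve 2 (λ σ τ → σ := σ :* con 1 :+ τ :* con 0) refl (α ^ s) (α ^ t)))) ∷ infinity-sound Bs

        infinity-covered : ∀ f {ls} → All (Bisects A) ls → Radix.digits 1 (suc πd-1) (Radix.powers 1 (Radix.levels 1 f 1 2 []) (infinity ls)) ≡ true →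
                           ∀ w → Cov ⟨ 1F , α ^ w , 0F ⟩
        infinity-covered f Bs ok = C.everywhere f (infinity-sound Bs) ok

    quotient-exists : ∀ {c} x → c ≢ 0F → ∃[ y ] x ≡ c * y
    quotient-exists {c} x c≢0 = inv c≢0 * x , sym (trans (sym (*-assoc c _ x)) (trans (cong (_* x) (proj₂ (inverse c c≢0))) (*-identityˡ x)))

    -- Seven cases, the orbits of the group of diagonal maps: the torus, the three sides without
    -- vertices, and the three vertices.
    covered : (∀ u v → CovT u v) → (∀ u → Cov ⟨ α ^ u , 0F , 1F ⟩) → (∀ v → Cov ⟨ 0F , α ^ v , 1F ⟩) → (∀ w → Cov ⟨ 1F , α ^ w , 0F ⟩) →
              (∃[ i ] Bisects A (vertical i)) → (∃[ j ] Bisects A (horizontal j)) → (∃[ d ] Bisects A (diagonal d)) →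
              ∀ P → NonZero3 P → Cov P
    covered T X Y I (i , Bi) (j , Bj) (d , Bd) ⟨ x , y , z ⟩ P≢0 with z ≟ 0F
    ... | no z≢0 with quotient-exists x z≢0 | quotient-exists y z≢0
    ...   | x′ , x≡ | y′ , y≡ = cov-scale z x≡ y≡ (sym (*-identityʳ z)) (affine x′ y′)
      where
      affine : ∀ x y → Cov ⟨ x , y , 1F ⟩
      affine x y with x ≟ 0F | y ≟ 0F
      ... | yes refl | yes refl = cov-line (diagonal d) Bd (on-diagonal d 1F (sym (zeroʳ _)))
      ... | yes refl | no y≢0 with generator y≢0
      ...   | v , refl = Y v
      affine x y | no x≢0 | yes refl with generator x≢0
      ...   | u , refl = X u
      affine x y | no x≢0 | no y≢0 with generator x≢0 | generator y≢0
      ...   | u , refl | v , refl = CovT.cov (T u v)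
    covered T X Y I (i , Bi) (j , Bj) (d , Bd) ⟨ x , y , z ⟩ P≢0 | yes refl with x ≟ 0F | y ≟ 0F
    ... | yes refl | yes refl = ⊥-elim (P≢0 (refl , refl , refl))
    ... | yes refl | no _ = cov-line (vertical i) Bi (solve 2 (λ y m → con 1 :* con 0 :+ (con 0 :* y :+ m :* con 0) := con 0) refl y (- (α ^ i)))
    ... | no _ | yes refl = cov-line (horizontal j) Bj (solve 2 (λ x m → con 0 :* x :+ (con 1 :* con 0 :+ m :* con 0) := con 0) refl x (- (α ^ j)))
    ... | no x≢0 | no y≢0 with quotient-exists y x≢0
    ...   | y′ , refl with generator {y′} (λ { refl → y≢0 (zeroʳ x) })
    ...     | w , refl = cov-scale x (sym (*-identityʳ x)) refl (sym (zeroʳ x)) (I w)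

    orbits-bound : ∀ Ps {X} → X ∈ orbits Ps → proj₁ X < n × proj₂ X < n
    orbits-bound (P ∷ Ps) X∈ with ∈-++⁻ (map (move P) full) X∈
    ... | inj₂ X∈′ = orbits-bound Ps X∈′
    ... | inj₁ X∈′ with ∈-map⁻ (move P) {xs = full} X∈′
    ...   | (a , b) , _ , refl = %-bound (proj₁ P ℕ.+ a) n-1 , %-bound (proj₂ P ℕ.+ b) n-1

    pt-injective : ∀ {X Y} → proj₁ X < n × proj₂ X < n → proj₁ Y < n × proj₂ Y < n → pt X ≡ pt Y → X ≡ Y
    pt-injective (i<n , j<n) (i′<n , j′<n) eq = cong₂ _,_ (α-injective i<n i′<n (cong Vec3.x eq)) (α-injective j<n j′<n (cong Vec3.y eq))

    lookup-distinct : ∀ Xs → (∀ {X} → X ∈ Xs → proj₁ X < n × proj₂ X < n) → AllPairs _≢_ (map number Xs) →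
                      ∀ i j → i ≢ j → lookup (map pt Xs) i ≢ lookup (map pt Xs) j
    lookup-distinct (X ∷ Xs) bd (ps ∷ pairs) zero    zero    i≢j eq = i≢j refl
    lookup-distinct (X ∷ Xs) bd (ps ∷ pairs) zero    (suc j) i≢j eq with ∈-map⁻ pt {xs = Xs} (∈-lookup {xs = map pt Xs} j)
    ... | Y , Y∈ , eq′ = All.lookup ps (∈-map⁺ number Y∈) (cong number (pt-injective (bd (here refl)) (bd (there Y∈)) (trans eq eq′)))
    lookup-distinct (X ∷ Xs) bd (ps ∷ pairs) (suc i) zero    i≢j eq with ∈-map⁻ pt {xs = Xs} (∈-lookup {xs = map pt Xs} i)
    ... | Y , Y∈ , eq′ = All.lookup ps (∈-map⁺ number Y∈) (cong number (pt-injective (bd (here refl)) (bd (there Y∈)) (trans (sym eq) eq′)))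
    lookup-distinct (X ∷ Xs) bd (ps ∷ pairs) (suc i) (suc j) i≢j eq = lookup-distinct Xs (bd ∘ there) pairs i j (i≢j ∘ cong suc) eq

    same-point : ∀ {P Q} → Vec3.z P ≡ 1F → Vec3.z Q ≡ 1F → SamePoint P Q → P ≡ Q
    same-point {⟨ x , y , _ ⟩} refl refl (c , _ , x≡ , y≡ , 1≡) = vec-cong (strip x≡) (strip y≡) refl
      where
      strip : ∀ {x x′} → x′ ≡ c * x → x ≡ x′
      strip {x} x′≡ = sym (trans x′≡ (trans (cong (_* x) (trans (sym (*-identityʳ c)) (sym 1≡))) (*-identityˡ x)))

    -- A point added to the arc would be collinear with two distinct points of it, against `noThree`
    -- for position 0 and their two positions.
    complete : ∀ {ls} → scan Ps ≡ just ls → AllPairs _≢_ (map number (orbits Ps)) → (∀ P → NonZero3 P → Cov P) → IsCompleteArc A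
    complete scanned pairs cov = arc , maximal
      where
      z≡1 : ∀ i → Vec3.z (lookup A i) ≡ 1F
      z≡1 i = pts-z Ps (∈-lookup i)
      distinct-points : ∀ i j → i ≢ j → lookup A i ≢ lookup A j
      distinct-points = lookup-distinct (orbits Ps) (orbits-bound Ps) pairs
      arc : IsArc A
      arc = record
        { points   = λ i (_ , _ , z≡0) → 0≢1 (trans (sym z≡0) (z≡1 i))
        ; distinct = λ i j i≢j same → distinct-points i j i≢j (same-point (z≡1 i) (z≡1 j) same)
        ; noThree  = λ i j k i≢j i≢k j≢k → scan-noThree full-closed Ps scanned (∈-lookup i) (∈-lookup j) (∈-lookup k)
                       (distinct-points i j i≢j) (distinct-points i k i≢k) (distinct-points j k j≢k) }
      maximal : ∀ P → ¬ IsArc (P ∷ A)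
      maximal P arc′ with cov P (IsArc.points arc′ zero)
      ... | Q , R , Q∈ , R∈ , Q≢R , col = IsArc.noThree arc′ zero (suc (index Q∈)) (suc (index R∈)) (λ ()) (λ ())
        (λ eq → Q≢R (trans (lookup-index Q∈) (trans (cong (lookup A) (Fin.suc-injective eq)) (sym (lookup-index R∈)))))
        (subst₂ (Collinear P) (lookup-index Q∈) (lookup-index R∈) col)

-- From a successful check to a complete arc; the plane of order 2.

module Soundness where

  open Numerals
  open Fields
  open Logarithms
  open Certificates
  open Geometry
  open Coverings
  open import Data.Bool.Base using (true; _∧_; _∨_)
  open import Data.Empty using (⊥; ⊥-elim)
  open import Data.Fin.Base using (Fin; zero; suc)
  open import Data.Fin.Patterns using (0F; 1F; 2F; 3F; 4F)
  import Data.Fin.Properties as Fin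
  open import Data.List.Base using (List; []; _∷_; _++_; length; map; lookup)
  open import Data.List.Membership.Propositional using (_∈_)
  open import Data.List.Membership.Propositional.Properties using (∈-map⁺)
  open import Data.List.Properties using (length-map; length-++)
  open import Data.List.Relation.Unary.All using (All; []; _∷_)
  open import Data.List.Relation.Unary.Any using (here; there)
  open import Data.Maybe.Base using (just)
  open import Data.Nat.Base using (ℕ; zero; suc; _≤_; _<_; z≤n; s≤s; _≡ᵇ_)
  import Data.Nat.Base as ℕ
  import Data.Nat.Properties as ℕ
  open import Data.Product.Base using (∃-syntax; _×_; _,_; proj₁; proj₂)
  open import Data.Sum.Base using (_⊎_; inj₁; inj₂)
  open import Relation.Binary.PropositionalEquality
  open import Relation.Nullary using (¬_; Dec; yes; no)
  open import Relation.Nullary.Decidable using (_×-dec_; _⊎-dec_; from-yes)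

  length-decode : ∀ n-1 k N → length (decode n-1 k N) ≡ k
  length-decode n-1 zero    N = refl
  length-decode n-1 (suc k) N = cong suc (length-decode n-1 k _)

  length-orbits : ∀ n-1 ss Ps → length (Shifts.orbits n-1 ss Ps) ≡ length Ps ℕ.* suc (length ss)
  length-orbits n-1 ss []       = refl
  length-orbits n-1 ss (P ∷ Ps) = trans (length-++ (map (Shifts.move n-1 ss P) ((0 , 0) ∷ ss)))
    (cong₂ ℕ._+_ (length-map (Shifts.move n-1 ss P) ((0 , 0) ∷ ss)) (length-orbits n-1 ss Ps))

  module Rooted (c : Certificate) (ms : List ℕ) (ok : Check.check′ c ms ≡ true) (F : FiniteField (suc (suc (Certificate.n-1 c))))
                (p≡0 : Field.num F (suc (Certificate.p-1 c)) ≡ FiniteField.0F F)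
                (period : Residues.power (Certificate.p-1 c) (Certificate.r c) (suc (Certificate.n-1 c)) (Residues.constant (Certificate.p-1 c) (Certificate.r c) 1)
                          ≡ Residues.constant (Certificate.p-1 c) (Certificate.r c) 1)
                {α : Fin (suc (suc (Certificate.n-1 c)))} (α-root : Roots.Root F (Certificate.p-1 c) (Certificate.r c) p≡0 α) where
    open Certificate c
    open Lattice lattice
    open Check c hiding (ms)
    open Residues p-1 r using (constant; timesX)

    private
      logTree : Tree (Residue m × ℕ)
      logTree = Tb.logs ms n 0 (constant 1) empty

      parts₁ = ∧-true {fieldOK} {latticeOK ∧ pointsOK ∧ logsOK ms logTree} ok
      parts₂ = ∧-true {latticeOK} {pointsOK ∧ logsOK ms logTree} (proj₂ parts₁)
      parts₃ = ∧-true {pointsOK} {logsOK ms logTree} (proj₂ parts₂)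

      module R = Roots F p-1 r p≡0
      module L = R.Logarithms ms {α} α-root
      open Field F using (_^_; +-identityʳ; +-cancelˡ; ^-nonzero; zeroˡ; 0≢1)
      open FiniteField F using () renaming (0F to 𝟎; 1F to 𝟏)
      open FiniteField F using () renaming (_+_ to infixl 6 _⊕_; _*_ to infixl 7 _⊗_)

      α^n≡1 : α ^ n ≡ 𝟏
      α^n≡1 = trans (cong (α ^_) (sym (ℕ.+-identityʳ n))) (trans (sym (L.ev-power n (constant 1) 0 (R.ev-1 α))) (trans (cong (R.ev α) period) (R.ev-1 α)))

      α≢0 : α ≢ 𝟎
      α≢0 α≡0 = 0≢1 (trans (sym (zeroˡ (α ^ n-1))) (trans (cong (_⊗ α ^ n-1) (sym α≡0)) α^n≡1))

      logEntries : Entries ms L.Log logTree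
      logEntries = L.logs-sound n 0 (constant 1) (R.ev-1 α) empty

      matches-sound : ∀ f Ps → matches f Ps ≡ true → ∃[ P ] (P ∈ Ps × f P ≡ true)
      matches-sound f (P ∷ Ps) eq with ∨-true {f P} eq
      ... | inj₁ fP = P , here refl , fP
      ... | inj₂ eq′ with matches-sound f Ps eq′
      ...   | Q , Q∈ , fQ = Q , there Q∈ , fQ

      1+α^μ : ∀ {μ} → Tb.log ms logTree (constant p-1) ≡ just μ → 𝟏 ⊕ α ^ μ ≡ 𝟎
      1+α^μ eq = trans (cong (𝟏 ⊕_) (trans (sym (L.log-sound (constant p-1) logEntries eq)) (R.ev-constant α {m} p-1))) p≡0

    module _ {z : Tree ℕ} (eqz : Tb.zechs ms logTree n-1 1 (timesX (constant 1)) empty ≡ just z) where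
      private
        zech = L.zechs-sound n-1 1 (timesX (constant 1)) logEntries (L.step (constant 1) 0 (R.ev-1 α)) empty eqz

        -- A Zech logarithm e of d gives α^d = 1 + α^e with α^e nonzero, hence α^d differs from 1.
        -- The table having an entry for every d below n thus proves α primitive.
        order : ∀ d → 0 < d → d < suc n-1 → α ^ d ≢ 𝟏
        order (suc d) _ (s≤s d<n) α^d≡1 with proj₂ zech d d<n
        ... | e , eq = ^-nonzero α≢0 e (+-cancelˡ 𝟏 (trans (sym eq) (trans (cong (α ^_) (ℕ.+-comm d 1)) (trans α^d≡1 (sym (+-identityʳ 𝟏))))))

        module G = Generated F α^n≡1 order
        module S = G.Scanned ms z shifts (proj₁ zech)

        lattice₁ = ∧-true {Shifts.closed n-1 shifts full full} (proj₁ parts₂)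
        lattice₂ = ∧-true {Shifts.member n-1 shifts (suc w₁-1 %1+ n-1 , τ %1+ n-1) full} (proj₂ lattice₁)
        lattice₃ = ∧-true {Shifts.member n-1 shifts (0 , suc w₂-1 %1+ n-1) full} (proj₂ lattice₂)
        lattice₄ = ∧-true {(σ ℕ.+ τ) %1+ n-1 ≡ᵇ 0} (proj₂ lattice₃)
        lattice₅ = ∧-true {matches (λ (a , b) → a ≡ᵇ suc πx-1 %1+ n-1) full} (proj₂ lattice₄)
        lattice₆ = ∧-true {matches (λ (a , b) → b ≡ᵇ suc πy-1 %1+ n-1) full} (proj₂ lattice₅)

        full-closed : ∀ {s t} → s ∈ full → t ∈ full → Shifts.move n-1 shifts s t ∈ full
        full-closed = S.closed-sound full (proj₁ lattice₁)

        module C = Covering F α^n≡1 order ms z shifts (proj₁ zech) full-closed reps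

        shiftX = matches-sound (λ (a , b) → a ≡ᵇ suc πx-1 %1+ n-1) full (proj₁ lattice₅)
        shiftY = matches-sound (λ (a , b) → b ≡ᵇ suc πy-1 %1+ n-1) full (proj₁ lattice₆)
        shiftD = matches-sound (λ (a , b) → b ≡ᵇ (a ℕ.+ suc πd-1) %1+ n-1) full (proj₂ lattice₆)

      module _ {μ ls} (eqμ : Tb.log ms logTree (constant p-1) ≡ just μ) (eqs : Sc.scan ms z reps ≡ just ls)
               (lines-ok : linesOK ms μ z (just ls) ≡ true) where
        private
          bits-n = bits 20 n
          lv = Radix.levels 1 bits-n 1 2 []
          lines₁ = ∧-true {axesOK μ ls lv} lines-ok
          axes₁ = ∧-true {circle 1 lv (suc πx-1) (Ex.axisX μ ls)} (proj₁ lines₁)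
          axes₂ = ∧-true {circle 1 lv (suc πy-1) (Ex.axisY ls)} (proj₂ axes₁)
          axes₃ = ∧-true {circle 1 lv (suc πd-1) (Ex.infinity ls)} (proj₂ axes₂)
          axes₄ = ∧-true {Ex.hasVertical ls} (proj₂ axes₃)
          axes₅ = ∧-true {Ex.hasHorizontal ls} (proj₂ axes₄)

          Bs : All (S.Bisects C.A) ls
          Bs = S.scan-Bisects full-closed reps (∈-map⁺ G.pt) eqs

          cov : ∀ P → Plane.NonZero3 F P → C.Cov P
          cov = C.covered
            (C.torus-covered lattice (S.member-sound _ full (proj₁ lattice₂)) (S.member-sound _ full (proj₁ lattice₃))
              (ℕ.≡ᵇ⇒≡ _ 0 (if-true (proj₁ lattice₄))) _ κ β f Bs (proj₂ lines₁))
            (C.Axes.axisX-covered lattice (proj₁ (proj₂ shiftX)) (ℕ.≡ᵇ⇒≡ _ _ (if-true (proj₂ (proj₂ shiftX)))) (1+α^μ eqμ) bits-n Bs (proj₁ axes₁))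
            (C.Axes.axisY-covered lattice (proj₁ (proj₂ shiftY)) (ℕ.≡ᵇ⇒≡ _ _ (if-true (proj₂ (proj₂ shiftY)))) bits-n Bs (proj₁ axes₂))
            (C.Axes.infinity-covered lattice (proj₁ (proj₂ shiftD)) (ℕ.≡ᵇ⇒≡ _ _ (if-true (proj₂ (proj₂ shiftD)))) bits-n Bs (proj₁ axes₃))
            (C.Axes.hasVertical-sound lattice Bs (proj₁ axes₄))
            (C.Axes.hasHorizontal-sound lattice Bs (proj₁ axes₅))
            (C.Axes.hasDiagonal-sound lattice Bs (proj₂ axes₅))

        arc : ∃[ A ] (Plane.IsCompleteArc F A × length A ≡ size)
        arc = C.A , C.complete eqs (proj₁ (distinct-sound (thresholds (bits 30 (n ℕ.* n))) _ empty (proj₁ parts₃))) cov ,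
          trans (length-map G.pt (Shifts.orbits n-1 shifts reps))
            (trans (length-orbits n-1 shifts reps) (cong (ℕ._* suc (length shifts)) (length-decode n-1 count N)))

    completeArc : ∃[ A ] (Plane.IsCompleteArc F A × length A ≡ size)
    completeArc = byTables _ _ refl refl (proj₂ parts₃)
      where
      byLines : ∀ {μ z} mls → Tb.log ms logTree (constant p-1) ≡ just μ → Tb.zechs ms logTree n-1 1 (timesX (constant 1)) empty ≡ just z →
                Sc.scan ms z reps ≡ mls → linesOK ms μ z mls ≡ true → ∃[ A ] (Plane.IsCompleteArc F A × length A ≡ size)
      byLines (just ls) eqμ eqz eqs ok = arc eqz eqμ eqs ok
      byTables : ∀ mμ mz → Tb.log ms logTree (constant p-1) ≡ mμ → Tb.zechs ms logTree n-1 1 (timesX (constant 1)) empty ≡ mz →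
                 tablesOK ms mμ mz ≡ true → ∃[ A ] (Plane.IsCompleteArc F A × length A ≡ size)
      byTables (just μ) (just z) eqμ eqz ok = byLines _ eqμ eqz refl ok

  module Certified (c : Certificate) (ok : Check.check c ≡ true) (F : FiniteField (suc (suc (Certificate.n-1 c)))) where
    open Certificate c
    open Check c
    open Residues p-1 r using (power; constant; same; same-sound)

    private
      field-ok = ∧-true {suc p-1 ℕ.^ suc m ≡ᵇ suc n} {same (power n (constant 1)) (constant 1)} (proj₁ (∧-true {fieldOK} ok))

      p≡0 : Field.num F (suc p-1) ≡ FiniteField.0F F
      p≡0 = Field.num-char F (suc p-1) (suc m) (sym (ℕ.≡ᵇ⇒≡ (suc p-1 ℕ.^ suc m) (suc n) (if-true (proj₁ field-ok))))

      period : power n (constant 1) ≡ constant 1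
      period = same-sound _ _ (proj₂ field-ok)

    completeArc : ∃[ A ] (Plane.IsCompleteArc F A × length A ≡ size)
    completeArc = Rooted.completeArc c ms ok F p≡0 period (proj₂ (Roots.root F p-1 r p≡0 period (s≤s z≤n)))

  -- The torus is a single point here, so the arc consists of the three vertices and the unit point.
  module Fano (F : FiniteField 2) where
    open Field F hiding (0F; 1F)
    open FiniteField F using () renaming (0F to 𝟎; 1F to 𝟏)
    open Plane F

    two : (a b x : Fin 2) → a ≢ b → x ≢ a → x ≡ b
    two zero       zero       _          a≢b _   = ⊥-elim (a≢b refl)
    two (suc zero) (suc zero) _          a≢b _   = ⊥-elim (a≢b refl)
    two zero       (suc zero) zero       _   x≢a = ⊥-elim (x≢a refl)
    two zero       (suc zero) (suc zero) _   _   = refl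
    two (suc zero) zero       zero       _   _   = refl
    two (suc zero) zero       (suc zero) _   x≢a = ⊥-elim (x≢a refl)

    frame : List Vec3
    frame = ⟨ 𝟏 , 𝟎 , 𝟎 ⟩ ∷ ⟨ 𝟎 , 𝟏 , 𝟎 ⟩ ∷ ⟨ 𝟎 , 𝟎 , 𝟏 ⟩ ∷ ⟨ 𝟏 , 𝟏 , 𝟏 ⟩ ∷ []

    -- The equation that a frame point imposes on the coordinates of a line through it; any three of
    -- the four force all coordinates to vanish.
    Fact : Vec3 → Fin 4 → Set
    Fact ⟨ l , m , k ⟩ 0F = l ≡ 𝟎
    Fact ⟨ l , m , k ⟩ 1F = m ≡ 𝟎
    Fact ⟨ l , m , k ⟩ 2F = k ≡ 𝟎
    Fact ⟨ l , m , k ⟩ 3F = l + (m + k) ≡ 𝟎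

    fact : ∀ L i → Incident L (lookup frame i) → Fact L i
    fact ⟨ l , m , k ⟩ 0F eq = trans (solve 3 (λ l m k → l := l :* con 1 :+ (m :* con 0 :+ k :* con 0)) refl l m k) eq
    fact ⟨ l , m , k ⟩ 1F eq = trans (solve 3 (λ l m k → m := l :* con 0 :+ (m :* con 1 :+ k :* con 0)) refl l m k) eq
    fact ⟨ l , m , k ⟩ 2F eq = trans (solve 3 (λ l m k → k := l :* con 0 :+ (m :* con 0 :+ k :* con 1)) refl l m k) eq
    fact ⟨ l , m , k ⟩ 3F eq = trans (solve 3 (λ l m k → l :+ (m :+ k) := l :* con 1 :+ (m :* con 1 :+ k :* con 1)) refl l m k) eq

    Among : (i j k r : Fin 4) → Set
    Among i j k r = r ≡ i ⊎ r ≡ j ⊎ r ≡ k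

    -- Distinct indices exhaust one of the four three-element subsets; phrased by membership, this
    -- makes four cases of 24 orderings.
    Triple : (i j k : Fin 4) → Set
    Triple i j k = i ≡ j ⊎ i ≡ k ⊎ j ≡ k ⊎ (Among i j k 0F × Among i j k 1F × Among i j k 2F)
      ⊎ (Among i j k 0F × Among i j k 1F × Among i j k 3F) ⊎ (Among i j k 0F × Among i j k 2F × Among i j k 3F)
      ⊎ (Among i j k 1F × Among i j k 2F × Among i j k 3F)

    among? : ∀ i j k r → Dec (Among i j k r)
    among? i j k r = (r Fin.≟ i) ⊎-dec (r Fin.≟ j) ⊎-dec (r Fin.≟ k)

    triple? : ∀ i j k → Dec (Triple i j k)
    triple? i j k = (i Fin.≟ j) ⊎-dec (i Fin.≟ k) ⊎-dec (j Fin.≟ k) ⊎-dec (a 0F ×-dec a 1F ×-dec a 2F)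
      ⊎-dec (a 0F ×-dec a 1F ×-dec a 3F) ⊎-dec (a 0F ×-dec a 2F ×-dec a 3F) ⊎-dec (a 1F ×-dec a 2F ×-dec a 3F)
      where
      a : ∀ r → Dec (Among i j k r)
      a = among? i j k

    triples : ∀ i j k → Triple i j k
    triples = from-yes (Fin.all? λ i → Fin.all? λ j → Fin.all? λ k → triple? i j k)

    frame-noThree : ∀ i j k → i ≢ j → i ≢ k → j ≢ k → ¬ Collinear (lookup frame i) (lookup frame j) (lookup frame k)
    frame-noThree i j k i≢j i≢k j≢k (L@(⟨ l , m , c ⟩) , L≢0 , p , q , r) = case (triples i j k)
      where
      pick : ∀ {s} → Among i j k s → Fact L s
      pick (inj₁ refl)        = fact L i p
      pick (inj₂ (inj₁ refl)) = fact L j q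
      pick (inj₂ (inj₂ refl)) = fact L k r
      case : Triple i j k → ⊥
      case (inj₁ i≡j) = i≢j i≡j
      case (inj₂ (inj₁ i≡k)) = i≢k i≡k
      case (inj₂ (inj₂ (inj₁ j≡k))) = j≢k j≡k
      case (inj₂ (inj₂ (inj₂ (inj₁ (a , b , d))))) = L≢0 (pick a , pick b , pick d)
      case (inj₂ (inj₂ (inj₂ (inj₂ (inj₁ (a , b , d)))))) = L≢0 (pick a , pick b ,
        trans (sym (trans (cong₂ _+_ (pick a) (trans (cong (_+ c) (pick b)) (+-identityˡ c))) (+-identityˡ c))) (pick d))
      case (inj₂ (inj₂ (inj₂ (inj₂ (inj₂ (inj₁ (a , b , d))))))) = L≢0 (pick a ,
        trans (sym (trans (cong₂ _+_ (pick a) (trans (cong (m +_) (pick b)) (+-identityʳ m))) (+-identityˡ m))) (pick d) , pick b)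
      case (inj₂ (inj₂ (inj₂ (inj₂ (inj₂ (inj₂ (a , b , d))))))) = L≢0 (
        trans (sym (trans (cong (l +_) (trans (cong₂ _+_ (pick a) (pick b)) (+-identityˡ 𝟎))) (+-identityʳ l))) (pick d) , pick a , pick b)

    frame-distinct : ∀ i j → i ≢ j → ¬ SamePoint (lookup frame i) (lookup frame j)
    frame-distinct i j i≢j (c , c≢0 , x≡ , y≡ , z≡) = case i j i≢j x≡ y≡ z≡
      where
      1≢c0 : 𝟏 ≢ c * 𝟎
      1≢c0 eq = 0≢1 (sym (trans eq (zeroʳ c)))
      0≢c1 : 𝟎 ≢ c * 𝟏
      0≢c1 eq = c≢0 (sym (trans eq (*-identityʳ c)))
      case : ∀ i j → i ≢ j → Vec3.x (lookup frame j) ≡ c * Vec3.x (lookup frame i) → Vec3.y (lookup frame j) ≡ c * Vec3.y (lookup frame i) →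
             Vec3.z (lookup frame j) ≡ c * Vec3.z (lookup frame i) → ⊥
      case 0F 0F i≢j _ _ _ = i≢j refl
      case 1F 1F i≢j _ _ _ = i≢j refl
      case 2F 2F i≢j _ _ _ = i≢j refl
      case 3F 3F i≢j _ _ _ = i≢j refl
      case 0F 1F _ _ y≡ _ = 1≢c0 y≡
      case 0F 2F _ _ _ z≡ = 1≢c0 z≡
      case 0F 3F _ _ y≡ _ = 1≢c0 y≡
      case 1F 0F _ x≡ _ _ = 1≢c0 x≡
      case 1F 2F _ _ _ z≡ = 1≢c0 z≡
      case 1F 3F _ x≡ _ _ = 1≢c0 x≡
      case 2F 0F _ x≡ _ _ = 1≢c0 x≡
      case 2F 1F _ _ y≡ _ = 1≢c0 y≡
      case 2F 3F _ x≡ _ _ = 1≢c0 x≡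
      case 3F 0F _ _ y≡ _ = 0≢c1 y≡
      case 3F 1F _ x≡ _ _ = 0≢c1 x≡
      case 3F 2F _ x≡ _ _ = 0≢c1 x≡

    frame-maximal : ∀ P → ¬ IsArc (P ∷ frame)
    frame-maximal ⟨ x , y , z ⟩ arc with x ≟ 𝟎 | y ≟ 𝟎 | z ≟ 𝟎
    ... | yes refl | _ | _ = IsArc.noThree arc 0F 2F 3F (λ ()) (λ ()) (λ ())
      (⟨ 𝟏 , 𝟎 , 𝟎 ⟩ , (λ (1≡0 , _) → 0≢1 (sym 1≡0)) ,
       solve 2 (λ y z → con 1 :* con 0 :+ (con 0 :* y :+ con 0 :* z) := con 0) refl y z ,
       solve 0 (con 1 :* con 0 :+ (con 0 :* con 1 :+ con 0 :* con 0) := con 0) refl ,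
       solve 0 (con 1 :* con 0 :+ (con 0 :* con 0 :+ con 0 :* con 1) := con 0) refl)
    ... | no _ | yes refl | _ = IsArc.noThree arc 0F 1F 3F (λ ()) (λ ()) (λ ())
      (⟨ 𝟎 , 𝟏 , 𝟎 ⟩ , (λ (_ , 1≡0 , _) → 0≢1 (sym 1≡0)) ,
       solve 2 (λ x z → con 0 :* x :+ (con 1 :* con 0 :+ con 0 :* z) := con 0) refl x z ,
       solve 0 (con 0 :* con 1 :+ (con 1 :* con 0 :+ con 0 :* con 0) := con 0) refl ,
       solve 0 (con 0 :* con 0 :+ (con 1 :* con 0 :+ con 0 :* con 1) := con 0) refl)
    ... | no _ | no _ | yes refl = IsArc.noThree arc 0F 1F 2F (λ ()) (λ ()) (λ ())
      (⟨ 𝟎 , 𝟎 , 𝟏 ⟩ , (λ (_ , _ , 1≡0) → 0≢1 (sym 1≡0)) ,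
       solve 2 (λ x y → con 0 :* x :+ (con 0 :* y :+ con 1 :* con 0) := con 0) refl x y ,
       solve 0 (con 0 :* con 1 :+ (con 0 :* con 0 :+ con 1 :* con 0) := con 0) refl ,
       solve 0 (con 0 :* con 0 :+ (con 0 :* con 1 :+ con 1 :* con 0) := con 0) refl)
    -- No coordinate vanishes, so over two elements x = y = 1, and P lies on the line x = y through
    -- (0 : 0 : 1) and (1 : 1 : 1).
    ... | no x≢0 | no y≢0 | no _ with two 𝟎 𝟏 x 0≢1 x≢0 | two 𝟎 𝟏 y 0≢1 y≢0
    ...   | refl | refl = IsArc.noThree arc 0F 3F 4F (λ ()) (λ ()) (λ ())
      (⟨ 𝟏 , - 𝟏 , 𝟎 ⟩ , (λ (1≡0 , _) → 0≢1 (sym 1≡0)) ,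
       trans (solve 2 (λ m z → con 1 :* con 1 :+ (m :* con 1 :+ con 0 :* z) := con 1 :+ m) refl (- 𝟏) z) (-‿inverseʳ 𝟏) ,
       solve 1 (λ m → con 1 :* con 0 :+ (m :* con 0 :+ con 0 :* con 1) := con 0) refl (- 𝟏) ,
       trans (solve 1 (λ m → con 1 :* con 1 :+ (m :* con 1 :+ con 0 :* con 1) := con 1 :+ m) refl (- 𝟏)) (-‿inverseʳ 𝟏))

    frame-points : ∀ i → NonZero3 (lookup frame i)
    frame-points 0F (1≡0 , _)     = 0≢1 (sym 1≡0)
    frame-points 1F (_ , 1≡0 , _) = 0≢1 (sym 1≡0)
    frame-points 2F (_ , _ , 1≡0) = 0≢1 (sym 1≡0)
    frame-points 3F (1≡0 , _)     = 0≢1 (sym 1≡0)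

    frame-complete : IsCompleteArc frame
    frame-complete = record { points = frame-points ; distinct = frame-distinct ; noThree = frame-noThree } , frame-maximal

-- Prime powers and the thirteen inequalities.

module Bounds where

  open Numerals
  open Certificates
  open Geometry using (∨-true)
  open Soundness
  open import Data.Bool.Base using (Bool; true; false; if_then_else_; _∧_; _∨_; not; T)
  open import Data.Bool.ListAction using (any; all)
  open import Data.Empty using (⊥-elim)
  open import Data.List.Base using (List; []; _∷_; map)
  open import Data.List.Membership.Propositional using (_∈_)
  open import Data.List.Relation.Unary.All using (All; []; _∷_)
  import Data.List.Relation.Unary.All as All
  open import Data.List.Relation.Unary.Any using (here; there)
  open import Data.Nat.Base
  open import Data.Nat.Coprimality using (Coprime; coprime-divisor)
  open import Data.Nat.Divisibility using (_∣_; _∣?_; ∣-trans; ∣1⇒≡1; m%n≡0⇒n∣m; ∣m+n∣m⇒∣n; ∣n⇒∣m*n)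
  open import Data.Nat.Primality using (Prime; prime⇒irreducible; ¬prime[1])
  open import Data.Nat.Properties
  open import Data.Product.Base using (∃-syntax; _×_; _,_; proj₁; proj₂)
  open import Data.Sum.Base using (_⊎_; inj₁; inj₂)
  open import Relation.Binary.PropositionalEquality
  open import Relation.Nullary using (¬_; yes; no)

  divisor-of-prime-power : ∀ {p} → Prime p → ∀ k {d} → d ∣ p ^ k → d ≡ 1 ⊎ p ∣ d
  divisor-of-prime-power p-prime zero d∣1 = inj₁ (∣1⇒≡1 d∣1)
  divisor-of-prime-power {p} p-prime (suc k) {d} d∣ with p ∣? d
  ... | yes p∣d = inj₂ p∣d
  ... | no  p∤d = divisor-of-prime-power p-prime k (coprime-divisor coprime d∣)
    where
    coprime : Coprime d p
    coprime {i} (i∣d , i∣p) with prime⇒irreducible p-prime i∣p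
    ... | inj₁ i≡1  = i≡1
    ... | inj₂ refl = ⊥-elim (p∤d i∣d)

  strip : ℕ → ℕ → ℕ → ℕ
  strip zero       d-1 q = q
  strip (suc fuel) d-1 q = if q %1+ d-1 ≡ᵇ 0 then strip fuel d-1 (q /1+ d-1) else q

  -- Searches for a y with d dividing 1 + y m, a Bezout identity that shows d and m coprime.
  bezout : ℕ → ℕ → ℕ → Bool
  bezout d-1 m zero    = false
  bezout d-1 m (suc y) = ((1 + y * m) %1+ d-1 ≡ᵇ 0) ∨ bezout d-1 m y

  coprimeDivisors′ : ℕ → ℕ → ℕ → Bool
  coprimeDivisors′ q d-1 zero      = false
  coprimeDivisors′ q d-1 (suc m-1) = (0 <ᵇ d-1) ∧ (0 <ᵇ m-1) ∧ (q %1+ d-1 ≡ᵇ 0) ∧ (q %1+ m-1 ≡ᵇ 0) ∧ bezout d-1 (suc m-1) (suc d-1)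

  -- The cofactor left after removing all factors d serves as second divisor. Ten divisions suffice,
  -- since the numbers to be excluded are below 2^10.
  coprimeDivisors : ℕ → ℕ → Bool
  coprimeDivisors q d-1 = coprimeDivisors′ q d-1 (strip 10 d-1 q)

  bezout-sound : ∀ {p} → Prime p → ∀ d-1 m y → p ∣ suc d-1 → p ∣ m → bezout d-1 m y ≢ true
  bezout-sound {p} p-prime d-1 m (suc y) p∣d p∣m eq with ∨-true {(1 + y * m) %1+ d-1 ≡ᵇ 0} eq
  ... | inj₂ eq′ = bezout-sound p-prime d-1 m y p∣d p∣m eq′
  ... | inj₁ eq′ = ¬prime[1] (subst Prime (∣1⇒≡1 p∣1) p-prime)
    where
    p∣1 : p ∣ 1
    p∣1 = ∣m+n∣m⇒∣n (subst (p ∣_) (+-comm 1 (y * m))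
            (∣-trans p∣d (m%n≡0⇒n∣m (1 + y * m) (suc d-1) (≡ᵇ⇒≡ _ 0 (if-true eq′))))) (∣n⇒∣m*n y p∣m)

  coprimeDivisors-sound : ∀ q d-1 → coprimeDivisors q d-1 ≡ true → ¬ IsPrimePower q
  coprimeDivisors-sound q d-1 eq (p , e , p-prime , q≡) with strip 10 d-1 q
  ... | suc m-1 = bezout-sound p-prime d-1 (suc m-1) (suc d-1) (divides (suc d-1) (nontrivial d-1 (proj₁ c₁)) (proj₁ c₃))
                    (divides (suc m-1) (nontrivial m-1 (proj₁ c₂)) (proj₁ c₄)) (proj₂ c₄)
    where
    c₁ = ∧-true {0 <ᵇ d-1} eq
    c₂ = ∧-true {0 <ᵇ m-1} (proj₂ c₁)
    c₃ = ∧-true {q %1+ d-1 ≡ᵇ 0} (proj₂ c₂)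
    c₄ = ∧-true {q %1+ m-1 ≡ᵇ 0} (proj₂ c₃)
    nontrivial : ∀ k → (0 <ᵇ k) ≡ true → suc k ≢ 1
    nontrivial (suc _) _ ()
    divides : ∀ d → d ≢ 1 → .{{_ : NonZero d}} → (q % d ≡ᵇ 0) ≡ true → p ∣ d
    divides d d≢1 eq with divisor-of-prime-power p-prime (suc e) {d} (subst (d ∣_) q≡ (m%n≡0⇒n∣m q d (≡ᵇ⇒≡ _ 0 (if-true eq))))
    ... | inj₁ d≡1 = ⊥-elim (d≢1 d≡1)
    ... | inj₂ p∣d = p∣d

  -- For q in [lo , hi] or in others: t + c < (a / b) √q, or ≤ if not strict.
  record Claim : Set where
    constructor claim
    field
      lo hi  : ℕ
      others : List ℕ
      c a b  : ℕ
      strict : Bool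

  Compare : Bool → ℕ → ℕ → ℕ → ℕ → Set
  Compare true  t a b q = t <[ a / b ]√ q
  Compare false t a b q = t ≤[ a / b ]√ q

  Meaning : ℕ → ℕ → Claim → Set
  Meaning q t (claim lo hi others c a b strict) = (q ∈[ lo , hi ] ⊎ q ∈ others) → Compare strict (t + c) a b q

  compareᵇ : Bool → ℕ → ℕ → ℕ → ℕ → Bool
  compareᵇ true  t a b q = (b * b) * (t * t) <ᵇ (a * a) * q
  compareᵇ false t a b q = (b * b) * (t * t) ≤ᵇ (a * a) * q

  compare-sound : ∀ strict {t k} a b q → t ≤ k → compareᵇ strict k a b q ≡ true → Compare strict t a b q
  compare-sound true  a b q t≤k ok = ≤-<-trans (*-monoʳ-≤ (b * b) (*-mono-≤ t≤k t≤k)) (<ᵇ⇒< _ _ (if-true ok))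
  compare-sound false a b q t≤k ok = ≤-trans (*-monoʳ-≤ (b * b) (*-mono-≤ t≤k t≤k)) (≤ᵇ⇒≤ _ _ (if-true ok))

  applies : ℕ → Claim → Bool
  applies q (claim lo hi others c a b strict) = ((lo ≤ᵇ q) ∧ (q ≤ᵇ hi)) ∨ any (q ≡ᵇ_) others

  holds : ℕ → ℕ → Claim → Bool
  holds q k cl@(claim lo hi others c a b strict) = if applies q cl then compareᵇ strict (k + c) a b q else true

  T-true : ∀ {b} → T b → b ≡ true
  T-true {true} _ = refl

  any-∈ : ∀ {q l} → q ∈ l → any (q ≡ᵇ_) l ≡ true
  any-∈ {q} (here refl) rewrite T-true (≡⇒≡ᵇ q q refl) = refl
  any-∈ {q} {x ∷ _} (there q∈) with q ≡ᵇ x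
  ... | true  = refl
  ... | false = any-∈ q∈

  applies-complete : ∀ q lo hi l c a b s → q ∈[ lo , hi ] ⊎ q ∈ l → applies q (claim lo hi l c a b s) ≡ true
  applies-complete q lo hi l c a b s (inj₁ (lo≤q , q≤hi))
    rewrite T-true (≤⇒≤ᵇ lo≤q) | T-true (≤⇒≤ᵇ q≤hi) = refl
  applies-complete q lo hi l c a b s (inj₂ q∈) with (lo ≤ᵇ q) ∧ (q ≤ᵇ hi)
  ... | true  = refl
  ... | false = any-∈ q∈

  holds-sound : ∀ {q t k} cl → t ≤ k → holds q k cl ≡ true → Meaning q t cl
  holds-sound {q} {t} {k} (claim lo hi l c a b s) t≤k ok h
    rewrite applies-complete q lo hi l c a b s h = compare-sound s a b q (+-monoˡ-≤ c t≤k) ok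

  all-sound : ∀ {A : Set} (f : A → Bool) xs → all f xs ≡ true → All (λ x → f x ≡ true) xs
  all-sound f []       ok = []
  all-sound f (x ∷ xs) ok = proj₁ (∧-true ok) ∷ all-sound f xs (proj₂ (∧-true {f x} ok))

  squares : List ℕ
  squares = 961 ∷ 1024 ∷ 1369 ∷ 1681 ∷ 2401 ∷ []

  claims : List Claim
  claims =
    claim 2 841 squares 0 4 1 true ∷
    claim 2 89 (101 ∷ []) 0 3 1 false ∷
    claim 2 277 [] 0 7 2 true ∷
    claim 2 509 (521 ∷ 523 ∷ 529 ∷ 601 ∷ 661 ∷ []) 0 19 5 true ∷
    claim 37 211 (23 ∷ 227 ∷ 229 ∷ 233 ∷ 241 ∷ 243 ∷ 256 ∷ 257 ∷ 661 ∷ []) 9 4 1 false ∷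
    claim 23 307 (317 ∷ 343 ∷ 601 ∷ 661 ∷ []) 8 4 1 false ∷
    claim 19 353 (16 ∷ 361 ∷ 373 ∷ 383 ∷ 601 ∷ 661 ∷ []) 7 4 1 false ∷
    claim 9 409 (421 ∷ 431 ∷ 433 ∷ 443 ∷ 463 ∷ 601 ∷ 661 ∷ []) 6 4 1 false ∷
    claim 8 499 (509 ∷ 521 ∷ 523 ∷ 529 ∷ 601 ∷ 661 ∷ []) 5 4 1 false ∷
    claim 7 557 (569 ∷ 577 ∷ 601 ∷ 625 ∷ 661 ∷ 729 ∷ 841 ∷ squares) 4 4 1 false ∷
    claim 7 641 (661 ∷ 729 ∷ 841 ∷ squares) 3 4 1 true ∷
    claim 3 691 (709 ∷ 729 ∷ 841 ∷ squares) 2 4 1 false ∷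
    claim 2 761 (841 ∷ squares) 1 4 1 true ∷ []

  -- The union of all ranges in `claims`, as `within` verifies below; for other q every claim is
  -- vacuous.
  relevant : ℕ → Bool
  relevant q = ((2 ≤ᵇ q) ∧ (q ≤ᵇ 841)) ∨ any (q ≡ᵇ_) squares

  order : Certificate → ℕ
  order c = suc (suc (Certificate.n-1 c))

  valid : Certificate → Bool
  valid c = Check.check c ∧ all (holds (order c) (Check.size c)) claims

  listed : List Certificate → ℕ → Bool
  listed cs q = any (λ c → q ≡ᵇ order c) cs

  listed-sound : ∀ cs q → listed cs q ≡ true → ∃[ c ] (c ∈ cs × q ≡ order c)
  listed-sound (c ∷ cs) q ok with ∨-true {q ≡ᵇ order c} ok
  ... | inj₁ eq = c , here refl , ≡ᵇ⇒≡ q (order c) (if-true eq)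
  ... | inj₂ ok′ with listed-sound cs q ok′
  ...   | d , d∈ , eq = d , there d∈ , eq

  candidate : List Certificate → ℕ → Bool
  -- The listed numbers are d - 1 for the primes d up to 29 = √841, one of which divides every
  -- composite number up to 841.
  candidate cs q = (q ≡ᵇ 2) ∨ listed cs q ∨ any (coprimeDivisors q) (1 ∷ 2 ∷ 4 ∷ 6 ∷ 10 ∷ 12 ∷ 16 ∷ 18 ∷ 22 ∷ 28 ∷ [])

  allBelow : (ℕ → Bool) → ℕ → Bool
  allBelow f zero    = true
  allBelow f (suc k) = f k ∧ allBelow f k

  allBelow-sound : ∀ f k → allBelow f k ≡ true → ∀ i → i < k → f i ≡ true
  allBelow-sound f (suc k) ok i (s≤s i≤k) with i ≟ k
  ... | yes refl = proj₁ (∧-true ok)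
  ... | no  i≢k  = allBelow-sound f k (proj₂ (∧-true {f k} ok)) i (≤∧≢⇒< i≤k i≢k)

  exhaustive : List Certificate → Bool
  exhaustive cs = allBelow (λ q → (q <ᵇ 2) ∨ candidate cs q) 842 ∧ all (candidate cs) squares

  any-coprime : ∀ q ds → any (coprimeDivisors q) ds ≡ true → ¬ IsPrimePower q
  any-coprime q (d ∷ ds) ok with ∨-true {coprimeDivisors q d} ok
  ... | inj₁ eq  = coprimeDivisors-sound q d eq
  ... | inj₂ ok′ = any-coprime q ds ok′

  module Conclusion (cs : List Certificate) (cs-valid : All (λ c → valid c ≡ true) cs) (cs-exhaustive : exhaustive cs ≡ true) where

    candidates : ∀ q → relevant q ≡ true → candidate cs q ≡ true
    candidates q ok with ∨-true {(2 ≤ᵇ q) ∧ (q ≤ᵇ 841)} ok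
    ... | inj₂ q∈ = member squares (all-sound (candidate cs) squares (proj₂ (∧-true {allBelow (λ q → (q <ᵇ 2) ∨ candidate cs q) 842} cs-exhaustive))) q∈
      where
      member : ∀ l → All (λ x → candidate cs x ≡ true) l → any (q ≡ᵇ_) l ≡ true → candidate cs q ≡ true
      member (x ∷ l) (c ∷ cs′) q∈ with ∨-true {q ≡ᵇ x} q∈
      ... | inj₁ eq  = subst (λ y → candidate cs y ≡ true) (sym (≡ᵇ⇒≡ q x (if-true eq))) c
      ... | inj₂ q∈′ = member l cs′ q∈′
    ... | inj₁ in-range with ∨-true {q <ᵇ 2} (allBelow-sound (λ q → (q <ᵇ 2) ∨ candidate cs q) 842
                               (proj₁ (∧-true {allBelow (λ q → (q <ᵇ 2) ∨ candidate cs q) 842} cs-exhaustive)) q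
                               (s≤s (≤ᵇ⇒≤ q 841 (if-true (proj₂ (∧-true {2 ≤ᵇ q} in-range))))))
    ...   | inj₂ ok′ = ok′
    ...   | inj₁ q<2 = ⊥-elim (<⇒≱ (<ᵇ⇒< q 2 (if-true q<2)) (≤ᵇ⇒≤ 2 q (if-true (proj₁ (∧-true {2 ≤ᵇ q} in-range)))))

    upperBound : ∀ q → relevant q ≡ true → IsPrimePower q → (F : FiniteField q) → ∀ t → Plane.IsT2 F t →
                 ∃[ k ] (t ≤ k × all (holds q k) claims ≡ true)
    upperBound q rel pp F t (_ , minimal) with ∨-true {q ≡ᵇ 2} (candidates q rel)
    ... | inj₁ eq with ≡ᵇ⇒≡ q 2 (if-true eq)
    ...   | refl = 4 , minimal (Fano.frame F) (Fano.frame-complete F) , refl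
    upperBound q rel pp F t (_ , minimal) | inj₂ ok with ∨-true {listed cs q} ok
    ... | inj₂ composite = ⊥-elim (any-coprime q (1 ∷ 2 ∷ 4 ∷ 6 ∷ 10 ∷ 12 ∷ 16 ∷ 18 ∷ 22 ∷ 28 ∷ []) composite pp)
    ... | inj₁ found with listed-sound cs q found
    ...   | c , c∈ , refl with ∧-true {Check.check c} (All.lookup cs-valid c∈)
    ...     | checked , bounds with Certified.completeArc c checked F
    ...       | A , complete , length≡ = Check.size c , subst (t ≤_) length≡ (minimal A complete) , bounds

    meaning : ∀ q → IsPrimePower q → (F : FiniteField q) → ∀ t → Plane.IsT2 F t → All (Meaning q t) claims
    meaning q pp F t T2 with relevant q in rel
    ... | true with upperBound q rel pp F t T2
    ...   | k , t≤k , ok = All.map (λ {cl} → holds-sound cl t≤k) (all-sound (holds q k) claims ok)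
    meaning q pp F t T2 | false = All.map (λ {cl} → vacuous cl) (all-sound within claims refl)
      where
      within : Claim → Bool
      within (claim lo hi l c a b s) = (2 ≤ᵇ lo) ∧ (hi ≤ᵇ 841) ∧ all relevant l
      contra : relevant q ≢ true
      contra rel′ with () ← trans (sym rel′) rel
      relevant-range : 2 ≤ q → q ≤ 841 → relevant q ≡ true
      relevant-range 2≤q q≤841 rewrite T-true (≤⇒≤ᵇ 2≤q) | T-true (≤⇒≤ᵇ q≤841) = refl
      vacuous : ∀ cl → within cl ≡ true → Meaning q t cl
      vacuous (claim lo hi l c a b s) ok (inj₁ (lo≤q , q≤hi)) = ⊥-elim (contra (relevant-range
        (≤-trans (≤ᵇ⇒≤ 2 lo (if-true (proj₁ (∧-true {2 ≤ᵇ lo} ok)))) lo≤q)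
        (≤-trans q≤hi (≤ᵇ⇒≤ hi 841 (if-true (proj₁ (∧-true {hi ≤ᵇ 841} (proj₂ (∧-true {2 ≤ᵇ lo} ok)))))))))
      vacuous (claim lo hi l c a b s) ok (inj₂ q∈) = ⊥-elim (contra (All.lookup (all-sound relevant l (proj₂ (∧-true {hi ≤ᵇ 841} (proj₂ (∧-true {2 ≤ᵇ lo} ok))))) q∈))

open import Data.Nat using (ℕ; _+_)
open import Data.List using (List; _∷_; [])
open import Data.List.Membership.Propositional using (_∈_)
open import Data.Sum using (_⊎_)
open import Data.Product using (_×_)
open Certificates using (Certificate; certificate; trivial; klein; hyperbolic)
open Bounds using (valid; exhaustive; all-sound; claims; Meaning; module Conclusion)
open import Data.Bool.Base using (true)
open import Data.Bool.ListAction using (all)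
open import Data.List.Base using (_++_)
open import Data.List.Relation.Unary.All using (All; head; tail)
open import Data.List.Relation.Unary.All.Properties using (++⁺)
open import Data.Nat.Properties using (+-identityʳ)
open import Data.Product.Base using (_,_)
open import Data.Sum.Base using (inj₁)
open import Data.Vec.Base using ([]; _∷_)
open import Function.Base using (_∘_)
open import Relation.Binary.PropositionalEquality using (_≡_; refl; subst)

-- The certificates by increasing order, one for each prime power in question except 2.

arcs₁ : List Certificate
arcs₁ =
  -- Here α = -1, and 228 is 11 10 01 00 in base 2: read from the right, the exponents (0 , 0), (0 ,
  -- 1), (1 , 0), (1 , 1) of the four points (±1 : ±1 : 1).
  certificate 1 2 (2 ∷ []) (trivial 1) 4 228 ∷
  certificate 2 1 (1 ∷ 1 ∷ []) (trivial 2) 6 522216 ∷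
  certificate 3 4 (2 ∷ []) (trivial 3) 6 15579765 ∷
  certificate 5 6 (3 ∷ []) (trivial 5) 6 1845028658 ∷
  certificate 6 1 (0 ∷ 1 ∷ 1 ∷ []) (trivial 6) 6 13816412890 ∷
  certificate 7 2 (1 ∷ 1 ∷ []) (trivial 7) 6 68643824850 ∷
  certificate 9 10 (2 ∷ []) (trivial 9) 7 86705351451107 ∷
  certificate 11 12 (2 ∷ []) (trivial 11) 8 184541205897143568 ∷
  certificate 14 1 (0 ∷ 0 ∷ 1 ∷ 1 ∷ []) (trivial 14) 9 1431409044889738630604 ∷
  certificate 15 16 (3 ∷ []) (trivial 15) 10 1056549272440268369169931 ∷
  certificate 17 18 (2 ∷ []) (trivial 17) 10 12505931632787709088917901 ∷
  certificate 21 22 (5 ∷ []) (trivial 21) 10 638133512214626426539767995 ∷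
  certificate 23 4 (1 ∷ 3 ∷ []) (trivial 23) 12 1296397016637471906462172288419848 ∷
  certificate 25 2 (0 ∷ 1 ∷ 2 ∷ []) (trivial 25) 12 7891782289964574141416738449105285 ∷
  certificate 27 28 (2 ∷ []) (trivial 27) 13 41358511236081975613247812055533007121 ∷
  certificate 29 30 (3 ∷ []) (trivial 29) 14 219860920985707333056654899395285302594049 ∷
  certificate 30 1 (0 ∷ 0 ∷ 1 ∷ 0 ∷ 1 ∷ []) (trivial 30) 14 538941237425629671565954167474893036709828 ∷
  certificate 35 36 (2 ∷ []) (trivial 35) 15 44457655220935508818951613193388817233057813015 ∷
  certificate 39 40 (6 ∷ []) (trivial 39) 16 1839853610067014298520148552315213815107264747571216 ∷
  certificate 41 42 (3 ∷ []) (trivial 41) 16 7832112347826429494884111630968911370717381684205872 ∷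
  certificate 45 46 (5 ∷ []) (trivial 45) 18 677067533959753593561157717665214452265238218475188023587578 ∷
  certificate 47 6 (1 ∷ 4 ∷ []) (trivial 47) 18 2810729195798242788570181089472843774306653314449184713655827 ∷
  certificate 51 52 (2 ∷ []) (trivial 51) 18 58526797058306941954571138865917479390050877273614098730758769 ∷
  certificate 57 58 (2 ∷ []) (trivial 57) 21 114213253705669026208152690300416011025057853949296078864374202937029211810 ∷
  certificate 59 60 (2 ∷ []) (klein 29) 5 215215271397144009 ∷
  certificate 62 1 (0 ∷ 0 ∷ 0 ∷ 0 ∷ 1 ∷ 1 ∷ []) (hyperbolic 62 6 8) 2 956749 ∷
  certificate 65 66 (2 ∷ []) (trivial 65) 22 111027938752898433871142731233248665382925615731059429096015118825134755098552462 ∷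
  certificate 69 70 (7 ∷ []) (trivial 69) 24 35916188593589680999474258908396919110623172293595415128825408844204317763629884781249809 ∷
  certificate 71 72 (5 ∷ []) (klein 35) 6 9443923526173025411353 ∷
  certificate 77 78 (3 ∷ []) (hyperbolic 77 5 12) 2 328548 ∷
  certificate 79 2 (0 ∷ 0 ∷ 1 ∷ 1 ∷ []) (trivial 79) 26 901864077430235087409438665978399283268063870108848041903955717731149715231681200165301013873427287 ∷
  certificate 81 82 (2 ∷ []) (trivial 81) 27 21766821511900394048711791037173327959144954276789867183346365688239138821750975031855402669606203761706 ∷
  certificate 87 88 (3 ∷ []) (klein 43) 7 824172656835750124001776512 ∷
  certificate 95 96 (5 ∷ []) (hyperbolic 95 15 5) 5 9018242584430469325 ∷
  certificate 99 100 (2 ∷ []) (klein 49) 7 4832340232481816161802340000 ∷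
  certificate 101 102 (5 ∷ []) (hyperbolic 101 16 5) 5 19720867622696041027 ∷
  certificate 105 106 (2 ∷ []) (trivial 105) 30 30591788878301263503522634966227188761396211058072505169488464670052169898222974837290218829855627606467928011548005718822 ∷
  certificate 107 108 (6 ∷ []) (klein 53) 8 156682703401582327934804770629600 ∷
  certificate 111 112 (3 ∷ []) (trivial 111) 30 869114886987352435506095138602083384956405725328672607070214088945845799242812031460624477564670563264099280370507155738479 ∷
  certificate 119 10 (1 ∷ 3 ∷ []) (hyperbolic 119 14 7) 4 4786742421533048 ∷
  certificate 123 4 (0 ∷ 1 ∷ 2 ∷ []) (trivial 123) 34 21987786923221118787135441842208638477670377098197508289021455190150014638105595047782393394838300235743160682987645422255862419183033963861409 ∷
  certificate 125 126 (3 ∷ []) (hyperbolic 125 6 17) 2 12765087 ∷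
  certificate 126 1 (0 ∷ 0 ∷ 0 ∷ 0 ∷ 0 ∷ 1 ∷ 1 ∷ []) (trivial 126) 36 29349502389609991599102484713502460905346512449300095612040477829863967925882903901545995960605917919691056160273788748653681727387353135527082395188505 ∷
  certificate 129 130 (2 ∷ []) (klein 64) 9 50560869695538614121670237182551529007 ∷
  certificate 135 136 (3 ∷ []) (klein 67) 9 125552046290432658972094768801265575879 ∷
  certificate 137 138 (2 ∷ []) (hyperbolic 137 22 5) 6 5222983797487153193612757 ∷
  certificate 147 148 (2 ∷ []) (klein 73) 9 544488494183858761571961151131866137021 ∷ []

-- Proved by evaluation: checking `refl` runs tables, scans and products for every certificate of
-- the list.
arcs₁-valid : all valid arcs₁ ≡ true
arcs₁-valid = refl

arcs₂ : List Certificate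
arcs₂ =
  certificate 149 150 (6 ∷ []) (hyperbolic 149 14 9) 4 13555370778660892 ∷
  certificate 155 156 (5 ∷ []) (klein 77) 9 1305098879145126860494399112277307331684 ∷
  certificate 161 162 (2 ∷ []) (hyperbolic 161 26 5) 7 1014841284741580947592314912472 ∷
  certificate 165 166 (5 ∷ []) (klein 82) 10 112986984888875632967610227096748368698575852 ∷
  certificate 167 12 (1 ∷ 11 ∷ []) (hyperbolic 167 7 20) 2 21338068 ∷
  certificate 171 172 (2 ∷ []) (klein 85) 10 132727317618831287449453566941594171123687232 ∷
  certificate 177 178 (2 ∷ []) (trivial 177) 42 1064222968389729735161411416451930485209902082806103399885985668539818980300314607912614889140639808136289306489762618526358778245825831401641168834329512372274407437983249180205954564326626 ∷
  certificate 179 180 (2 ∷ []) (klein 89) 11 20492091765076120311952023602758270066997258814009 ∷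
  certificate 189 190 (19 ∷ []) (trivial 189) 46 423557179639361689325388651336289604316732395495304524462660054530757290464345563827937693310295416749464968998983189775780127378463953282785153255681976379057927911421940820764363563888984255804511705514834574 ∷
  certificate 191 192 (5 ∷ []) (klein 95) 11 81401555534146933931405325525282369618804119175173 ∷
  certificate 195 196 (2 ∷ []) (hyperbolic 195 27 6) 6 411405454235292504819069816 ∷
  certificate 197 198 (3 ∷ []) (klein 98) 11 167260349407492173108457705868348116067623616004937 ∷
  certificate 209 210 (2 ∷ []) (hyperbolic 209 29 6) 7 41193358984388635673577050287090 ∷
  certificate 221 222 (3 ∷ []) (klein 110) 12 100075411213231149471232581846442008603141731793036832144 ∷
  certificate 225 226 (2 ∷ []) (klein 112) 12 148117088431585968706630622151748482790522597022898106431 ∷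
  certificate 227 228 (6 ∷ []) (trivial 227) 50 60746467475537859900382851193606453956330451198011432895576906313044230057188539449264834983112478838646954064157779705544335850883430278469107882197499456129451052174895351544720253781896709967420751224855210555534403909257526326967772 ∷
  certificate 231 232 (3 ∷ []) (hyperbolic 231 28 7) 6 2798056053780371405015961670 ∷
  certificate 237 238 (7 ∷ []) (klein 118) 13 29887733882084072962783467793403017653219267749783717832468444 ∷
  certificate 239 240 (7 ∷ []) (klein 119) 13 37189067259352456464741180601054730987307664760900976902803200 ∷
  certificate 241 2 (0 ∷ 0 ∷ 0 ∷ 1 ∷ 2 ∷ []) (klein 120) 13 46490546690547869795499399410226651220126862583696303906222876 ∷
  certificate 249 250 (6 ∷ []) (hyperbolic 249 9 24) 2 107251576 ∷
  certificate 254 1 (0 ∷ 0 ∷ 0 ∷ 1 ∷ 1 ∷ 1 ∷ 0 ∷ 1 ∷ []) (trivial 254) 54 80163260969924722670728482850167520835364310329311535399728700886518308376329813043313988380837828227560505417567467982899580086246728000212658282288078429962906028557870223904959158169827247388634400690251699091438116717129608377517933972997522237389261734155 ∷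
  certificate 255 256 (3 ∷ []) (klein 127) 13 175328212974294883969990387487943408237769584350659606649634816 ∷
  certificate 261 262 (5 ∷ []) (klein 130) 13 373559147371888031126560956976258061426828940561832268960214336 ∷
  certificate 267 268 (2 ∷ []) (klein 133) 13 606815006680322524042548051561768477637934460202252205687939376 ∷
  certificate 269 270 (6 ∷ []) (klein 134) 14 55130011171024305678398090466837278385561955101403973649686594457369 ∷
  certificate 275 276 (5 ∷ []) (klein 137) 14 109463214597142085441831563177801231433872002391387634661263902329632 ∷
  certificate 279 280 (3 ∷ []) (trivial 279) 58 72818354889777274015357822505993689527675282458582785502191416132158450985300480927784775459504621440197086398119626215686283452937521951161512031140539586472114605996798744694823446387333916133086702311367368413282631443398462296647990076865408658856872149147483407866299852539497542 ∷
  certificate 281 282 (3 ∷ []) (klein 140) 14 185404195465282194380244027367941056296319336996577924051516433006082 ∷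
  certificate 287 16 (1 ∷ 7 ∷ []) (klein 143) 15 29283694008593306427679630363047412357336723354434286811220653834772928512 ∷
  certificate 291 292 (2 ∷ []) (klein 145) 15 44902890800196730860521054505654324059539006862739535091657528305604707108 ∷
  certificate 305 306 (5 ∷ []) (hyperbolic 305 50 5) 10 8032779160674764166122688332555440366175547482317 ∷
  certificate 309 310 (17 ∷ []) (hyperbolic 309 9 30) 2 284362849 ∷
  certificate 311 312 (10 ∷ []) (hyperbolic 311 25 11) 5 713313348766692851650552 ∷
  certificate 315 316 (2 ∷ []) (klein 157) 15 443221591439591576398627253611815077532119937114596676885091305977840203492 ∷ []

arcs₂-valid : all valid arcs₂ ≡ true
arcs₂-valid = refl

arcs₃ : List Certificate
arcs₃ =
  certificate 329 330 (3 ∷ []) (hyperbolic 329 21 14) 4 3527011902549198450 ∷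
  certificate 335 336 (10 ∷ []) (hyperbolic 335 20 15) 4 4030439289855843820 ∷
  certificate 341 6 (0 ∷ 1 ∷ 5 ∷ []) (hyperbolic 341 56 5) 11 7607450885901245978481919338666464769626416384283661782 ∷
  certificate 345 346 (2 ∷ []) (klein 172) 15 6324447181115933090184091947497948020035191437631939606375277335252537475367 ∷
  certificate 347 348 (2 ∷ []) (hyperbolic 347 57 5) 11 13254307799128021104877684247524136186474693253631539771 ∷
  certificate 351 352 (3 ∷ []) (hyperbolic 351 21 15) 4 13344031543276436417 ∷
  certificate 357 358 (7 ∷ []) (trivial 357) 66 12870473295337063235608672441258581957172139166339317281941046010220623876610113485533707549704821892958924329301453412736741090431327505869030702350623648075458082237712725729673067741035911007669317013963479764997981774843677583369738168371029314304410907910583946811040308436899230300937008080983356628169935889514154923380292783982196 ∷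
  certificate 359 18 (1 ∷ 5 ∷ []) (hyperbolic 359 44 7) 8 8796956810600076747220252230506299226166 ∷
  certificate 365 366 (6 ∷ []) (klein 182) 17 684586383227529613688720638425673858462718029577694924600732467418540770058472150630218 ∷
  certificate 371 372 (2 ∷ []) (hyperbolic 371 11 30) 2 229718956 ∷
  certificate 377 378 (2 ∷ []) (hyperbolic 377 26 13) 5 3569554098640960457843147 ∷
  certificate 381 382 (5 ∷ []) (trivial 381) 70 30758070386634076319209572483113169028891160527235479765637376131653634955011560185589172627757628968011544951287361418147785497294778535392029108360988120488156045260720746065019451896909860441059061165807280894481691970257109110944225302228795378323741575935662716468848843073950894662379982175846851729439446953034034496835375722631600888450600594902063751570 ∷
  certificate 387 388 (2 ∷ []) (klein 193) 18 756977767329801191988834708296170471211748222754620571627450487985639449621519885358397075860 ∷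
  certificate 395 396 (5 ∷ []) (hyperbolic 395 21 17) 4 23249776386313143701 ∷
  certificate 399 400 (3 ∷ []) (hyperbolic 399 49 7) 9 8231776423877522393825985850560685133690562089 ∷
  certificate 407 408 (21 ∷ []) (hyperbolic 407 23 16) 4 36178009780300681810 ∷
  certificate 417 418 (2 ∷ []) (hyperbolic 417 10 37) 2 38439291 ∷
  certificate 419 420 (2 ∷ []) (hyperbolic 419 11 34) 2 212033954 ∷
  certificate 429 430 (7 ∷ []) (klein 214) 19 5577727267511299010108085649815189794248736421558658924466646325853354941866913777711562727246250200 ∷
  certificate 431 432 (5 ∷ []) (hyperbolic 431 23 17) 4 59857263246708554884 ∷
  certificate 437 438 (15 ∷ []) (hyperbolic 437 72 5) 13 78786863623176202880621939914669893631896422908644099241718788495790 ∷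
  certificate 441 442 (2 ∷ []) (hyperbolic 441 33 12) 6 4273739833378155454192572848297 ∷
  certificate 447 448 (3 ∷ []) (klein 223) 19 27678697003271003820497796438616064405078626279227760427442403737275236275438322241523423451034013696 ∷
  certificate 455 456 (13 ∷ []) (hyperbolic 455 11 37) 2 369919743 ∷
  certificate 459 460 (2 ∷ []) (hyperbolic 459 22 19) 4 48006474962632959631 ∷
  certificate 461 462 (3 ∷ []) (klein 230) 20 18626499658110925580702778044603865074465037734587428497622891674146313824626814557449146476009681768769251 ∷
  certificate 465 466 (2 ∷ []) (klein 232) 19 116746200528835037387810140938783770929419896087857093597695198767958665123375710596059380542628020084 ∷
  certificate 477 478 (13 ∷ []) (klein 238) 19 318261474593933796902585376201787835010744282891680284258511372029867543370815503047774300352417687816 ∷ []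

arcs₃-valid : all valid arcs₃ ≡ true
arcs₃-valid = refl

arcs₄ : List Certificate
arcs₄ =
  certificate 485 486 (3 ∷ []) (klein 242) 19 545297343534202378889953037638547929799341508603598409450971196243951836670405174283152711882581228564 ∷
  certificate 489 490 (2 ∷ []) (hyperbolic 489 48 9) 8 1054200504602054460420156238731690526910622 ∷
  certificate 497 498 (7 ∷ []) (hyperbolic 497 82 5) 14 494661008528952269267141291140392070487551020388190830383347665236014930823 ∷
  certificate 501 502 (5 ∷ []) (klein 250) 21 125560506853219363568185139223880326612052532185730259262288813091718202806264929132989627686211779062151635286427 ∷
  certificate 507 508 (2 ∷ []) (klein 253) 21 217184770530596072973968407433984269496875020473954394531413709300624633296092720489921438539854218669137655502635 ∷
  certificate 510 1 (0 ∷ 0 ∷ 0 ∷ 0 ∷ 1 ∷ 0 ∷ 0 ∷ 0 ∷ 1 ∷ []) (hyperbolic 510 72 6) 12 12728800883668649290801946540153699877541379030807114886191193156 ∷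
  certificate 519 520 (3 ∷ []) (hyperbolic 519 25 19) 4 170304566857226718062 ∷
  certificate 521 522 (2 ∷ []) (hyperbolic 521 86 5) 14 1929826538940390593640441233287795505704293263894442961058435818860918400147 ∷
  certificate 527 22 (1 ∷ 4 ∷ []) (hyperbolic 527 43 11) 7 5907818259508773051251095115115434168 ∷
  certificate 539 540 (2 ∷ []) (hyperbolic 539 26 19) 4 254173477330350798113 ∷
  certificate 545 546 (2 ∷ []) (hyperbolic 545 25 20) 4 320213620133495776292 ∷
  certificate 555 556 (2 ∷ []) (klein 277) 21 8912215830613904686776142056662486030003301298603478329239920519906498074995685981694970229231466984732551364213740 ∷
  certificate 561 562 (2 ∷ []) (klein 280) 21 14596706589257401040328906095911883676715716569099181349712495342116070636823998300268163696450692916631115389171836 ∷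
  certificate 567 568 (3 ∷ []) (trivial 567) 90 6054948019125286916213416834199463149174651072859971411033697947958410051665279881993128779705458135766638395038179203885772183541527699252610103804860148677718704634409743777385423333758877122061314943902677609393232088270502116612579292139215859750590999515925701937905174099247797953796396504148036114419245030960250494672366208830100264673188383849531723292221532043202604406535278219284939685904247752177812662442795803743448936847531357287354166209774428701290319541046940392482290153258035 ∷
  certificate 569 570 (3 ∷ []) (hyperbolic 569 37 14) 6 54022772161591948111951163115946 ∷
  certificate 575 576 (5 ∷ []) (hyperbolic 575 31 17) 5 219758922090642028517988594 ∷
  certificate 585 586 (2 ∷ []) (trivial 585) 90 1643041273976626495199520545175275594969020679299038728931411986576645216204665467556281851262953072507279509482677581642683942849440171926369504340611670966267887192221105451498666103071352250640661688250477151155794510301188579561886679459070181487039279218947778298388358042120590924303991433810284298514466220270216892406236622491268773448186390682544134712629060373379249028563074692740259706782233889764456008785356529321464775845798219460150411428056735934062495248727735480495737281772630870 ∷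
  certificate 591 592 (3 ∷ []) (trivial 591) 90 10416486580675613374078161709553151787544351779466542356229787859646817234634198549278310155319079282990648853565469977394298248066648645581781879858878680282111758373587954168932745675375129017931958414503191795556402202261944598433328214823085499665825143549315346456848064035581304514867025474954068487531467185917300201516339301709524727014187744391256816744679597291513257294850499680806433198722770919401335260508055590610165918094295328241531754162284956421700393789726919128129692054663413545 ∷
  certificate 597 598 (7 ∷ []) (hyperbolic 597 25 22) 4 474502244465478759833 ∷
  certificate 599 600 (7 ∷ []) (hyperbolic 599 39 14) 6 122819227794818032397851174328543 ∷
  certificate 605 606 (3 ∷ []) (klein 302) 23 47717703490534212644956012699059779393501802860030730266092057944809929578220524532900357013325624406040228461178287872182949986 ∷
  certificate 611 612 (2 ∷ []) (hyperbolic 611 50 11) 8 28944796303397335480467666000333206940936152 ∷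
  certificate 615 616 (3 ∷ []) (hyperbolic 615 27 21) 4 919865026215972873567 ∷
  certificate 617 618 (2 ∷ []) (hyperbolic 617 102 5) 16 31628615463834965665456257725388861167890099883573646459360340026210079418452866193375575 ∷ []

arcs₄-valid : all valid arcs₄ ≡ true
arcs₄-valid = refl

arcs₅ : List Certificate
arcs₅ =
  certificate 623 4 (0 ∷ 1 ∷ 1 ∷ 2 ∷ []) (hyperbolic 623 12 47) 2 283855794 ∷
  certificate 629 630 (3 ∷ []) (hyperbolic 629 13 44) 2 1992045993 ∷
  certificate 639 640 (3 ∷ []) (hyperbolic 639 39 15) 6 241099491471592376764468647122579 ∷
  certificate 641 642 (11 ∷ []) (klein 320) 24 280863139973320304988797140176930596767082464263805237960367316203788349278345698508471128182271819391411145636769459863595361866335636 ∷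
  certificate 645 646 (5 ∷ []) (klein 322) 24 381055821732975358489037660724266932767671385630858207262046725541375504985184133074422375146002597193828823958646975419840442284285152 ∷
  certificate 651 652 (2 ∷ []) (klein 325) 25 256565311100543739118286214935681092281517721592328151105822516276165524490884897537582403121883231815555455678864485949966109605024579004144 ∷
  certificate 657 658 (2 ∷ []) (hyperbolic 657 13 46) 2 1839235166 ∷
  certificate 659 660 (2 ∷ []) (hyperbolic 659 43 14) 6 433128579529642979496279150014522 ∷
  certificate 671 672 (5 ∷ []) (hyperbolic 671 27 23) 4 1045783964701223133911 ∷
  certificate 675 676 (2 ∷ []) (klein 337) 25 1549975602054365323620848624962860109140228274531439262174659688887192435164300193768896182850828177192085446361236386904512653410261140976512 ∷
  certificate 681 682 (5 ∷ []) (klein 340) 25 2423338707403113739579986643229225648244489363938527941660927506718100721167170838936097191433134025849843409970453495309892780269037468809512 ∷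
  certificate 689 690 (3 ∷ []) (hyperbolic 689 29 22) 4 2090053815503815045001 ∷
  certificate 699 700 (2 ∷ []) (hyperbolic 699 27 24) 4 2104627229259525250929 ∷
  certificate 707 708 (2 ∷ []) (klein 353) 25 15745673577283284344639301392631475820694675437271420370930112974501828828703238925955616944169098246251799315784108146142685364991222724178928 ∷
  certificate 717 718 (11 ∷ []) (klein 358) 25 31741075681213874712577574806158143476653125429915640011267805989757705613897691204478903320397096888197412336912033964947262087134559011005424 ∷
  certificate 725 726 (5 ∷ []) (klein 362) 25 52369799856887320969848397373227916772900283441289487585726161853913276750004115113052909043530165407072334118642571064527423819924459678812512 ∷
  certificate 727 2 (0 ∷ 0 ∷ 0 ∷ 0 ∷ 1 ∷ 1 ∷ []) (hyperbolic 727 13 51) 2 3306046248 ∷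
  certificate 731 732 (6 ∷ []) (klein 365) 26 44966086092599966585783581863985323814167788541741189691021338815666855070245717739948743025754680035798639362206803920917613717273704901441339790737 ∷
  certificate 737 738 (3 ∷ []) (klein 368) 25 123732780581967602121824645684401811759242534920234287937890920580127572633265052992053330339313584302970073569164106918477935886941231593588576 ∷ []

arcs₅-valid : all valid arcs₅ ≡ true
arcs₅-valid = refl

arcs₆ : List Certificate
arcs₆ =
  certificate 741 742 (5 ∷ []) (hyperbolic 741 13 52) 2 4406722232 ∷
  certificate 749 750 (3 ∷ []) (hyperbolic 749 29 24) 4 2795869235398803201468 ∷
  certificate 755 756 (2 ∷ []) (hyperbolic 755 13 53) 2 2507332441 ∷
  certificate 759 760 (6 ∷ []) (klein 379) 27 176543594454130513477516743171076522103642958699344970580760126469664849566515605181169211586783455907348747314132174940908037469938793036514620371417366734 ∷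
  certificate 767 768 (11 ∷ []) (hyperbolic 767 63 11) 9 719014896827484357758718835604778594966973107339416 ∷
  certificate 771 772 (2 ∷ []) (klein 385) 27 421465639367978095151257907560684345934095433571544853405928758975344823656341229874550444204012050570238896729862043551363973543397497088096455724564990635 ∷
  certificate 785 786 (2 ∷ []) (klein 392) 27 1049361258043009149504856568933461362740465551103923701495429670462617600037797970498339502103693745520480461067048013991725815694859257905541796570022027748 ∷
  certificate 795 796 (2 ∷ []) (klein 397) 27 2208224262263260516873900563947113867443723122775921578089668196187943127216971465175808322375906489003074861785055040665686826137376943652983873969056120383 ∷
  certificate 807 808 (3 ∷ []) (hyperbolic 807 100 7) 14 318298492220952212450017752331667954079643224304017286135955673356703083216259676 ∷
  certificate 809 810 (3 ∷ []) (hyperbolic 809 29 26) 4 4691158389066373181770 ∷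
  certificate 819 820 (2 ∷ []) (klein 409) 27 10940247583112376223932919040507560637519569284179748253464141399354050939758226813840479187582574673573096075823256252897203685892119708861382712381711918515 ∷
  certificate 821 822 (3 ∷ []) (klein 410) 27 12591385952863144472596216998981569823074341664126175078881120780438949310325039233255057056895882280769827933417751164222307233371617090020096639708625510889 ∷
  certificate 825 826 (2 ∷ []) (hyperbolic 825 58 13) 8 2884909500823187552358736756952826130319368952 ∷
  certificate 827 828 (2 ∷ []) (hyperbolic 827 45 17) 6 5576529883632721601988943250783487 ∷
  certificate 837 838 (11 ∷ []) (trivial 837) 114 3158199320883589064430255121109952305483942000246824458681414885201942349635230835954059320505942650458990507066441626373598150207751636224100367440409442109913359758914107886353397236848945643404494322229069862259506915817794343234750369459374231534983807245362169655151376811573043604340783245835195452599114625960285457077760126050802012398673463849927018497939087707773080141363545360886255250497696650965564575283894876415041479794861441870511429363449314941704395864442482188605055019913986538830925804609398096253111341564510223736339694100589612247309739339862006995969165624113239008204682917347869444068643572293776728859986089374777432454583284326264861640 ∷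
  -- From here on q = s^2. The period s + 1 makes α^(s+1) a generator of the multiplicative group of
  -- the subfield of order s; four orbits of length s - 1 give 4 √q - 4 points, so the bound with
  -- constant 4 is met with equality.
  certificate 839 28 (1 ∷ 15 ∷ []) (hyperbolic 839 29 27) 4 6771980514234536913677 ∷
  certificate 959 30 (1 ∷ 7 ∷ []) (hyperbolic 959 31 29) 4 20051927846580313508779 ∷
  certificate 1022 1 (0 ∷ 0 ∷ 0 ∷ 0 ∷ 0 ∷ 0 ∷ 1 ∷ 0 ∷ 0 ∷ 1 ∷ []) (hyperbolic 1022 32 30) 4 33465124121000862903427 ∷
  certificate 1367 36 (1 ∷ 15 ∷ []) (hyperbolic 1367 37 35) 4 336221680221226097051131 ∷
  certificate 1679 40 (1 ∷ 7 ∷ []) (hyperbolic 1679 41 39) 4 1336956233096693874892595 ∷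
  certificate 2399 6 (0 ∷ 1 ∷ 1 ∷ 4 ∷ []) (hyperbolic 2399 49 47) 4 16957716169310626642632080 ∷ []

arcs₆-valid : all valid arcs₆ ≡ true
arcs₆-valid = refl

arcs : List Certificate
arcs = arcs₁ ++ arcs₂ ++ arcs₃ ++ arcs₄ ++ arcs₅ ++ arcs₆

arcs-valid : All (λ c → valid c ≡ true) arcs
arcs-valid = ++⁺ (all-sound valid arcs₁ arcs₁-valid) (++⁺ (all-sound valid arcs₂ arcs₂-valid) (++⁺ (all-sound valid arcs₃ arcs₃-valid)
  (++⁺ (all-sound valid arcs₄ arcs₄-valid) (++⁺ (all-sound valid arcs₅ arcs₅-valid) (all-sound valid arcs₆ arcs₆-valid)))))

arcs-exhaustive : exhaustive arcs ≡ true
arcs-exhaustive = refl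

theorem4 : ∀ (q : ℕ) → IsPrimePower q → (F : FiniteField q) → ∀ (t : ℕ) → Plane.IsT2 F t →
    ((q ∈[ 2 , 841 ] ⊎ q ∈ (961 ∷ 1024 ∷ 1369 ∷ 1681 ∷ 2401 ∷ [])) → t <[ 4 / 1 ]√ q)
  × ((q ∈[ 2 , 89 ] ⊎ q ∈ (101 ∷ [])) → t ≤[ 3 / 1 ]√ q)
  × (q ∈[ 2 , 277 ] → t <[ 7 / 2 ]√ q)
  × ((q ∈[ 2 , 509 ] ⊎ q ∈ (521 ∷ 523 ∷ 529 ∷ 601 ∷ 661 ∷ [])) → t <[ 19 / 5 ]√ q)
  × ((q ∈[ 37 , 211 ] ⊎ q ∈ (23 ∷ 227 ∷ 229 ∷ 233 ∷ 241 ∷ 243 ∷ 256 ∷ 257 ∷ 661 ∷ [])) → (t + 9) ≤[ 4 / 1 ]√ q)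
  × ((q ∈[ 23 , 307 ] ⊎ q ∈ (317 ∷ 343 ∷ 601 ∷ 661 ∷ [])) → (t + 8) ≤[ 4 / 1 ]√ q)
  × ((q ∈[ 19 , 353 ] ⊎ q ∈ (16 ∷ 361 ∷ 373 ∷ 383 ∷ 601 ∷ 661 ∷ [])) → (t + 7) ≤[ 4 / 1 ]√ q)
  × ((q ∈[ 9 , 409 ] ⊎ q ∈ (421 ∷ 431 ∷ 433 ∷ 443 ∷ 463 ∷ 601 ∷ 661 ∷ [])) → (t + 6) ≤[ 4 / 1 ]√ q)
  × ((q ∈[ 8 , 499 ] ⊎ q ∈ (509 ∷ 521 ∷ 523 ∷ 529 ∷ 601 ∷ 661 ∷ [])) → (t + 5) ≤[ 4 / 1 ]√ q)
  × ((q ∈[ 7 , 557 ] ⊎ q ∈ (569 ∷ 577 ∷ 601 ∷ 625 ∷ 661 ∷ 729 ∷ 841 ∷ 961 ∷ 1024 ∷ 1369 ∷ 1681 ∷ 2401 ∷ [])) → (t + 4) ≤[ 4 / 1 ]√ q)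
  × ((q ∈[ 7 , 641 ] ⊎ q ∈ (661 ∷ 729 ∷ 841 ∷ 961 ∷ 1024 ∷ 1369 ∷ 1681 ∷ 2401 ∷ [])) → (t + 3) <[ 4 / 1 ]√ q)
  × ((q ∈[ 3 , 691 ] ⊎ q ∈ (709 ∷ 729 ∷ 841 ∷ 961 ∷ 1024 ∷ 1369 ∷ 1681 ∷ 2401 ∷ [])) → (t + 2) ≤[ 4 / 1 ]√ q)
  × ((q ∈[ 2 , 761 ] ⊎ q ∈ (841 ∷ 961 ∷ 1024 ∷ 1369 ∷ 1681 ∷ 2401 ∷ [])) → (t + 1) <[ 4 / 1 ]√ q)
theorem4 q pp F t T2 =
  plain (_<[ 4 / 1 ]√ q) ∘ head m₁ , plain (_≤[ 3 / 1 ]√ q) ∘ head m₂ , plain (_<[ 7 / 2 ]√ q) ∘ head m₃ ∘ inj₁ , plain (_<[ 19 / 5 ]√ q) ∘ head m₄ ,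
  head m₅ , head m₆ , head m₇ , head m₈ , head m₉ , head m₁₀ , head m₁₁ , head m₁₂ , head m₁₃
  where
  -- Claims without a constant have c = 0 and speak of t + 0.
  plain : (P : ℕ → Set) → P (t + 0) → P t
  plain P = subst P (+-identityʳ t)
  m₁ : All (Meaning q t) claims
  m₁ = Conclusion.meaning arcs arcs-valid arcs-exhaustive q pp F t T2
  m₂ = tail m₁
  m₃ = tail m₂
  m₄ = tail m₃
  m₅ = tail m₄
  m₆ = tail m₅
  m₇ = tail m₆
  m₈ = tail m₇
  m₉ = tail m₈
  m₁₀ = tail m₉
  m₁₁ = tail m₁₀
  m₁₂ = tail m₁₁
  m₁₃ = tail m₁₂
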